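{- There is a universal constant $c_0>0$ such that the following holds. Let $n,k,\Delta_1,\Delta_2$ be nonnegative integers with $n-\Delta_1=k-\Delta_2\ge0$, let $\Delta=\Delta_1+\Delta_2$, and suppose $\min(k,\Delta)\ge2$. Then there exists an $(n,k,\Delta_1,\Delta_2)$-adversary for Steiner tree with predictions such that every randomized online algorithm has competitive ratio at least $c_0\log\min(k,\Delta)$ against this adversary.
   Context: Online Steiner tree with predictions: a finite connected undirected graph with nonnegative edge costs, a root $\rho$, and a predicted set of terminals $\hat R\subseteq V$ are given offline. The actual terminals $R\subseteq V$ arrive one at a time, and upon each arrival the algorithm must irrevocably buy edges so that the new terminal is connected to $\rho$. The cost is the total cost of bought edges, and $\mathrm{OPT}$ is the optimal offline cost for $R$. An $(n,k,\Delta_1,\Delta_2)$-adversary is an oblivious adversary (possibly randomized; its choices do not depend on the algorithm's decisions or random bits) that produces an instance with prediction $\hat R$ and request sequence $R$ satisfying $|\hat R|=n$, $|R|=k$, $|\hat R\setminus R|=\Delta_1$, $|R\setminus\hat R|=\Delta_2$. An algorithm has competitive ratio at least $\alpha$ against the adversary if its expected cost is at least $\alpha$ times the expected optimal cost, the latter being positive, with expectation over the adversary's and the algorithm's randomness. -}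

module Defs where

open import Data.Bool.Base using (Bool; true; false; not; _∧_; if_then_else_)
import Data.Bool.Properties as Bool
open import Data.Fin.Base using (Fin)
open import Data.Fin.Subset
  using (Subset; inside; outside; _∈_; ⊤; ⊥; ⁅_⁆; _∪_; _─_; ⋃; ∣_∣)
import Data.Integer.Base as ℤ
import Data.Integer.Properties as ℤ
open import Data.List.Base using (List; []; _∷_; map)
open import Data.List.Relation.Unary.Unique.Propositional using (Unique)
open import Data.Nat.Base as ℕ using (ℕ; zero; suc; _⊔_; z≤n; s≤s)
open import Data.Nat.Induction using (<-wellFounded)
open import Data.Nat.Logarithm using (⌊log₂_⌋; ⌊log₂⌋-mono-≤; ⌊log₂[2^n]⌋≡n)
open import Data.Nat.Logarithm.Core using (⌊log2⌋)
import Data.Nat.Properties as ℕ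
open import Data.Product.Base using (Σ; ∃; _×_; _,_; proj₁; proj₂)
open import Data.Rational.Base as ℚ using (ℚ; mkℚ; 0ℚ; 1ℚ; ½)
import Data.Rational.Properties as ℚ
open import Data.Rational.Solver using (module +-*-Solver)
import Data.Rational.Unnormalised.Base as ℚᵘ
import Data.Rational.Unnormalised.Properties as ℚᵘ
open import Data.Sum.Base using (_⊎_; inj₁; inj₂)
open import Data.Vec.Base using ([]; _∷_; lookup)
import Data.Vec.Functional as Vector
open import Data.Vec.Properties using (≡-dec)
open import Function.Base using (_∘_)
open import Function.Bundles using (_⇔_)
open import Induction.WellFounded using (Acc; acc)
open import Relation.Binary.Construct.Closure.ReflexiveTransitive using (Star)
open import Relation.Binary.PropositionalEquality
open import Relation.Nullary.Decidable.Core using (does)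
open import Relation.Nullary.Negation.Core using (¬_)

IsCauchy : (ℕ → ℚ) → Set
IsCauchy x = ∀ ε → ℚ.Positive ε →
  ∃ λ N → ∀ i j → N ℕ.≤ i → N ℕ.≤ j → ℚ.∣ x i ℚ.- x j ∣ ℚ.≤ ε

-- Equality of reals is _≈_ below, not _≡_.
record ℝ : Set where
  constructor mkℝ
  field
    seq    : ℕ → ℚ
    cauchy : IsCauchy seq

open ℝ public

infix 4 _≤ᴿ_ _<ᴿ_ _≈_

_≤ᴿ_ : ℝ → ℝ → Set
x ≤ᴿ y = ∀ ε → ℚ.Positive ε → ∃ λ N → ∀ i → N ℕ.≤ i → seq x i ℚ.≤ seq y i ℚ.+ ε

_<ᴿ_ : ℝ → ℝ → Set
x <ᴿ y = ∃ λ ε → ℚ.Positive ε × ∃ λ N → ∀ i → N ℕ.≤ i → seq x i ℚ.+ ε ℚ.≤ seq y i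

_≈_ : ℝ → ℝ → Set
x ≈ y = x ≤ᴿ y × y ≤ᴿ x

fromℚ : ℚ → ℝ
fromℚ q = mkℝ (λ _ → q) λ where
  ε ε>0 → 0 , λ _ _ _ _ →
    subst (λ d → ℚ.∣ d ∣ ℚ.≤ ε) (sym (ℚ.+-inverseʳ q)) (ℚ.<⇒≤ (ℚ.positive⁻¹ ε {{ε>0}}))

0ᴿ 1ᴿ : ℝ
0ᴿ = fromℚ 0ℚ
1ᴿ = fromℚ 1ℚ

infixl 6 _+ᴿ_
infixl 7 _*ᴿ_

_+ᴿ_ : ℝ → ℝ → ℝ
mkℝ x cx +ᴿ mkℝ y cy = mkℝ (λ i → x i ℚ.+ y i) c
  where
  c : IsCauchy (λ i → x i ℚ.+ y i)
  c ε ε>0 with cx (½ ℚ.* ε) (ℚ.pos*pos⇒pos ½ ε {{ε>0}})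
             | cy (½ ℚ.* ε) (ℚ.pos*pos⇒pos ½ ε {{ε>0}})
  ... | M , hx | N , hy = M ⊔ N , λ i j p q → begin
    ℚ.∣ (x i ℚ.+ y i) ℚ.- (x j ℚ.+ y j) ∣
      ≡⟨ cong ℚ.∣_∣ (solve 4 (λ a b a′ b′ →
           (a :+ b) :- (a′ :+ b′) := (a :- a′) :+ (b :- b′)) refl (x i) (y i) (x j) (y j)) ⟩
    ℚ.∣ (x i ℚ.- x j) ℚ.+ (y i ℚ.- y j) ∣
      ≤⟨ ℚ.∣p+q∣≤∣p∣+∣q∣ (x i ℚ.- x j) (y i ℚ.- y j) ⟩
    ℚ.∣ x i ℚ.- x j ∣ ℚ.+ ℚ.∣ y i ℚ.- y j ∣
      ≤⟨ ℚ.+-mono-≤ (hx i j (ℕ.m⊔n≤o⇒m≤o M N p) (ℕ.m⊔n≤o⇒m≤o M N q))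
                    (hy i j (ℕ.m⊔n≤o⇒n≤o M N p) (ℕ.m⊔n≤o⇒n≤o M N q)) ⟩
    ½ ℚ.* ε ℚ.+ ½ ℚ.* ε
      ≡⟨ sym (ℚ.*-distribʳ-+ ε ½ ½) ⟩
    (½ ℚ.+ ½) ℚ.* ε
      ≡⟨ ℚ.*-identityˡ ε ⟩
    ε ∎
    where
    open +-*-Solver
    open ℚ.≤-Reasoning

eventuallyBounded : ∀ {x} → IsCauchy x →
  ∃ λ B → ℚ.Positive B × ∃ λ N → ∀ i → N ℕ.≤ i → ℚ.∣ x i ∣ ℚ.≤ B
eventuallyBounded {x} cx with cx 1ℚ _
... | N , h = 1ℚ ℚ.+ ℚ.∣ x N ∣
            , ℚ.pos+nonNeg⇒pos 1ℚ ℚ.∣ x N ∣ {{ℚ.∣-∣-nonNeg (x N)}}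
            , N , λ i p → begin
  ℚ.∣ x i ∣
    ≡⟨ cong ℚ.∣_∣ (solve 2 (λ a b → a := (a :- b) :+ b) refl (x i) (x N)) ⟩
  ℚ.∣ (x i ℚ.- x N) ℚ.+ x N ∣
    ≤⟨ ℚ.∣p+q∣≤∣p∣+∣q∣ (x i ℚ.- x N) (x N) ⟩
  ℚ.∣ x i ℚ.- x N ∣ ℚ.+ ℚ.∣ x N ∣
    ≤⟨ ℚ.+-monoˡ-≤ ℚ.∣ x N ∣ (h i N p ℕ.≤-refl) ⟩
  1ℚ ℚ.+ ℚ.∣ x N ∣ ∎
  where
  open +-*-Solver
  open ℚ.≤-Reasoning

*-mono-∣∣ : ∀ a b c d → ℚ.∣ a ∣ ℚ.≤ c → ℚ.∣ b ∣ ℚ.≤ d → ℚ.Positive c →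
            ℚ.∣ a ℚ.* b ∣ ℚ.≤ c ℚ.* d
*-mono-∣∣ a b c d a≤c b≤d c>0 = begin
  ℚ.∣ a ℚ.* b ∣        ≡⟨ ℚ.∣p*q∣≡∣p∣*∣q∣ a b ⟩
  ℚ.∣ a ∣ ℚ.* ℚ.∣ b ∣  ≤⟨ ℚ.*-monoʳ-≤-nonNeg ℚ.∣ b ∣ {{ℚ.∣-∣-nonNeg b}} a≤c ⟩
  c ℚ.* ℚ.∣ b ∣        ≤⟨ ℚ.*-monoˡ-≤-nonNeg c {{ℚ.pos⇒nonNeg c {{c>0}}}} b≤d ⟩
  c ℚ.* d              ∎
  where open ℚ.≤-Reasoning

*-difference : ∀ a b a′ b′ →
  a ℚ.* b ℚ.- a′ ℚ.* b′ ≡ a ℚ.* (b ℚ.- b′) ℚ.+ b′ ℚ.* (a ℚ.- a′)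
*-difference = solve 4 (λ a b a′ b′ →
  a :* b :- a′ :* b′ := a :* (b :- b′) :+ b′ :* (a :- a′)) refl
  where open +-*-Solver

*-difference-≤ : ∀ {B C δ} a b a′ b′ → ℚ.Positive B → ℚ.Positive C →
  ℚ.∣ a ∣ ℚ.≤ B → ℚ.∣ b′ ∣ ℚ.≤ C → ℚ.∣ a ℚ.- a′ ∣ ℚ.≤ δ → ℚ.∣ b ℚ.- b′ ∣ ℚ.≤ δ →
  ℚ.∣ a ℚ.* b ℚ.- a′ ℚ.* b′ ∣ ℚ.≤ (B ℚ.+ C) ℚ.* δ
*-difference-≤ {B} {C} {δ} a b a′ b′ B>0 C>0 a≤ b′≤ a-a′≤ b-b′≤ = begin
  ℚ.∣ a ℚ.* b ℚ.- a′ ℚ.* b′ ∣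
    ≡⟨ cong ℚ.∣_∣ (*-difference a b a′ b′) ⟩
  ℚ.∣ a ℚ.* (b ℚ.- b′) ℚ.+ b′ ℚ.* (a ℚ.- a′) ∣
    ≤⟨ ℚ.∣p+q∣≤∣p∣+∣q∣ (a ℚ.* (b ℚ.- b′)) (b′ ℚ.* (a ℚ.- a′)) ⟩
  ℚ.∣ a ℚ.* (b ℚ.- b′) ∣ ℚ.+ ℚ.∣ b′ ℚ.* (a ℚ.- a′) ∣
    ≤⟨ ℚ.+-mono-≤ (*-mono-∣∣ a (b ℚ.- b′) B δ a≤ b-b′≤ B>0)
                  (*-mono-∣∣ b′ (a ℚ.- a′) C δ b′≤ a-a′≤ C>0) ⟩
  B ℚ.* δ ℚ.+ C ℚ.* δ
    ≡⟨ sym (ℚ.*-distribʳ-+ δ B C) ⟩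
  (B ℚ.+ C) ℚ.* δ ∎
  where open ℚ.≤-Reasoning

divideBy : ∀ D ε → ℚ.Positive D → ℚ.Positive ε → ∃ λ δ → ℚ.Positive δ × D ℚ.* δ ≡ ε
divideBy D ε D>0 ε>0 =
  D⁻¹ ℚ.* ε ,
  ℚ.pos*pos⇒pos D⁻¹ {{ℚ.1/pos⇒pos D {{D>0}}}} ε {{ε>0}} ,
  trans (sym (ℚ.*-assoc D D⁻¹ ε))
    (trans (cong (ℚ._* ε) (ℚ.*-inverseʳ D {{D≢0}})) (ℚ.*-identityˡ ε))
  where
  D≢0 : ℚ.NonZero D
  D≢0 = ℚ.pos⇒nonZero D {{D>0}}
  D⁻¹ : ℚ
  D⁻¹ = ℚ.1/_ D {{D≢0}}

*-cauchy : ∀ {x y} → IsCauchy x → IsCauchy y → IsCauchy (λ i → x i ℚ.* y i)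
*-cauchy {x} {y} cx cy ε ε>0 =
  let B , B>0 , K , x≤B = eventuallyBounded {x} cx
      C , C>0 , L , y≤C = eventuallyBounded {y} cy
      δ , δ>0 , eq      = divideBy (B ℚ.+ C) ε (ℚ.pos+pos⇒pos B {{B>0}} C {{C>0}}) ε>0
      M , hx            = cx δ δ>0
      N , hy            = cy δ δ>0
  in (K ⊔ L) ⊔ (M ⊔ N) , λ i j p q →
     let p₁ = ℕ.m⊔n≤o⇒m≤o (K ⊔ L) (M ⊔ N) p
         p₂ = ℕ.m⊔n≤o⇒n≤o (K ⊔ L) (M ⊔ N) p
         q₁ = ℕ.m⊔n≤o⇒m≤o (K ⊔ L) (M ⊔ N) q
         q₂ = ℕ.m⊔n≤o⇒n≤o (K ⊔ L) (M ⊔ N) q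
     in subst (ℚ.∣ x i ℚ.* y i ℚ.- x j ℚ.* y j ∣ ℚ.≤_) eq
          (*-difference-≤ (x i) (y i) (x j) (y j) B>0 C>0
            (x≤B i (ℕ.m⊔n≤o⇒m≤o K L p₁)) (y≤C j (ℕ.m⊔n≤o⇒n≤o K L q₁))
            (hx i j (ℕ.m⊔n≤o⇒m≤o M N p₂) (ℕ.m⊔n≤o⇒m≤o M N q₂))
            (hy i j (ℕ.m⊔n≤o⇒n≤o M N p₂) (ℕ.m⊔n≤o⇒n≤o M N q₂)))

_*ᴿ_ : ℝ → ℝ → ℝ
mkℝ x cx *ᴿ mkℝ y cy = mkℝ (λ i → x i ℚ.* y i) (*-cauchy {x} {y} cx cy)

∑ : ∀ {n} → (Fin n → ℝ) → ℝ
∑ = Vector.foldr _+ᴿ_ 0ᴿ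

∑⊆ : ∀ {n} → (Subset n → ℝ) → ℝ
∑⊆ {zero}  f = f []
∑⊆ {suc n} f = ∑⊆ (λ S → f (inside ∷ S)) +ᴿ ∑⊆ (λ S → f (outside ∷ S))

partialSum : (ℕ → ℝ) → ℕ → ℝ
partialSum a zero    = 0ᴿ
partialSum a (suc n) = partialSum a n +ᴿ a n

_SumsTo_ : (ℕ → ℝ) → ℝ → Set
a SumsTo s = ∀ ε → ℚ.Positive ε → ∃ λ N → ∀ n → N ℕ.≤ n →
  partialSum a n ≤ᴿ s +ᴿ fromℚ ε × s ≤ᴿ partialSum a n +ᴿ fromℚ ε

-- For m ≥ 1, ⌊log₂ (m ^ i)⌋ / i is within 1 / i of the real logarithm of m,
-- which is therefore the limit of these approximants.
log₂Approx : ℕ → ℕ → ℚ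
log₂Approx m i = (ℤ.+ ⌊log₂ m ℕ.^ suc i ⌋) ℚ./ suc i

2^⌊log2⌋≤ : ∀ n (a : Acc ℕ._<_ n) → 1 ℕ.≤ n → 2 ℕ.^ ⌊log2⌋ n a ℕ.≤ n
2^⌊log2⌋≤ 1             _        _ = s≤s z≤n
2^⌊log2⌋≤ (suc (suc n)) (acc rs) _ = begin
  2 ℕ.* 2 ℕ.^ ⌊log2⌋ (suc ℕ.⌊ n /2⌋) _
    ≤⟨ ℕ.*-monoʳ-≤ 2 (2^⌊log2⌋≤ (suc ℕ.⌊ n /2⌋) _ (s≤s z≤n)) ⟩
  2 ℕ.* suc ℕ.⌊ n /2⌋
    ≡⟨ cong (suc ℕ.⌊ n /2⌋ ℕ.+_) (ℕ.+-identityʳ _) ⟩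
  suc ℕ.⌊ n /2⌋ ℕ.+ suc ℕ.⌊ n /2⌋
    ≤⟨ ℕ.+-monoʳ-≤ (suc ℕ.⌊ n /2⌋) (s≤s (ℕ.⌊n/2⌋≤⌈n/2⌉ n)) ⟩
  suc ℕ.⌊ n /2⌋ ℕ.+ suc ℕ.⌈ n /2⌉
    ≡⟨ cong suc (ℕ.+-suc _ _) ⟩
  2 ℕ.+ (ℕ.⌊ n /2⌋ ℕ.+ ℕ.⌈ n /2⌉)
    ≡⟨ cong (2 ℕ.+_) (ℕ.⌊n/2⌋+⌈n/2⌉≡n n) ⟩
  2 ℕ.+ n ∎
  where open ℕ.≤-Reasoning

2^⌊log₂⌋≤ : ∀ n → 1 ℕ.≤ n → 2 ℕ.^ ⌊log₂ n ⌋ ℕ.≤ n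
2^⌊log₂⌋≤ n = 2^⌊log2⌋≤ n (<-wellFounded n)

<2^1+⌊log₂⌋ : ∀ n → n ℕ.< 2 ℕ.^ suc ⌊log₂ n ⌋
<2^1+⌊log₂⌋ n = ℕ.≰⇒> λ 2^≤n →
  ℕ.1+n≰n (subst (ℕ._≤ ⌊log₂ n ⌋) (⌊log₂[2^n]⌋≡n _) (⌊log₂⌋-mono-≤ 2^≤n))

module _ (m : ℕ) (1≤m : 1 ℕ.≤ m) where
  private
    a : ℕ → ℕ
    a i = ⌊log₂ m ℕ.^ i ⌋

    instance
      m≢0 : ℕ.NonZero m
      m≢0 = ℕ.>-nonZero 1≤m

  cross : ∀ i j → a i ℕ.* suc j ℕ.≤ suc (a (suc j)) ℕ.* i
  cross i j = ℕ.≮⇒≥ λ lt → ℕ.<⇒≱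
    (ℕ.^-monoʳ-< 2 (s≤s (s≤s z≤n)) lt)
    (begin
      2 ℕ.^ (a i ℕ.* suc j)          ≡⟨ sym (ℕ.^-*-assoc 2 (a i) (suc j)) ⟩
      (2 ℕ.^ a i) ℕ.^ suc j          ≤⟨ ℕ.^-monoˡ-≤ (suc j) (2^⌊log₂⌋≤ _ (ℕ.m^n>0 m i)) ⟩
      (m ℕ.^ i) ℕ.^ suc j            ≡⟨ ℕ.^-*-assoc m i (suc j) ⟩
      m ℕ.^ (i ℕ.* suc j)            ≡⟨ cong (m ℕ.^_) (ℕ.*-comm i (suc j)) ⟩
      m ℕ.^ (suc j ℕ.* i)            ≡⟨ sym (ℕ.^-*-assoc m (suc j) i) ⟩
      (m ℕ.^ suc j) ℕ.^ i            ≤⟨ ℕ.^-monoˡ-≤ i (ℕ.<⇒≤ (<2^1+⌊log₂⌋ (m ℕ.^ suc j))) ⟩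
      (2 ℕ.^ suc (a (suc j))) ℕ.^ i  ≡⟨ ℕ.^-*-assoc 2 (suc (a (suc j))) i ⟩
      2 ℕ.^ (suc (a (suc j)) ℕ.* i)  ∎)
    where open ℕ.≤-Reasoning

  close : ∀ i j → log₂Approx m i ℚ.- log₂Approx m j ℚ.≤ (ℤ.+ 1) ℚ./ suc j
  close i j = begin
    x ℚ.- y            ≤⟨ ℚ.+-monoˡ-≤ (ℚ.- y) x≤ ⟩
    (z ℚ.+ y) ℚ.- y    ≡⟨ solve 2 (λ c b → (c :+ b) :- b := c) refl z y ⟩
    z                  ∎
    where
    open +-*-Solver
    x y z : ℚ
    x = log₂Approx m i
    y = log₂Approx m j
    z = (ℤ.+ 1) ℚ./ suc j

    A B : ℕ
    A = a (suc i)
    B = a (suc j)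

    cross′ : A ℕ.* (suc j ℕ.* suc j) ℕ.≤ (1 ℕ.* suc j ℕ.+ B ℕ.* suc j) ℕ.* suc i
    cross′ = ℕ.≤-trans (ℕ.≤-reflexive (sym (ℕ.*-assoc A (suc j) (suc j))))
      (ℕ.≤-trans (ℕ.*-monoˡ-≤ (suc j) (cross (suc i) j))
      (ℕ.≤-reflexive (trans (ℕ.*-assoc (suc B) (suc i) (suc j))
      (trans (cong (suc B ℕ.*_) (ℕ.*-comm (suc i) (suc j)))
      (trans (sym (ℕ.*-assoc (suc B) (suc j) (suc i)))
             (cong (ℕ._* suc i) (ℕ.*-distribʳ-+ (suc j) 1 B)))))))

    numerator : (ℤ.+ 1) ℤ.* (ℤ.+ suc j) ℤ.+ (ℤ.+ B) ℤ.* (ℤ.+ suc j)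
                ≡ ℤ.+ (1 ℕ.* suc j ℕ.+ B ℕ.* suc j)
    numerator = cong₂ ℤ._+_ (sym (ℤ.pos-* 1 (suc j))) (sym (ℤ.pos-* B (suc j)))

    x≤ : x ℚ.≤ z ℚ.+ y
    x≤ = ℚ.toℚᵘ-cancel-≤
      (ℚᵘ.≤-respˡ-≃ (ℚᵘ.≃-sym (ℚ.toℚᵘ-fromℚᵘ (ℚᵘ.mkℚᵘ (ℤ.+ A) i)))
      (ℚᵘ.≤-respʳ-≃ (ℚᵘ.≃-sym (ℚᵘ.≃-trans (ℚ.toℚᵘ-homo-+ z y)
          (ℚᵘ.+-cong (ℚ.toℚᵘ-fromℚᵘ (ℚᵘ.mkℚᵘ (ℤ.+ 1) j))
                     (ℚ.toℚᵘ-fromℚᵘ (ℚᵘ.mkℚᵘ (ℤ.+ B) j)))))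
      (ℚᵘ.*≤* (subst₂ ℤ._≤_ (ℤ.pos-* A (suc j ℕ.* suc j))
          (trans (ℤ.pos-* (1 ℕ.* suc j ℕ.+ B ℕ.* suc j) (suc i))
                 (cong (ℤ._* (ℤ.+ suc i)) (sym numerator)))
          (ℤ.+≤+ cross′)))))

    open ℚ.≤-Reasoning

1/-small : ∀ ε → ℚ.Positive ε → ∃ λ N → ∀ i → N ℕ.≤ i → (ℤ.+ 1) ℚ./ suc i ℚ.≤ ε
1/-small ε@(mkℚ ℤ.+[1+ n ] d _) _ = d , λ i d≤i → ℚ.toℚᵘ-cancel-≤
  (ℚᵘ.≤-respˡ-≃ (ℚᵘ.≃-sym (ℚ.toℚᵘ-fromℚᵘ (ℚᵘ.mkℚᵘ (ℤ.+ 1) i)))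
    (ℚᵘ.*≤* (subst₂ ℤ._≤_ (ℤ.pos-* 1 (suc d)) (ℤ.pos-* (suc n) (suc i))
      (ℤ.+≤+ (ℕ.*-mono-≤ (s≤s (z≤n {n})) (s≤s d≤i))))))

∣-∣-≤ : ∀ p q {ε} → p ℚ.- q ℚ.≤ ε → q ℚ.- p ℚ.≤ ε → ℚ.∣ p ℚ.- q ∣ ℚ.≤ ε
∣-∣-≤ p q {ε} h₁ h₂ with ℚ.∣p∣≡p∨∣p∣≡-p (p ℚ.- q)
... | inj₁ eq = subst (ℚ._≤ ε) (sym eq) h₁
... | inj₂ eq = subst (ℚ._≤ ε)
  (sym (trans eq (solve 2 (λ a b → :- (a :- b) := b :- a) refl p q))) h₂
  where open +-*-Solver

-- log₂ 0 is a junk value.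
log₂ : ℕ → ℝ
log₂ zero      = 0ᴿ
log₂ m@(suc _) = mkℝ (log₂Approx m) c
  where
  c : IsCauchy (log₂Approx m)
  c ε ε>0 with 1/-small ε ε>0
  ... | N , h = N , λ i j N≤i N≤j → ∣-∣-≤ (log₂Approx m i) (log₂Approx m j)
    (ℚ.≤-trans (close m (s≤s z≤n) i j) (h j N≤j))
    (ℚ.≤-trans (close m (s≤s z≤n) j i) (h i N≤i))

-- A set of outcomes is given by its indicator function, so unions are required
-- only where they have one. ℙ is a function on events, not on their proofs of
-- eventhood: this is ℙ-cong.
record ProbabilitySpace : Set₁ where
  field
    Ω       : Set
    IsEvent : (Ω → Bool) → Set
    ℙ       : (A : Ω → Bool) → IsEvent A → ℝ

  _IsUnionOf_ : (Ω → Bool) → (ℕ → Ω → Bool) → Set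
  B IsUnionOf A = ∀ ω → B ω ≡ true ⇔ (∃ λ i → A i ω ≡ true)

  PairwiseDisjoint : (ℕ → Ω → Bool) → Set
  PairwiseDisjoint A = ∀ i j ω → i ≢ j → A i ω ∧ A j ω ≡ false

  field
    Ω-event     : IsEvent (λ _ → true)
    ∁-event     : ∀ {A} → IsEvent A → IsEvent (not ∘ A)
    ⋃-event     : ∀ {A B} → (∀ i → IsEvent (A i)) → B IsUnionOf A → IsEvent B
    ℙ-cong      : ∀ {A B} (a : IsEvent A) (b : IsEvent B) → A ≗ B → ℙ A a ≈ ℙ B b
    ℙ-nonneg    : ∀ {A} (a : IsEvent A) → 0ᴿ ≤ᴿ ℙ A a
    ℙ-Ω         : ℙ (λ _ → true) Ω-event ≈ 1ᴿ
    ℙ-additive  : ∀ {A B} (a : ∀ i → IsEvent (A i)) (b : IsEvent B) →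
                  PairwiseDisjoint A → B IsUnionOf A →
                  (λ i → ℙ (A i) (a i)) SumsTo ℙ B b

record Network : Set where
  field
    order size : ℕ

  Vertex : Set
  Vertex = Fin order

  Edge : Set
  Edge = Fin size

  field
    ends : Edge → Vertex × Vertex
    cost : Edge → ℝ
    root : Vertex

  Joins : Edge → Vertex → Vertex → Set
  Joins e u v = ends e ≡ (u , v) ⊎ ends e ≡ (v , u)

  Connected : Subset size → Vertex → Vertex → Set
  Connected S = Star (λ u v → ∃ λ e → e ∈ S × Joins e u v)

  field
    loopless    : ∀ e v → ¬ Joins e v v
    simple      : ∀ e f u v → Joins e u v → Joins f u v → e ≡ f
    cost-nonneg : ∀ e → 0ᴿ ≤ᴿ cost e
    connected   : ∀ u v → Connected ⊤ u v

  totalCost : Subset size → ℝ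
  totalCost S = ∑ (λ e → if lookup S e then cost e else 0ᴿ)

  Spans : Subset size → Subset order → Set
  Spans S T = ∀ v → v ∈ T → Connected S v root

  IsOptimalCost : Subset order → ℝ → Set
  IsOptimalCost T opt =
    (∃ λ S → Spans S T × totalCost S ≈ opt) × (∀ S → Spans S T → opt ≤ᴿ totalCost S)

open Network

-- Request sequences are listed with the most recent request first. A rule
-- states what is bought when a given vertex arrives after given past requests.
PurchaseRule : Set
PurchaseRule = (G : Network) (R̂ : Subset (order G)) →
               Vertex G → List (Vertex G) → Subset (size G)

allPurchases : PurchaseRule →
               (G : Network) (R̂ : Subset (order G)) → List (Vertex G) → Subset (size G)
allPurchases buy G R̂ []         = ⊥
allPurchases buy G R̂ (v ∷ past) = allPurchases buy G R̂ past ∪ buy G R̂ v past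

record OnlineAlgorithm : Set where
  field
    buy      : PurchaseRule
    feasible : ∀ G R̂ v past → Unique (v ∷ past) →
               Connected G (allPurchases buy G R̂ (v ∷ past)) v (root G)

  bought : (G : Network) (R̂ : Subset (order G)) → List (Vertex G) → Subset (size G)
  bought = allPurchases buy

open OnlineAlgorithm

record RandomizedAlgorithm : Set₁ where
  field
    space : ProbabilitySpace
  open ProbabilitySpace space public
  field
    run : Ω → OnlineAlgorithm

  boughtExactly : (G : Network) (R̂ : Subset (order G)) → List (Vertex G) →
                  Subset (size G) → Ω → Bool
  boughtExactly G R̂ requests S ω =
    does (≡-dec Bool._≟_ (bought (run ω) G R̂ requests) S)

  field
    measurable : ∀ G R̂ requests → Unique requests →
                 ∀ S → IsEvent (boughtExactly G R̂ requests S)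

record Instance : Set where
  field
    network    : Network
    prediction : Subset (order network)
    requests   : List (Vertex network)
    distinct   : Unique requests

  terminals : Subset (order network)
  terminals = ⋃ (map ⁅_⁆ requests)

  field
    OPT         : ℝ
    OPT-optimal : IsOptimalCost network terminals OPT

open Instance

record HasSizes (n k Δ₁ Δ₂ : ℕ) (I : Instance) : Set where
  field
    ∣R̂∣≡n    : ∣ prediction I ∣ ≡ n
    ∣R∣≡k    : ∣ terminals I ∣ ≡ k
    ∣R̂─R∣≡Δ₁ : ∣ prediction I ─ terminals I ∣ ≡ Δ₁
    ∣R─R̂∣≡Δ₂ : ∣ terminals I ─ prediction I ∣ ≡ Δ₂

-- An oblivious randomized adversary is a finitely supported distribution on
-- instances, fixed independently of the algorithm.
record Adversary (n k Δ₁ Δ₂ : ℕ) : Set where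
  field
    outcomes      : ℕ
    weight        : Fin outcomes → ℝ
    weight-nonneg : ∀ i → 0ᴿ ≤ᴿ weight i
    weight-total  : ∑ weight ≈ 1ᴿ
    outcome       : Fin outcomes → Instance
    sizes         : ∀ i → HasSizes n k Δ₁ Δ₂ (outcome i)

  expectation : (Instance → ℝ) → ℝ
  expectation f = ∑ (λ i → weight i *ᴿ f (outcome i))

-- The bought set takes finitely many values, so its expected cost is the sum
-- over these values of probability times cost.
expectedCost : RandomizedAlgorithm → Instance → ℝ
expectedCost alg I = ∑⊆ λ S →
  ℙ (boughtExactly network′ (prediction I) (requests I) S)
    (measurable network′ (prediction I) (requests I) (distinct I) S)
  *ᴿ totalCost network′ S
  where
  open RandomizedAlgorithm alg
  network′ : Network
  network′ = network I

CompetitiveRatioAtLeast : ∀ {n k Δ₁ Δ₂} →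
  ℝ → Adversary n k Δ₁ Δ₂ → RandomizedAlgorithm → Set
CompetitiveRatioAtLeast α adv alg =
  0ᴿ <ᴿ expectation OPT ×
  α *ᴿ expectation OPT ≤ᴿ expectation (expectedCost alg)
  where open Adversary adv

{-# OPTIONS --safe #-}
module Submission where

-- The network is the diamond graph of depth j: start from one edge joining the root to a
-- second pole and, j times, replace every edge by two parallel paths of two edges each. The
-- adversary draws one coin per level and requests, level by level, the middles lying on the
-- root-to-pole path selected by the coins; this path, of length 2 ^ j, is optimal. Once the
-- requests of a level are served, a cut argument shows that for every column x of the graph
-- the bought edges contain, inside the part selected so far, an edge of x or of its mirror
-- image. The next coin makes that edge useless with probability 1/2, so each of the 1 + j
-- levels contributes 2 ^ j / 4 to the expected cost, in disjoint sets of edges. Depending on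
-- whether Δ₂ is large, the nodes of the diamond are left unpredicted or are all predicted.

open import Defs
open import Algebra.Bundles using (CommutativeMonoid)
open import Data.Bool.Base using (Bool; true; false; T; not; _∧_; _∨_; _xor_; if_then_else_)
import Data.Bool.Properties as Bool
open import Data.Fin.Base using (Fin; zero; suc; _↑ˡ_; _↑ʳ_; combine)
import Data.Fin.Properties as Fin
open import Data.Fin.Subset using (Subset; inside; outside; _∈_; ⊤; ⁅_⁆; _∪_; _∩_; _─_; ⋃; ∣_∣)
import Data.Fin.Subset.Properties as Subset
import Data.Integer.Base as ℤ
import Data.Integer.Properties as ℤ
open import Data.List.Base as List using (List; []; _∷_; _++_; length)
open import Data.List.Membership.Propositional using () renaming (_∈_ to _∈ˡ_)
open import Data.List.Membership.Propositional.Properties using (∈-allFin; ∈-++⁻; ∈-++⁺ˡ; ∈-++⁺ʳ; ∈-map⁻; ∈-map⁺)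
import Data.List.Properties as List
open import Data.List.Relation.Unary.All as All using ()
open import Data.List.Relation.Unary.AllPairs using () renaming ([] to []ᵘ; _∷_ to _∷ᵘ_)
open import Data.List.Relation.Unary.Any using () renaming (here to hereˡ; there to thereˡ)
open import Data.List.Relation.Unary.Unique.Propositional using (Unique)
import Data.List.Relation.Unary.Unique.Propositional.Properties as Unique
open import Data.Nat.Base using (ℕ; zero; suc; _+_; _*_; _^_; _∸_; _≤_; _<_; _⊓_; _⊔_; z≤n; s≤s; _≡ᵇ_; ⌊_/2⌋)
open import Data.Nat.Logarithm using (⌊log₂_⌋; ⌊log₂⌋-mono-≤; ⌊log₂[2^n]⌋≡n)
import Data.Nat.Properties as ℕ
open import Data.Nat.Solver using () renaming (module +-*-Solver to ℕ-Solver)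
open import Data.Product.Base using (Σ; ∃; _×_; _,_; proj₁; proj₂)
open import Data.Product.Function.NonDependent.Propositional using (_×-↔_)
open import Data.Product.Properties using (,-injectiveˡ; ,-injectiveʳ)
open import Data.Rational.Base as ℚ using (ℚ; 0ℚ; 1ℚ; ½)
import Data.Rational.Properties as ℚ
open import Data.Rational.Solver using () renaming (module +-*-Solver to ℚ-Solver)
import Data.Rational.Unnormalised.Base as ℚᵘ
import Data.Rational.Unnormalised.Properties as ℚᵘ
import Data.Sum.Base as Sum
open import Data.Sum.Base using (_⊎_; inj₁; inj₂; [_,_]′)
open import Data.Sum.Function.Propositional using (_⊎-↔_)
open import Data.Sum.Properties using (inj₁-injective; inj₂-injective)
open import Data.Vec.Base using (Vec; []; _∷_; here; there; lookup; tabulate; replicate)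
open import Data.Vec.Properties using (≡-dec; ∷-injectiveʳ; []=⇒lookup; lookup⇒[]=; lookup∘tabulate)
open import Function.Base using (_∘_; case_of_)
open import Function.Bundles using (_⇔_; _↔_; Inverse; mk⇔; mk↔ₛ′)
open import Function.Construct.Composition using (_↔-∘_)
open import Function.Construct.Identity using (↔-id)
open import Level using (0ℓ)
open import Relation.Binary.Bundles using (Preorder)
open import Relation.Binary.Construct.Closure.ReflexiveTransitive as Star using (Star; _◅_; _◅◅_)
open import Relation.Binary.PropositionalEquality
open import Relation.Binary.Structures using (IsPreorder)
open import Relation.Nullary.Decidable.Core using (does; yes; no)
open import Relation.Nullary.Negation.Core using (¬_; contradiction)
open import Algebra.Properties.CommutativeSemigroup ℕ.+-commutativeSemigroup using () renaming (interchange to +-interchange)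
open import Algebra.Properties.Monoid.Sum ℕ.+-0-monoid using (sum; sum-cong-≗)

-- Rational and real inequalities

-- Predictions are harmless as soon as the predicted set is the same for all coin sequences: none of
-- the diamond nodes, or all of them but the root. The first uses up `2 ^ j` unpredicted terminals,
-- so it requires a large `Δ₂`. The second works even for `Δ₂ = 0`, but its decoys number about
-- `4 ^ j`, so the depth is only half a logarithm. Together with the rounding this gives a logarithm
-- of at most `3 * suc j`, and the factor 1/4 per level turns it into the constant 1/12. Randomness
-- of the algorithm is handled in the manner of Yao: for each fixed outcome `ω` the total cost over
-- all `2 ^ j` instances is bounded by double counting, and this inequality is then integrated. The
-- obstacle is that `expectedCost` is defined for one instance at a time, as a sum over the possible
-- bought sets, and no integral is available. Linearity therefore has to be derived from finite
-- additivity, by conditioning on the bought sets one instance after the other.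

fromℕ : ℕ → ℚ
fromℕ n = (ℤ.+ n) ℚ./ 1

toℚᵘ-fromℕ : ∀ n → ℚ.toℚᵘ (fromℕ n) ℚᵘ.≃ ℚᵘ.mkℚᵘ (ℤ.+ n) 0
toℚᵘ-fromℕ n = ℚ.toℚᵘ-fromℚᵘ (ℚᵘ.mkℚᵘ (ℤ.+ n) 0)

fromℕ-homo-+ : ∀ m n → fromℕ (m + n) ≡ fromℕ m ℚ.+ fromℕ n
fromℕ-homo-+ m n = ℚ.toℚᵘ-injective (begin
  ℚ.toℚᵘ (fromℕ (m + n))                         ≈⟨ toℚᵘ-fromℕ (m + n) ⟩
  ℚᵘ.mkℚᵘ (ℤ.+ (m + n)) 0                        ≈⟨ ℚᵘ.*≡* (cong (ℤ._* ℤ.+ 1)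
                                                       (sym (cong₂ ℤ._+_ (ℤ.*-identityʳ (ℤ.+ m)) (ℤ.*-identityʳ (ℤ.+ n))))) ⟩
  ℚᵘ.mkℚᵘ (ℤ.+ m) 0 ℚᵘ.+ ℚᵘ.mkℚᵘ (ℤ.+ n) 0       ≈⟨ ℚᵘ.+-cong (toℚᵘ-fromℕ m) (toℚᵘ-fromℕ n) ⟨
  ℚ.toℚᵘ (fromℕ m) ℚᵘ.+ ℚ.toℚᵘ (fromℕ n)         ≈⟨ ℚ.toℚᵘ-homo-+ (fromℕ m) (fromℕ n) ⟨
  ℚ.toℚᵘ (fromℕ m ℚ.+ fromℕ n)                   ∎)
  where open import Relation.Binary.Reasoning.Setoid ℚᵘ.≃-setoid

fromℕ-homo-* : ∀ m n → fromℕ (m * n) ≡ fromℕ m ℚ.* fromℕ n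
fromℕ-homo-* m n = ℚ.toℚᵘ-injective (begin
  ℚ.toℚᵘ (fromℕ (m * n))                         ≈⟨ toℚᵘ-fromℕ (m * n) ⟩
  ℚᵘ.mkℚᵘ (ℤ.+ (m * n)) 0                        ≈⟨ ℚᵘ.*≡* (cong (ℤ._* ℤ.+ 1) (ℤ.pos-* m n)) ⟩
  ℚᵘ.mkℚᵘ (ℤ.+ m) 0 ℚᵘ.* ℚᵘ.mkℚᵘ (ℤ.+ n) 0       ≈⟨ ℚᵘ.*-cong (toℚᵘ-fromℕ m) (toℚᵘ-fromℕ n) ⟨
  ℚ.toℚᵘ (fromℕ m) ℚᵘ.* ℚ.toℚᵘ (fromℕ n)         ≈⟨ ℚ.toℚᵘ-homo-* (fromℕ m) (fromℕ n) ⟨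
  ℚ.toℚᵘ (fromℕ m ℚ.* fromℕ n)                   ∎)
  where open import Relation.Binary.Reasoning.Setoid ℚᵘ.≃-setoid

fromℕ-nonNeg : ∀ n → ℚ.NonNegative (fromℕ n)
fromℕ-nonNeg n = ℚ.normalize-nonNeg n 1

fromℕ-mono-≤ : ∀ {m n} → m ≤ n → fromℕ m ℚ.≤ fromℕ n
fromℕ-mono-≤ {m} {n} m≤n = begin
  fromℕ m                          ≡⟨ ℚ.+-identityʳ (fromℕ m) ⟨
  fromℕ m ℚ.+ 0ℚ                   ≤⟨ ℚ.+-monoʳ-≤ (fromℕ m) (ℚ.nonNegative⁻¹ _ {{fromℕ-nonNeg (n ∸ m)}}) ⟩
  fromℕ m ℚ.+ fromℕ (n ∸ m)        ≡⟨ fromℕ-homo-+ m (n ∸ m) ⟨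
  fromℕ (m + (n ∸ m))              ≡⟨ cong fromℕ (ℕ.m+[n∸m]≡n m≤n) ⟩
  fromℕ n                          ∎
  where open ℚ.≤-Reasoning

p≤p+ε : ∀ p {ε} → ℚ.Positive ε → p ℚ.≤ p ℚ.+ ε
p≤p+ε p {ε} ε>0 = subst (ℚ._≤ p ℚ.+ ε) (ℚ.+-identityʳ p)
  (ℚ.+-monoʳ-≤ p (ℚ.<⇒≤ (ℚ.positive⁻¹ ε {{ε>0}})))

infix 4 _≤̇_ _≐_

-- Many relations below hold term by term between the Cauchy sequences, where rational algebra
-- applies directly; the relations with `ε` are left to steps that involve probabilities.
_≤̇_ _≐_ : ℝ → ℝ → Set
x ≤̇ y = ∀ i → seq x i ℚ.≤ seq y i
x ≐ y = ∀ i → seq x i ≡ seq y i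

≤̇⇒≤ : ∀ {x y} → x ≤̇ y → x ≤ᴿ y
≤̇⇒≤ x≤y ε ε>0 = 0 , λ i _ → ℚ.≤-trans (x≤y i) (p≤p+ε _ ε>0)

≐⇒≈ : ∀ {x y} → x ≐ y → x ≈ y
≐⇒≈ {x} {y} eq = ≤̇⇒≤ {x} {y} (ℚ.≤-reflexive ∘ eq) , ≤̇⇒≤ {y} {x} (ℚ.≤-reflexive ∘ sym ∘ eq)

≤ᴿ-refl : ∀ {x} → x ≤ᴿ x
≤ᴿ-refl {x} = ≤̇⇒≤ {x} {x} (λ _ → ℚ.≤-refl)

halves : ∀ ε → ½ ℚ.* ε ℚ.+ ½ ℚ.* ε ≡ ε
halves ε = trans (sym (ℚ.*-distribʳ-+ ε ½ ½)) (ℚ.*-identityˡ ε)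

half-pos : ∀ ε → ℚ.Positive ε → ℚ.Positive (½ ℚ.* ε)
half-pos ε ε>0 = ℚ.pos*pos⇒pos ½ ε {{ε>0}}

≤ᴿ-trans : ∀ {x y z} → x ≤ᴿ y → y ≤ᴿ z → x ≤ᴿ z
≤ᴿ-trans {x} {y} {z} x≤y y≤z ε ε>0
  with x≤y (½ ℚ.* ε) (half-pos ε ε>0) | y≤z (½ ℚ.* ε) (half-pos ε ε>0)
... | M , p | N , q = M ⊔ N , λ i M⊔N≤i → begin
  seq x i                                   ≤⟨ p i (ℕ.m⊔n≤o⇒m≤o M N M⊔N≤i) ⟩
  seq y i ℚ.+ ½ ℚ.* ε                       ≤⟨ ℚ.+-monoˡ-≤ (½ ℚ.* ε) (q i (ℕ.m⊔n≤o⇒n≤o M N M⊔N≤i)) ⟩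
  (seq z i ℚ.+ ½ ℚ.* ε) ℚ.+ ½ ℚ.* ε         ≡⟨ ℚ.+-assoc (seq z i) (½ ℚ.* ε) (½ ℚ.* ε) ⟩
  seq z i ℚ.+ (½ ℚ.* ε ℚ.+ ½ ℚ.* ε)         ≡⟨ cong (seq z i ℚ.+_) (halves ε) ⟩
  seq z i ℚ.+ ε                             ∎
  where open ℚ.≤-Reasoning

≤ᴿ-limit : ∀ {x y} → (∀ ε → ℚ.Positive ε → x ≤ᴿ y +ᴿ fromℚ ε) → x ≤ᴿ y
≤ᴿ-limit {x} {y} h ε ε>0 with h (½ ℚ.* ε) (half-pos ε ε>0) (½ ℚ.* ε) (half-pos ε ε>0)
... | N , p = N , λ i N≤i → ℚ.≤-trans (p i N≤i) (ℚ.≤-reflexive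
  (trans (ℚ.+-assoc (seq y i) (½ ℚ.* ε) (½ ℚ.* ε)) (cong (seq y i ℚ.+_) (halves ε))))

+ᴿ-mono-≤ : ∀ {x y z w} → x ≤ᴿ y → z ≤ᴿ w → x +ᴿ z ≤ᴿ y +ᴿ w
+ᴿ-mono-≤ {x} {y} {z} {w} x≤y z≤w ε ε>0
  with x≤y (½ ℚ.* ε) (half-pos ε ε>0) | z≤w (½ ℚ.* ε) (half-pos ε ε>0)
... | M , p | N , q = M ⊔ N , λ i M⊔N≤i → begin
  seq x i ℚ.+ seq z i
    ≤⟨ ℚ.+-mono-≤ (p i (ℕ.m⊔n≤o⇒m≤o M N M⊔N≤i)) (q i (ℕ.m⊔n≤o⇒n≤o M N M⊔N≤i)) ⟩
  (seq y i ℚ.+ ½ ℚ.* ε) ℚ.+ (seq w i ℚ.+ ½ ℚ.* ε)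
    ≡⟨ solve 3 (λ a b e → (a :+ e) :+ (b :+ e) := (a :+ b) :+ (e :+ e)) refl (seq y i) (seq w i) (½ ℚ.* ε) ⟩
  (seq y i ℚ.+ seq w i) ℚ.+ (½ ℚ.* ε ℚ.+ ½ ℚ.* ε)
    ≡⟨ cong (seq y i ℚ.+ seq w i ℚ.+_) (halves ε) ⟩
  (seq y i ℚ.+ seq w i) ℚ.+ ε ∎
  where
  open ℚ.≤-Reasoning
  open ℚ-Solver

+ᴿ-cancelˡ-≤ : ∀ z {x y} → z +ᴿ x ≤ᴿ z +ᴿ y → x ≤ᴿ y
+ᴿ-cancelˡ-≤ z {x} {y} h ε ε>0 with h ε ε>0
... | N , p = N , λ i N≤i → begin
  seq x i
    ≡⟨ solve 2 (λ a b → a := (:- b) :+ (b :+ a)) refl (seq x i) (seq z i) ⟩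
  (ℚ.- seq z i) ℚ.+ (seq z i ℚ.+ seq x i)
    ≤⟨ ℚ.+-monoʳ-≤ (ℚ.- seq z i) (p i N≤i) ⟩
  (ℚ.- seq z i) ℚ.+ ((seq z i ℚ.+ seq y i) ℚ.+ ε)
    ≡⟨ solve 3 (λ a b e → (:- b) :+ ((b :+ a) :+ e) := a :+ e) refl (seq y i) (seq z i) ε ⟩
  seq y i ℚ.+ ε ∎
  where
  open ℚ.≤-Reasoning
  open ℚ-Solver

≈-refl : ∀ {x} → x ≈ x
≈-refl {x} = ≤ᴿ-refl {x} , ≤ᴿ-refl {x}

≈-sym : ∀ {x y} → x ≈ y → y ≈ x
≈-sym (p , q) = q , p

≈-trans : ∀ {x y z} → x ≈ y → y ≈ z → x ≈ z
≈-trans {x} {y} {z} (p , q) (r , s) = ≤ᴿ-trans {x} {y} {z} p r , ≤ᴿ-trans {z} {y} {x} s q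

+ᴿ-cong : ∀ {x y z w} → x ≈ y → z ≈ w → x +ᴿ z ≈ y +ᴿ w
+ᴿ-cong {x} {y} {z} {w} (p , q) (r , s) =
  +ᴿ-mono-≤ {x} {y} {z} {w} p r , +ᴿ-mono-≤ {y} {x} {w} {z} q s

≤ᴿ-preorder : Preorder _ _ _
≤ᴿ-preorder = record
  { Carrier = ℝ ; _≈_ = _≈_ ; _≲_ = _≤ᴿ_
  ; isPreorder = record
    { isEquivalence = record
      { refl  = λ {x} → ≈-refl {x}
      ; sym   = λ {x} {y} → ≈-sym {x} {y}
      ; trans = λ {x} {y} {z} → ≈-trans {x} {y} {z} }
    ; reflexive = proj₁
    ; trans = λ {x} {y} {z} → ≤ᴿ-trans {x} {y} {z} } }

module ≤ᴿ-Reasoning where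
  open import Relation.Binary.Reasoning.Preorder ≤ᴿ-preorder public

infixr 7 _·_

_·_ : ℚ → ℝ → ℝ
q · x = fromℚ q *ᴿ x

·-mono-≤ : ∀ q → ℚ.NonNegative q → ∀ {x y} → x ≤ᴿ y → q · x ≤ᴿ q · y
-- Dividing by `1ℚ + q` instead of `q` includes the case `q = 0`.
·-mono-≤ q q≥0 {x} {y} x≤y ε ε>0 with divideBy (1ℚ ℚ.+ q) ε (ℚ.pos+nonNeg⇒pos 1ℚ q {{q≥0}}) ε>0
... | δ , δ>0 , eq with x≤y δ δ>0
... | N , p = N , λ i N≤i → begin
  q ℚ.* seq x i                      ≤⟨ ℚ.*-monoˡ-≤-nonNeg q {{q≥0}} (p i N≤i) ⟩
  q ℚ.* (seq y i ℚ.+ δ)              ≡⟨ ℚ.*-distribˡ-+ q (seq y i) δ ⟩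
  q ℚ.* seq y i ℚ.+ q ℚ.* δ          ≤⟨ ℚ.+-monoʳ-≤ (q ℚ.* seq y i) qδ≤ε ⟩
  q ℚ.* seq y i ℚ.+ ε                ∎
  where
  open ℚ.≤-Reasoning
  qδ≤ε : q ℚ.* δ ℚ.≤ ε
  qδ≤ε = begin
    q ℚ.* δ                   ≡⟨ ℚ.+-identityˡ (q ℚ.* δ) ⟨
    0ℚ ℚ.+ q ℚ.* δ            ≤⟨ ℚ.+-monoˡ-≤ (q ℚ.* δ) (ℚ.<⇒≤ (ℚ.positive⁻¹ δ {{δ>0}})) ⟩
    δ ℚ.+ q ℚ.* δ             ≡⟨ cong (ℚ._+ q ℚ.* δ) (ℚ.*-identityˡ δ) ⟨
    1ℚ ℚ.* δ ℚ.+ q ℚ.* δ      ≡⟨ ℚ.*-distribʳ-+ δ 1ℚ q ⟨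
    (1ℚ ℚ.+ q) ℚ.* δ          ≡⟨ eq ⟩
    ε                         ∎

-- Boolean tests and events

_==_ : ∀ {n} → Vec Bool n → Vec Bool n → Bool
u == v = does (≡-dec Bool._≟_ u v)

==⇒≡ : ∀ {n} (u v : Vec Bool n) → u == v ≡ true → u ≡ v
==⇒≡ u v eq with ≡-dec Bool._≟_ u v
... | yes p = p

==-refl : ∀ {n} (u : Vec Bool n) → u == u ≡ true
==-refl u with ≡-dec Bool._≟_ u u
... | yes _  = refl
... | no u≢u = contradiction refl u≢u

∧-true : ∀ {a b} → a ∧ b ≡ true → a ≡ true × b ≡ true
∧-true {true} eq = refl , eq

∧-intro : ∀ {a b} → a ≡ true → b ≡ true → a ∧ b ≡ true
∧-intro refl refl = refl

∨-true : ∀ a {b} → a ∨ b ≡ true → a ≡ true ⊎ b ≡ true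
∨-true true  eq = inj₁ refl
∨-true false eq = inj₂ eq

any⊆ : ∀ {n} → (Subset n → Bool) → Bool
any⊆ {zero}  f = f []
any⊆ {suc n} f = any⊆ (f ∘ (inside ∷_)) ∨ any⊆ (f ∘ (outside ∷_))

any⊆-elim : ∀ {n} (f : Subset n → Bool) → any⊆ f ≡ true → ∃ λ S → f S ≡ true
any⊆-elim {zero}  f eq = [] , eq
any⊆-elim {suc n} f eq with ∨-true (any⊆ (f ∘ (inside ∷_))) eq
... | inj₁ p = let S , q = any⊆-elim (f ∘ (inside ∷_)) p in inside ∷ S , q
... | inj₂ p = let S , q = any⊆-elim (f ∘ (outside ∷_)) p in outside ∷ S , q

any⊆-intro : ∀ {n} (f : Subset n → Bool) S → f S ≡ true → any⊆ f ≡ true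
any⊆-intro f []            eq = eq
any⊆-intro f (inside  ∷ S) eq rewrite any⊆-intro (f ∘ (inside ∷_)) S eq = refl
any⊆-intro f (outside ∷ S) eq rewrite any⊆-intro (f ∘ (outside ∷_)) S eq = Bool.∨-zeroʳ _

Event : Set → Set
Event Ω = Ω → Bool

∅ᵉ : ∀ {Ω} → Event Ω
∅ᵉ _ = false

_∪ᵉ_ _∩ᵉ_ : ∀ {Ω} → Event Ω → Event Ω → Event Ω
(A ∪ᵉ B) ω = A ω ∨ B ω
(A ∩ᵉ B) ω = A ω ∧ B ω

_≡̂_ : ∀ {Ω : Set} {n} → (Ω → Subset n) → Subset n → Event Ω
(X ≡̂ S) ω = X ω == S

-- Expectations of finitely supported variables

-- Costs are natural numbers, so an expectation can be written with repeated addition `_⊠_` in place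
-- of products: an ordered commutative monoid of values is enough structure.
module FinitelyAdditive
  (M : CommutativeMonoid 0ℓ 0ℓ)
  (_≤ᴹ_ : CommutativeMonoid.Carrier M → CommutativeMonoid.Carrier M → Set)
  (≤-isPreorder : IsPreorder (CommutativeMonoid._≈_ M) _≤ᴹ_)
  (+-mono : ∀ {x y z w} → x ≤ᴹ y → z ≤ᴹ w → CommutativeMonoid._∙_ M x z ≤ᴹ CommutativeMonoid._∙_ M y w)
  where

  open CommutativeMonoid M using (Carrier; commutativeSemigroup)
    renaming (_≈_ to _≈ᴹ_; _∙_ to _+ᴹ_; ε to 0ᴹ; refl to ≈ᴹ-refl; sym to ≈ᴹ-sym; trans to ≈ᴹ-trans;
              ∙-cong to +-cong; identityˡ to +-identityˡ; identityʳ to +-identityʳ)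
  open IsPreorder ≤-isPreorder using () renaming (refl to ≤-refl; reflexive to ≤-reflexive; trans to ≤-trans)
  open import Algebra.Properties.CommutativeSemigroup commutativeSemigroup using (interchange)
  open import Algebra.Properties.CommutativeMonoid.Mult M
    using (×-homo-+; ×-congʳ; ×-distrib-+) renaming (_×_ to _⊠_)
  open import Algebra.Properties.CommutativeMonoid.Sum M
    using (∑-distrib-+) renaming (sum to sumᴹ)

  ≤-preorder : Preorder 0ℓ 0ℓ 0ℓ
  ≤-preorder = record { isPreorder = ≤-isPreorder }
  open import Relation.Binary.Reasoning.Preorder ≤-preorder

  ⊠-monoʳ : ∀ n {x y} → x ≤ᴹ y → (n ⊠ x) ≤ᴹ (n ⊠ y)
  ⊠-monoʳ zero    x≤y = ≤-refl
  ⊠-monoʳ (suc n) x≤y = +-mono x≤y (⊠-monoʳ n x≤y)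

  ⊠-monoˡ : ∀ {m n x} → 0ᴹ ≤ᴹ x → m ≤ n → (m ⊠ x) ≤ᴹ (n ⊠ x)
  ⊠-monoˡ {n = zero}  x≥0 z≤n = ≤-refl
  ⊠-monoˡ {n = suc n} x≥0 z≤n = ≤-trans (≤-reflexive (≈ᴹ-sym (+-identityˡ 0ᴹ))) (+-mono x≥0 (⊠-monoˡ {n = n} x≥0 z≤n))
  ⊠-monoˡ x≥0 (s≤s m≤n) = +-mono ≤-refl (⊠-monoˡ x≥0 m≤n)

  ⊠-zeroʳ : ∀ n → (n ⊠ 0ᴹ) ≈ᴹ 0ᴹ
  ⊠-zeroʳ zero    = ≈ᴹ-refl
  ⊠-zeroʳ (suc n) = ≈ᴹ-trans (+-identityˡ _) (⊠-zeroʳ n)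

  -- Subtraction is truncated, so this is an inequality: a value `c` above `K` leaves the trivial
  -- bound 0 to the remaining variables.
  ⊠-split : ∀ K c {x} → 0ᴹ ≤ᴹ x → (K ⊠ x) ≤ᴹ ((c ⊠ x) +ᴹ ((K ∸ c) ⊠ x))
  ⊠-split K c {x} x≥0 = ≤-trans (⊠-monoˡ x≥0 (ℕ.m≤n+m∸n K c)) (≤-reflexive (×-homo-+ x c (K ∸ c)))

  sum-mono : ∀ {n} {f g : Fin n → Carrier} → (∀ i → f i ≤ᴹ g i) → sumᴹ f ≤ᴹ sumᴹ g
  sum-mono {zero}  f≤g = ≤-refl
  sum-mono {suc n} f≤g = +-mono (f≤g zero) (sum-mono (f≤g ∘ suc))

  sum⊆ : ∀ {n} → (Subset n → Carrier) → Carrier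
  sum⊆ {zero}  f = f []
  sum⊆ {suc n} f = sum⊆ (f ∘ (inside ∷_)) +ᴹ sum⊆ (f ∘ (outside ∷_))

  sum⊆-mono : ∀ {n} {f g : Subset n → Carrier} → (∀ S → f S ≤ᴹ g S) → sum⊆ f ≤ᴹ sum⊆ g
  sum⊆-mono {zero}  f≤g = f≤g []
  sum⊆-mono {suc n} f≤g = +-mono (sum⊆-mono (f≤g ∘ (inside ∷_))) (sum⊆-mono (f≤g ∘ (outside ∷_)))

  sum⊆-distrib-+ : ∀ {n} (f g : Subset n → Carrier) → sum⊆ (λ S → f S +ᴹ g S) ≈ᴹ (sum⊆ f +ᴹ sum⊆ g)
  sum⊆-distrib-+ {zero}  f g = ≈ᴹ-refl
  sum⊆-distrib-+ {suc n} f g = ≈ᴹ-trans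
    (+-cong (sum⊆-distrib-+ (f ∘ (inside ∷_)) (g ∘ (inside ∷_))) (sum⊆-distrib-+ (f ∘ (outside ∷_)) (g ∘ (outside ∷_))))
    (interchange _ _ _ _)

  sum⊆-sum-comm : ∀ {m n} (f : Subset m → Fin n → Carrier) →
    sum⊆ (λ S → sumᴹ (f S)) ≈ᴹ sumᴹ (λ i → sum⊆ (λ S → f S i))
  sum⊆-sum-comm {zero}  f = ≈ᴹ-refl
  sum⊆-sum-comm {suc m} f = ≈ᴹ-trans
    (+-cong (sum⊆-sum-comm (f ∘ (inside ∷_))) (sum⊆-sum-comm (f ∘ (outside ∷_))))
    (≈ᴹ-sym (∑-distrib-+ (λ i → sum⊆ (λ S → f (inside ∷ S) i)) (λ i → sum⊆ (λ S → f (outside ∷ S) i))))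

  sum⊆-comm : ∀ {m n} (f : Subset m → Subset n → Carrier) →
    sum⊆ (λ S → sum⊆ (f S)) ≈ᴹ sum⊆ (λ T → sum⊆ (λ S → f S T))
  sum⊆-comm {zero}  f = ≈ᴹ-refl
  sum⊆-comm {suc m} f = ≈ᴹ-trans
    (+-cong (sum⊆-comm (f ∘ (inside ∷_))) (sum⊆-comm (f ∘ (outside ∷_))))
    (≈ᴹ-sym (sum⊆-distrib-+ (λ T → sum⊆ (λ S → f (inside ∷ S) T)) (λ T → sum⊆ (λ S → f (outside ∷ S) T))))

  ⊠-sum⊆ : ∀ k {n} (f : Subset n → Carrier) → (k ⊠ sum⊆ f) ≈ᴹ sum⊆ (λ S → k ⊠ f S)
  ⊠-sum⊆ k {zero}  f = ≈ᴹ-refl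
  ⊠-sum⊆ k {suc n} f = ≈ᴹ-trans (×-distrib-+ _ _ k)
    (+-cong (⊠-sum⊆ k (f ∘ (inside ∷_))) (⊠-sum⊆ k (f ∘ (outside ∷_))))

  module _
    {Ω : Set}
    (IsEvent : Event Ω → Set)
    (ℙ : ∀ A → IsEvent A → Carrier)
    (∪-event : ∀ {A B} → IsEvent A → IsEvent B → IsEvent (A ∪ᵉ B))
    (∩-event : ∀ {A B} → IsEvent A → IsEvent B → IsEvent (A ∩ᵉ B))
    (∅-event : IsEvent ∅ᵉ)
    (ℙ-cong : ∀ {A B} (a : IsEvent A) (b : IsEvent B) → A ≗ B → ℙ A a ≈ᴹ ℙ B b)
    (ℙ-nonneg : ∀ {A} (a : IsEvent A) → 0ᴹ ≤ᴹ ℙ A a)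
    (ℙ-∅ : ℙ ∅ᵉ ∅-event ≈ᴹ 0ᴹ)
    (ℙ-∪ : ∀ {A B C} (a : IsEvent A) (b : IsEvent B) (c : IsEvent C) →
      C ≗ A ∪ᵉ B → A ∩ᵉ B ≗ ∅ᵉ → ℙ C c ≈ᴹ (ℙ A a +ᴹ ℙ B b))
    where

    any⊆-event : ∀ {n} {E : Subset n → Event Ω} → (∀ S → IsEvent (E S)) → IsEvent (λ ω → any⊆ (λ S → E S ω))
    any⊆-event {zero}  e = e []
    any⊆-event {suc n} e = ∪-event (any⊆-event (e ∘ (inside ∷_))) (any⊆-event (e ∘ (outside ∷_)))

    -- Subsets are the leaves of a binary tree of depth `n`. Splitting by the first membership bit
    -- reduces the claim to additivity for two disjoint events at each branching.
    ℙ-partition : ∀ {n} {E : Subset n → Event Ω} {B} (e : ∀ S → IsEvent (E S)) (b : IsEvent B) →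
      (∀ ω → B ω ≡ true → ∃ λ S → E S ω ≡ true) → (∀ ω S → E S ω ≡ true → B ω ≡ true) →
      (∀ ω S T → E S ω ≡ true → E T ω ≡ true → S ≡ T) →
      ℙ B b ≈ᴹ sum⊆ (λ S → ℙ (E S) (e S))
    ℙ-partition {zero} {E} {B} e b B⊆ ⊆B unique = ℙ-cong b (e []) λ ω → Bool.⇔→≡ {z = true}
      (mk⇔ (λ eq → E[] ω (B⊆ ω eq)) (⊆B ω []))
      where
      E[] : ∀ ω → (∃ λ S → E S ω ≡ true) → E [] ω ≡ true
      E[] ω ([] , eq) = eq
    ℙ-partition {suc n} {E} {B} e b B⊆ ⊆B unique = ≈ᴹ-trans
      (ℙ-∪ i o b
        (λ ω → Bool.⇔→≡ {z = true} (mk⇔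
          (λ eq → let S , p = B⊆ ω eq in any⊆-intro (λ S → E S ω) S p)
          (λ eq → let S , p = any⊆-elim (λ S → E S ω) eq in ⊆B ω S p)))
        (λ ω → disjoint ω (I ω) (O ω) refl refl))
      (+-cong
        (ℙ-partition (e ∘ (inside ∷_)) i (λ ω → any⊆-elim (λ S → E (inside ∷ S) ω))
          (λ ω → any⊆-intro (λ S → E (inside ∷ S) ω))
          (λ ω S T p q → ∷-injectiveʳ (unique ω _ _ p q)))
        (ℙ-partition (e ∘ (outside ∷_)) o (λ ω → any⊆-elim (λ S → E (outside ∷ S) ω))
          (λ ω → any⊆-intro (λ S → E (outside ∷ S) ω))
          (λ ω S T p q → ∷-injectiveʳ (unique ω _ _ p q))))
      where
      I O : Event Ω
      I ω = any⊆ (λ S → E (inside ∷ S) ω)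
      O ω = any⊆ (λ S → E (outside ∷ S) ω)
      i : IsEvent I
      i = any⊆-event (e ∘ (inside ∷_))
      o : IsEvent O
      o = any⊆-event (e ∘ (outside ∷_))
      disjoint : ∀ ω x y → I ω ≡ x → O ω ≡ y → x ∧ y ≡ false
      disjoint ω false y     p q = refl
      disjoint ω true  false p q = refl
      disjoint ω true  true  p q with any⊆-elim (λ S → E (inside ∷ S) ω) p | any⊆-elim (λ S → E (outside ∷ S) ω) q
      ... | S , r | T , s with unique ω _ _ r s
      ... | ()

    ℙ-condition : ∀ {n} (X : Ω → Subset n) {A} (a : IsEvent A)
      {B : Subset n → Event Ω} (b : ∀ S → IsEvent (B S)) → (∀ S → B S ≗ A ∩ᵉ (X ≡̂ S)) →
      ℙ A a ≈ᴹ sum⊆ (λ S → ℙ (B S) (b S))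
    ℙ-condition X {A} a {B} b B≗ = ℙ-partition b a
      (λ ω eq → X ω , trans (B≗ (X ω) ω) (∧-intro eq (==-refl (X ω))))
      (λ ω S eq → proj₁ (∧-true (trans (sym (B≗ S ω)) eq)))
      (λ ω S T p q → trans (sym (==⇒≡ (X ω) S (proj₂ (∧-true {A ω} (trans (sym (B≗ S ω)) p)))))
                                (==⇒≡ (X ω) T (proj₂ (∧-true {A ω} (trans (sym (B≗ T ω)) q)))))

    -- Splitting the event A according to the value of the first variable reduces the
    -- pointwise bound K on A to the bounds K ∸ c S for the remaining variables.
    expectation-≥ : ∀ {n} N (X : Fin N → Ω → Subset n) (e : ∀ i S → IsEvent (X i ≡̂ S))
      (c : Fin N → Subset n → ℕ) {A} (a : IsEvent A) K →
      (∀ ω → A ω ≡ true → K ≤ sum (λ i → c i (X i ω))) →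
      (K ⊠ ℙ A a) ≤ᴹ sumᴹ (λ i → sum⊆ (λ S → c i S ⊠ ℙ (A ∩ᵉ (X i ≡̂ S)) (∩-event a (e i S))))
    expectation-≥ zero X e c {A} a zero bound = ≤-refl
    -- The empty sum cannot reach a positive bound, so `A` is empty and its probability vanishes.
    expectation-≥ zero X e c {A} a (suc K) bound = ≤-reflexive
      (≈ᴹ-trans (×-congʳ (suc K) (≈ᴹ-trans (ℙ-cong a ∅-event A≗∅ᵉ) ℙ-∅)) (⊠-zeroʳ (suc K)))
      where
      A≗∅ᵉ : A ≗ ∅ᵉ
      A≗∅ᵉ ω = Bool.¬-not (λ eq → case bound ω eq of λ ())
    expectation-≥ (suc N) X e c {A} a K bound = begin
      K ⊠ ℙ A a
        ≲⟨ ⊠-monoʳ K (≤-reflexive (ℙ-condition (X zero) a a₀ (λ S ω → refl))) ⟩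
      K ⊠ sum⊆ p₀
        ≈⟨ ⊠-sum⊆ K p₀ ⟩
      sum⊆ (λ S → K ⊠ p₀ S)
        ≲⟨ sum⊆-mono (λ S → ⊠-split K (c zero S) (ℙ-nonneg (a₀ S))) ⟩
      sum⊆ (λ S → (c zero S ⊠ p₀ S) +ᴹ ((K ∸ c zero S) ⊠ p₀ S))
        ≈⟨ sum⊆-distrib-+ (λ S → c zero S ⊠ p₀ S) (λ S → (K ∸ c zero S) ⊠ p₀ S) ⟩
      E₀ +ᴹ sum⊆ (λ S → (K ∸ c zero S) ⊠ p₀ S)
        ≲⟨ +-mono ≤-refl (sum⊆-mono (λ S →
             expectation-≥ N (X ∘ suc) (e ∘ suc) (c ∘ suc) (a₀ S) (K ∸ c zero S) (bound′ S))) ⟩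
      E₀ +ᴹ sum⊆ (λ S → sumᴹ (λ i → sum⊆ (λ T → w i T ⊠ joint i S T)))
        ≈⟨ +-cong ≈ᴹ-refl (sum⊆-sum-comm (λ S i → sum⊆ (λ T → w i T ⊠ joint i S T))) ⟩
      E₀ +ᴹ sumᴹ (λ i → sum⊆ (λ S → sum⊆ (λ T → w i T ⊠ joint i S T)))
        ≲⟨ +-mono ≤-refl (sum-mono (λ i → marginal i)) ⟩
      E₀ +ᴹ sumᴹ (λ i → sum⊆ (λ T → w i T ⊠ p i T)) ∎
      where
      A₀ : Subset _ → Event Ω
      A₀ S = A ∩ᵉ (X zero ≡̂ S)
      a₀ : ∀ S → IsEvent (A₀ S)
      a₀ S = ∩-event a (e zero S)
      p₀ : Subset _ → Carrier
      p₀ S = ℙ (A₀ S) (a₀ S)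
      E₀ : Carrier
      E₀ = sum⊆ (λ S → c zero S ⊠ p₀ S)
      w : Fin N → Subset _ → ℕ
      w = c ∘ suc
      p : Fin N → Subset _ → Carrier
      p i T = ℙ (A ∩ᵉ (X (suc i) ≡̂ T)) (∩-event a (e (suc i) T))
      joint : Fin N → Subset _ → Subset _ → Carrier
      joint i S T = ℙ (A₀ S ∩ᵉ (X (suc i) ≡̂ T)) (∩-event (a₀ S) (e (suc i) T))

      bound′ : ∀ S ω → A₀ S ω ≡ true → K ∸ c zero S ≤ sum (λ i → c (suc i) (X (suc i) ω))
      bound′ S ω eq = ℕ.m≤n+o⇒m∸n≤o K (c zero S) (subst (λ T → K ≤ c zero T + _)
        (==⇒≡ (X zero ω) S (proj₂ (∧-true {A ω} eq))) (bound ω (proj₁ (∧-true eq))))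

      ∧-swap : ∀ x y z → (x ∧ y) ∧ z ≡ (x ∧ z) ∧ y
      ∧-swap true  y z = Bool.∧-comm y z
      ∧-swap false y z = refl

      -- The recursive calls yield joint probabilities with the first variable; summed over its
      -- values, they give back the probabilities within `A`.
      marginal : ∀ i → sum⊆ (λ S → sum⊆ (λ T → w i T ⊠ joint i S T)) ≤ᴹ sum⊆ (λ T → w i T ⊠ p i T)
      marginal i = begin
        sum⊆ (λ S → sum⊆ (λ T → w i T ⊠ joint i S T))
          ≈⟨ sum⊆-comm (λ S T → w i T ⊠ joint i S T) ⟩
        sum⊆ (λ T → sum⊆ (λ S → w i T ⊠ joint i S T))
          ≲⟨ sum⊆-mono (λ T → ≤-reflexive (≈ᴹ-sym (⊠-sum⊆ (w i T) (λ S → joint i S T)))) ⟩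
        sum⊆ (λ T → w i T ⊠ sum⊆ (λ S → joint i S T))
          ≲⟨ sum⊆-mono (λ T → ⊠-monoʳ (w i T) (≤-reflexive (≈ᴹ-sym
               (ℙ-condition (X zero) (∩-event a (e (suc i) T)) (λ S → ∩-event (a₀ S) (e (suc i) T))
                 (λ S ω → ∧-swap (A ω) (X zero ω == S) (X (suc i) ω == T)))))) ⟩
        sum⊆ (λ T → w i T ⊠ p i T) ∎

-- Finite additivity of a probability space

module Probability (space : ProbabilitySpace) where
  open ProbabilitySpace space

  -- Invariance under pointwise equality comes from the union axiom: `B` is a union of the constant
  -- sequence `A`.
  event-cong : ∀ {A B} → IsEvent A → A ≗ B → IsEvent B
  event-cong {A} a A≗B = ⋃-event {λ _ → A} (λ _ → a)
    (λ ω → mk⇔ (λ eq → 0 , trans (A≗B ω) eq) (λ (_ , eq) → trans (sym (A≗B ω)) eq))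

  ∅-event : IsEvent ∅ᵉ
  ∅-event = ∁-event Ω-event

  pair : Event Ω → Event Ω → ℕ → Event Ω
  pair A B zero          = A
  pair A B (suc zero)    = B
  pair A B (suc (suc _)) = ∅ᵉ

  pair-event : ∀ {A B} → IsEvent A → IsEvent B → ∀ i → IsEvent (pair A B i)
  pair-event a b zero          = a
  pair-event a b (suc zero)    = b
  pair-event a b (suc (suc _)) = ∅-event

  ∪-isUnion : ∀ A B → (A ∪ᵉ B) IsUnionOf pair A B
  ∪-isUnion A B ω = mk⇔ to from
    where
    to : A ω ∨ B ω ≡ true → ∃ λ i → pair A B i ω ≡ true
    to eq with ∨-true (A ω) eq
    ... | inj₁ p = 0 , p
    ... | inj₂ p = 1 , p
    from : (∃ λ i → pair A B i ω ≡ true) → A ω ∨ B ω ≡ true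
    from (zero     , p) = cong (_∨ B ω) p
    from (suc zero , p) = trans (cong (A ω ∨_) p) (Bool.∨-zeroʳ (A ω))

  ∪-event : ∀ {A B} → IsEvent A → IsEvent B → IsEvent (A ∪ᵉ B)
  ∪-event {A} {B} a b = ⋃-event (pair-event a b) (∪-isUnion A B)

  ∩-event : ∀ {A B} → IsEvent A → IsEvent B → IsEvent (A ∩ᵉ B)
  ∩-event {A} {B} a b = event-cong (∁-event (∪-event (∁-event a) (∁-event b)))
    (λ ω → deMorgan (A ω) (B ω))
    where
    deMorgan : ∀ x y → not (not x ∨ not y) ≡ x ∧ y
    deMorgan true  true  = refl
    deMorgan true  false = refl
    deMorgan false _     = refl

  partialSum-nonneg : ∀ a → (∀ i → 0ᴿ ≤ᴿ a i) → ∀ n → 0ᴿ ≤ᴿ partialSum a n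
  partialSum-nonneg a a≥0 zero    = ≤ᴿ-refl {0ᴿ}
  partialSum-nonneg a a≥0 (suc n) =
    +ᴿ-mono-≤ {0ᴿ} {partialSum a n} {0ᴿ} {a n} (partialSum-nonneg a a≥0 n) (a≥0 n)

  -- Comparing partial sums of the constant series of ℙ ∅ᵉ two terms apart.
  ℙ-∅ : ℙ ∅ᵉ ∅-event ≈ 0ᴿ
  ℙ-∅ = ≤ᴿ-limit {p} {0ᴿ} p≤ε , ℙ-nonneg ∅-event
    where
    p : ℝ
    p = ℙ ∅ᵉ ∅-event
    ps : ℕ → ℝ
    ps = partialSum (λ _ → p)
    p≤ε : ∀ ε → ℚ.Positive ε → p ≤ᴿ 0ᴿ +ᴿ fromℚ ε
    p≤ε ε ε>0
      with ℙ-additive {λ _ → ∅ᵉ} (λ _ → ∅-event) ∅-event (λ _ _ _ _ → refl)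
             (λ ω → mk⇔ (λ ()) (λ ())) ε ε>0
    ... | N , h = begin
      p                   ≲⟨ ≤̇⇒≤ {p} {0ᴿ +ᴿ p} (λ i → ℚ.≤-reflexive (sym (ℚ.+-identityˡ (seq p i)))) ⟩
      0ᴿ +ᴿ p             ≲⟨ +ᴿ-mono-≤ {0ᴿ} {ps N} {p} {p} (partialSum-nonneg _ (λ _ → ℙ-nonneg ∅-event) N) (≤ᴿ-refl {p}) ⟩
      ps N +ᴿ p           ≲⟨ +ᴿ-cancelˡ-≤ p {ps N +ᴿ p} {fromℚ ε} (begin
          p +ᴿ (ps N +ᴿ p)    ≲⟨ ≤̇⇒≤ {p +ᴿ (ps N +ᴿ p)} {ps (suc (suc N))} (λ i → ℚ.≤-reflexive (ℚ.+-comm (seq p i) _)) ⟩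
          ps (suc (suc N))    ≲⟨ proj₁ (h (suc (suc N)) (ℕ.m≤n+m N 2)) ⟩
          p +ᴿ fromℚ ε        ∎) ⟩
      fromℚ ε             ≲⟨ ≤̇⇒≤ {fromℚ ε} {0ᴿ +ᴿ fromℚ ε} (λ i → ℚ.≤-reflexive (sym (ℚ.+-identityˡ ε))) ⟩
      0ᴿ +ᴿ fromℚ ε       ∎
      where open ≤ᴿ-Reasoning

  -- The sequence `A , B , ∅ᵉ , ∅ᵉ , …` has partial sums that are constant from the second term on,
  -- by `ℙ-∅`; their limit is therefore this constant.
  ℙ-∪ : ∀ {A B C} (a : IsEvent A) (b : IsEvent B) (c : IsEvent C) →
    (∀ ω → C ω ≡ A ω ∨ B ω) → (∀ ω → A ω ∧ B ω ≡ false) → ℙ C c ≈ ℙ A a +ᴿ ℙ B b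
  ℙ-∪ {A} {B} {C} a b c C≗A∪B A∩B≗∅ᵉ = C≤A+B , A+B≤C
    where
    x+y : ℝ
    x+y = ℙ A a +ᴿ ℙ B b
    ps : ℕ → ℝ
    ps = partialSum (λ i → ℙ (pair A B i) (pair-event a b i))

    disjoint : PairwiseDisjoint (pair A B)
    disjoint 0             0             ω i≢j = contradiction refl i≢j
    disjoint 0             1             ω i≢j = A∩B≗∅ᵉ ω
    disjoint 0             (suc (suc _)) ω i≢j = Bool.∧-zeroʳ (A ω)
    disjoint 1             0             ω i≢j = trans (Bool.∧-comm (B ω) (A ω)) (A∩B≗∅ᵉ ω)
    disjoint 1             1             ω i≢j = contradiction refl i≢j
    disjoint 1             (suc (suc _)) ω i≢j = Bool.∧-zeroʳ (B ω)
    disjoint (suc (suc _)) j             ω i≢j = refl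

    sums : (λ i → ℙ (pair A B i) (pair-event a b i)) SumsTo ℙ C c
    sums = ℙ-additive (pair-event a b) c disjoint
      (λ ω → subst (λ v → v ≡ true ⇔ ∃ λ i → pair A B i ω ≡ true) (sym (C≗A∪B ω)) (∪-isUnion A B ω))

    ps≈ : ∀ n → ps (2 + n) ≈ x+y
    ps≈ zero    = ≐⇒≈ {ps 2} {x+y} (λ i → cong (ℚ._+ seq (ℙ B b) i) (ℚ.+-identityˡ (seq (ℙ A a) i)))
    ps≈ (suc n) = ≈-trans {ps (3 + n)} {x+y +ᴿ 0ᴿ} {x+y}
      (+ᴿ-cong {ps (2 + n)} {x+y} {ℙ ∅ᵉ ∅-event} {0ᴿ} (ps≈ n) ℙ-∅)
      (≐⇒≈ {x+y +ᴿ 0ᴿ} {x+y} (λ i → ℚ.+-identityʳ (seq x+y i)))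

    C≤A+B : ℙ C c ≤ᴿ x+y
    C≤A+B = ≤ᴿ-limit {ℙ C c} {x+y} λ ε ε>0 → let N , h = sums ε ε>0 in
      ≤ᴿ-trans {ℙ C c} {ps (2 + N) +ᴿ fromℚ ε} {x+y +ᴿ fromℚ ε} (proj₂ (h (2 + N) (ℕ.m≤n+m N 2)))
        (+ᴿ-mono-≤ {ps (2 + N)} {x+y} {fromℚ ε} {fromℚ ε} (proj₁ (ps≈ N)) (≤ᴿ-refl {fromℚ ε}))

    A+B≤C : x+y ≤ᴿ ℙ C c
    A+B≤C = ≤ᴿ-limit {x+y} {ℙ C c} λ ε ε>0 → let N , h = sums ε ε>0 in
      ≤ᴿ-trans {x+y} {ps (2 + N)} {ℙ C c +ᴿ fromℚ ε} (proj₂ (ps≈ N)) (proj₁ (h (2 + N) (ℕ.m≤n+m N 2)))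

-- Real-valued expectations

+ᴿ-commutativeMonoid : CommutativeMonoid 0ℓ 0ℓ
+ᴿ-commutativeMonoid = record
  { Carrier = ℝ ; _≈_ = _≈_ ; _∙_ = _+ᴿ_ ; ε = 0ᴿ
  ; isCommutativeMonoid = record
    { isMonoid = record
      { isSemigroup = record
        { isMagma = record
          { isEquivalence = Preorder.isEquivalence ≤ᴿ-preorder
          ; ∙-cong = λ {x} {y} {z} {w} → +ᴿ-cong {x} {y} {z} {w} }
        ; assoc = λ x y z → ≐⇒≈ {(x +ᴿ y) +ᴿ z} {x +ᴿ (y +ᴿ z)} (λ i → ℚ.+-assoc (seq x i) (seq y i) (seq z i)) }
      ; identity = (λ x → ≐⇒≈ {0ᴿ +ᴿ x} {x} (λ i → ℚ.+-identityˡ (seq x i)))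
                 , (λ x → ≐⇒≈ {x +ᴿ 0ᴿ} {x} (λ i → ℚ.+-identityʳ (seq x i))) }
    ; comm = λ x y → ≐⇒≈ {x +ᴿ y} {y +ᴿ x} (λ i → ℚ.+-comm (seq x i) (seq y i)) } }

infix 4 _≼_

-- Unlike x ≤ᴿ y, the type x ≼ y determines x and y for unification.
record _≼_ (x y : ℝ) : Set where
  constructor ⟪_⟫
  field get : x ≤ᴿ y

≼-trans : ∀ {x y z} → x ≼ y → y ≼ z → x ≼ z
≼-trans {x} {y} {z} ⟪ p ⟫ ⟪ q ⟫ = ⟪ ≤ᴿ-trans {x} {y} {z} p q ⟫

≼-isPreorder : IsPreorder _≈_ _≼_
≼-isPreorder = record
  { isEquivalence = Preorder.isEquivalence ≤ᴿ-preorder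
  ; reflexive     = λ (x≤y , _) → ⟪ x≤y ⟫
  ; trans         = ≼-trans }

≼-+-mono : ∀ {x y z w} → x ≼ y → z ≼ w → x +ᴿ z ≼ y +ᴿ w
≼-+-mono {x} {y} {z} {w} ⟪ p ⟫ ⟪ q ⟫ = ⟪ +ᴿ-mono-≤ {x} {y} {z} {w} p q ⟫

module ℝ-FinitelyAdditive = FinitelyAdditive +ᴿ-commutativeMonoid _≼_ ≼-isPreorder
  ≼-+-mono
open ℝ-FinitelyAdditive using (sum⊆)
open import Algebra.Properties.CommutativeMonoid.Mult +ᴿ-commutativeMonoid using () renaming (_×_ to _⊠_) public

⊠≐ : ∀ n x → n ⊠ x ≐ x *ᴿ fromℚ (fromℕ n)
⊠≐ zero    x i = sym (ℚ.*-zeroʳ (seq x i))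
⊠≐ (suc n) x i = begin
  seq x i ℚ.+ seq (n ⊠ x) i                       ≡⟨ cong₂ ℚ._+_ (sym (ℚ.*-identityʳ (seq x i))) (⊠≐ n x i) ⟩
  seq x i ℚ.* 1ℚ ℚ.+ seq x i ℚ.* fromℕ n          ≡⟨ ℚ.*-distribˡ-+ (seq x i) 1ℚ (fromℕ n) ⟨
  seq x i ℚ.* (1ℚ ℚ.+ fromℕ n)                    ≡⟨ cong (seq x i ℚ.*_) (fromℕ-homo-+ 1 n) ⟨
  seq x i ℚ.* fromℕ (suc n)                       ∎
  where open ≡-Reasoning

sum⊆≈∑⊆ : ∀ {n} (f : Subset n → ℝ) → sum⊆ f ≈ ∑⊆ f
sum⊆≈∑⊆ {zero}  f = ≈-refl {f []}
sum⊆≈∑⊆ {suc n} f = +ᴿ-cong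
  {sum⊆ (f ∘ (inside ∷_))} {∑⊆ (f ∘ (inside ∷_))} {sum⊆ (f ∘ (outside ∷_))} {∑⊆ (f ∘ (outside ∷_))}
  (sum⊆≈∑⊆ (f ∘ (inside ∷_))) (sum⊆≈∑⊆ (f ∘ (outside ∷_)))

fromℕ≤⊠ : ∀ K {x} → 1ᴿ ≼ x → fromℚ (fromℕ K) ≼ K ⊠ x
fromℕ≤⊠ K {x} 1≼x = ≼-trans
  ⟪ ≤̇⇒≤ {fromℚ (fromℕ K)} {K ⊠ 1ᴿ} (λ i → ℚ.≤-reflexive (sym (trans (⊠≐ K 1ᴿ i) (ℚ.*-identityˡ (fromℕ K))))) ⟫
  (ℝ-FinitelyAdditive.⊠-monoʳ K 1≼x)

weighted-sum-≤ : ∀ {N n} (c : Fin N → Subset n → ℕ) (p q : Fin N → Subset n → ℝ) →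
  (∀ i S → p i S ≼ q i S) →
  ∑ (λ i → sum⊆ (λ S → c i S ⊠ p i S)) ≼ ∑ (λ i → ∑⊆ (λ S → c i S ⊠ q i S))
weighted-sum-≤ c p q p≼q = ℝ-FinitelyAdditive.sum-mono λ i → ≼-trans
  (ℝ-FinitelyAdditive.sum⊆-mono (λ S → ℝ-FinitelyAdditive.⊠-monoʳ (c i S) (p≼q i S)))
  ⟪ proj₁ (sum⊆≈∑⊆ (λ S → c i S ⊠ q i S)) ⟫

module Linearity (space : ProbabilitySpace) where
  open ProbabilitySpace space
  open Probability space
  -- The variables `X i` will be the sets bought on the different instances. They all depend on the
  -- same `ω`, and only their sum is bounded, yet the conclusion mentions each distribution
  -- separately, as `expectedCost` does.
  expectation-bound : ∀ {n} N (X : Fin N → Ω → Subset n) (e : ∀ i S → IsEvent (X i ≡̂ S))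
    (c : Fin N → Subset n → ℕ) K → (∀ ω → K ≤ sum (λ i → c i (X i ω))) →
    fromℚ (fromℕ K) ≼ ∑ (λ i → ∑⊆ (λ S → c i S ⊠ ℙ (X i ≡̂ S) (e i S)))
  expectation-bound N X e c K bound = ≼-trans
    (fromℕ≤⊠ K ⟪ proj₂ ℙ-Ω ⟫)
    (≼-trans
      (ℝ-FinitelyAdditive.expectation-≥ IsEvent ℙ ∪-event ∩-event ∅-event ℙ-cong (λ a → ⟪ ℙ-nonneg a ⟫) ℙ-∅ ℙ-∪
         N X e c Ω-event K (λ ω _ → bound ω))
      (weighted-sum-≤ c (λ i S → ℙ _ (∩-event Ω-event (e i S))) (λ i S → ℙ (X i ≡̂ S) (e i S))
         (λ i S → ⟪ proj₁ (ℙ-cong (∩-event Ω-event (e i S)) (e i S) (λ ω → refl)) ⟫)))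

-- Sums over Boolean vectors

Σᵥ : ∀ {j} → (Vec Bool j → ℕ) → ℕ
Σᵥ {zero}  f = f []
Σᵥ {suc j} f = Σᵥ (f ∘ (false ∷_)) + Σᵥ (f ∘ (true ∷_))

Σᵥ-cong : ∀ {j} {f g : Vec Bool j → ℕ} → f ≗ g → Σᵥ f ≡ Σᵥ g
Σᵥ-cong {zero}  f≗g = f≗g []
Σᵥ-cong {suc j} f≗g = cong₂ _+_ (Σᵥ-cong (f≗g ∘ (false ∷_))) (Σᵥ-cong (f≗g ∘ (true ∷_)))

Σᵥ-mono-≤ : ∀ {j} {f g : Vec Bool j → ℕ} → (∀ v → f v ≤ g v) → Σᵥ f ≤ Σᵥ g
Σᵥ-mono-≤ {zero}  f≤g = f≤g []
Σᵥ-mono-≤ {suc j} f≤g = ℕ.+-mono-≤ (Σᵥ-mono-≤ (f≤g ∘ (false ∷_))) (Σᵥ-mono-≤ (f≤g ∘ (true ∷_)))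

Σᵥ-distrib-+ : ∀ {j} (f g : Vec Bool j → ℕ) → Σᵥ (λ v → f v + g v) ≡ Σᵥ f + Σᵥ g
Σᵥ-distrib-+ {zero}  f g = refl
Σᵥ-distrib-+ {suc j} f g = trans
  (cong₂ _+_ (Σᵥ-distrib-+ (f ∘ (false ∷_)) (g ∘ (false ∷_))) (Σᵥ-distrib-+ (f ∘ (true ∷_)) (g ∘ (true ∷_))))
  (+-interchange (Σᵥ (f ∘ (false ∷_))) _ _ _)

Σᵥ-* : ∀ {j} c (f : Vec Bool j → ℕ) → Σᵥ (λ v → c * f v) ≡ c * Σᵥ f
Σᵥ-* {zero}  c f = refl
Σᵥ-* {suc j} c f = trans (cong₂ _+_ (Σᵥ-* c (f ∘ (false ∷_))) (Σᵥ-* c (f ∘ (true ∷_)))) (sym (ℕ.*-distribˡ-+ c _ _))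

Σᵥ-const : ∀ j c → Σᵥ {j} (λ _ → c) ≡ 2 ^ j * c
Σᵥ-const zero    c = sym (ℕ.*-identityˡ c)
Σᵥ-const (suc j) c = begin
  Σᵥ {j} (λ _ → c) + Σᵥ {j} (λ _ → c)  ≡⟨ cong₂ _+_ (Σᵥ-const j c) (Σᵥ-const j c) ⟩
  2 ^ j * c + 2 ^ j * c                ≡⟨ ℕ.*-distribʳ-+ c (2 ^ j) (2 ^ j) ⟨
  (2 ^ j + 2 ^ j) * c                  ≡⟨ cong (λ z → (2 ^ j + z) * c) (ℕ.+-identityʳ (2 ^ j)) ⟨
  2 ^ suc j * c                        ∎
  where open ≡-Reasoning

Σᵥ-comm : ∀ {i j} (f : Vec Bool i → Vec Bool j → ℕ) → Σᵥ (λ u → Σᵥ (f u)) ≡ Σᵥ (λ v → Σᵥ (λ u → f u v))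
Σᵥ-comm {zero}  f = refl
Σᵥ-comm {suc i} f = trans (cong₂ _+_ (Σᵥ-comm (f ∘ (false ∷_))) (Σᵥ-comm (f ∘ (true ∷_))))
  (sym (Σᵥ-distrib-+ (λ v → Σᵥ (λ u → f (false ∷ u) v)) (λ v → Σᵥ (λ u → f (true ∷ u) v))))

≤Σᵥ : ∀ {j} (f : Vec Bool j → ℕ) v → f v ≤ Σᵥ f
≤Σᵥ f []          = ℕ.≤-refl
≤Σᵥ f (false ∷ v) = ℕ.≤-trans (≤Σᵥ (f ∘ (false ∷_)) v) (ℕ.m≤m+n _ _)
≤Σᵥ f (true ∷ v)  = ℕ.≤-trans (≤Σᵥ (f ∘ (true ∷_)) v) (ℕ.m≤n+m _ _)

-- Out of range nothing changes. This covers the last level `ℓ = j`, after which no coin remains and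
-- `flip j s` is `s`.
flip : ∀ {j} → ℕ → Vec Bool j → Vec Bool j
flip i       []      = []
flip zero    (b ∷ v) = not b ∷ v
flip (suc i) (b ∷ v) = b ∷ flip i v

Σᵥ-flip : ∀ {j} i (f : Vec Bool j → ℕ) → Σᵥ (f ∘ flip i) ≡ Σᵥ f
Σᵥ-flip {zero}  i       f = refl
Σᵥ-flip {suc j} zero    f = ℕ.+-comm (Σᵥ (f ∘ (true ∷_))) (Σᵥ (f ∘ (false ∷_)))
Σᵥ-flip {suc j} (suc i) f = cong₂ _+_ (Σᵥ-flip i (f ∘ (false ∷_))) (Σᵥ-flip i (f ∘ (true ∷_)))

Σᵥ-≡ : ∀ {j} (s : Vec Bool j) c → Σᵥ (λ t → if t == s then c else 0) ≡ c
Σᵥ-≡ []          c = refl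
Σᵥ-≡ {suc j} (b ∷ s) c = go b
  where
  zeros : Σᵥ {j} (λ _ → 0) ≡ 0
  zeros = trans (Σᵥ-const j 0) (ℕ.*-zeroʳ (2 ^ j))
  go : ∀ b → Σᵥ (λ t → if t == (b ∷ s) then c else 0) ≡ c
  go false = trans (cong₂ _+_ (Σᵥ-≡ s c) zeros) (ℕ.+-identityʳ c)
  go true  = cong₂ _+_ zeros (Σᵥ-≡ s c)

Σ< : ℕ → (ℕ → ℕ) → ℕ
Σ< zero    f = 0
Σ< (suc n) f = Σ< n f + f n

Σ<-≥ : ∀ n {f c} → (∀ i → i < n → c ≤ f i) → n * c ≤ Σ< n f
Σ<-≥ zero    c≤f = z≤n
Σ<-≥ (suc n) {f} {c} c≤f = ℕ.≤-trans (ℕ.≤-reflexive (ℕ.+-comm c (n * c)))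
  (ℕ.+-mono-≤ (Σ<-≥ n (λ i i<n → c≤f i (ℕ.m<n⇒m<1+n i<n))) (c≤f n ℕ.≤-refl))

Σ<-* : ∀ n c f → Σ< n (λ i → c * f i) ≡ c * Σ< n f
Σ<-* zero    c f = sym (ℕ.*-zeroʳ c)
Σ<-* (suc n) c f = trans (cong (_+ c * f n) (Σ<-* n c f)) (sym (ℕ.*-distribˡ-+ c (Σ< n f) (f n)))

Σ<-Σᵥ-comm : ∀ n {j} (f : ℕ → Vec Bool j → ℕ) → Σ< n (λ i → Σᵥ (f i)) ≡ Σᵥ (λ v → Σ< n (λ i → f i v))
Σ<-Σᵥ-comm zero    {j} f = sym (trans (Σᵥ-const j 0) (ℕ.*-zeroʳ (2 ^ j)))
Σ<-Σᵥ-comm (suc n) f = trans (cong (_+ Σᵥ (f n)) (Σ<-Σᵥ-comm n f))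
  (sym (Σᵥ-distrib-+ (λ v → Σ< n (λ i → f i v)) (f n)))

Σ<-indicator : ∀ n m c → Σ< n (λ i → if m ≡ᵇ i then c else 0) ≤ c
Σ<-indicator n m c = go n
  where
  vanish : ∀ n → n ≤ m → Σ< n (λ i → if m ≡ᵇ i then c else 0) ≡ 0
  vanish zero    n≤m = refl
  vanish (suc n) n<m with m ≡ᵇ n in eq
  ... | true  = contradiction (sym (ℕ.≡ᵇ⇒≡ m n (subst T (sym eq) _))) (ℕ.<⇒≢ n<m)
  ... | false = trans (ℕ.+-identityʳ _) (vanish n (ℕ.<⇒≤ n<m))
  go : ∀ n → Σ< n (λ i → if m ≡ᵇ i then c else 0) ≤ c
  go zero    = z≤n
  go (suc n) with m ≡ᵇ n in eq
  ... | true  = ℕ.≤-reflexive (cong (_+ c) (vanish n (ℕ.≤-reflexive (sym (ℕ.≡ᵇ⇒≡ m n (subst T (sym eq) _))))))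
  ... | false = ℕ.≤-trans (ℕ.≤-reflexive (ℕ.+-identityʳ _)) (go n)

-- Longest common prefixes

lcp : ∀ {j} → Vec Bool j → Vec Bool j → ℕ
lcp []      []      = 0
lcp (p ∷ s) (q ∷ t) = if p xor q then 0 else suc (lcp s t)

lcp-full : ∀ {j} (s t : Vec Bool j) → j ≤ lcp s t → s ≡ t
lcp-full []          []          j≤ = refl
lcp-full (false ∷ s) (false ∷ t) (s≤s j≤) = cong (false ∷_) (lcp-full s t j≤)
lcp-full (true ∷ s)  (true ∷ t)  (s≤s j≤) = cong (true ∷_) (lcp-full s t j≤)

-- The first `ℓ` entries agree and survive the flip. Entry `ℓ` agrees with that of `t` either before
-- or after the flip, but not both times; if there is no such entry, the common prefix ends at `ℓ`
-- anyway.
lcp-flip : ∀ {j} ℓ (s t : Vec Bool j) → ℓ ≤ lcp s t → lcp s t ≡ ℓ ⊎ lcp (flip ℓ s) t ≡ ℓ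
lcp-flip zero    []          []          ℓ≤ = inj₁ refl
lcp-flip zero    (false ∷ s) (false ∷ t) ℓ≤ = inj₂ refl
lcp-flip zero    (false ∷ s) (true ∷ t)  ℓ≤ = inj₁ refl
lcp-flip zero    (true ∷ s)  (false ∷ t) ℓ≤ = inj₁ refl
lcp-flip zero    (true ∷ s)  (true ∷ t)  ℓ≤ = inj₂ refl
lcp-flip (suc ℓ) []          []          ()
lcp-flip (suc ℓ) (false ∷ s) (false ∷ t) (s≤s ℓ≤) with lcp-flip ℓ s t ℓ≤
... | inj₁ eq = inj₁ (cong suc eq)
... | inj₂ eq = inj₂ (cong suc eq)
lcp-flip (suc ℓ) (true ∷ s)  (true ∷ t)  (s≤s ℓ≤) with lcp-flip ℓ s t ℓ≤
... | inj₁ eq = inj₁ (cong suc eq)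
... | inj₂ eq = inj₂ (cong suc eq)

-- Level 0 requests the far pole, which is reached from one side only. Level `suc i` requests the
-- middles of depth `i`, which can be reached through either half around them; entry `i` of a column
-- says which half.
mirror : ∀ {j} → ℕ → Vec Bool j → Vec Bool j
mirror zero    x = x
mirror (suc i) x = flip i x

Σᵥ-mirror : ∀ {j} ℓ (f : Vec Bool j → ℕ) → Σᵥ (f ∘ mirror ℓ) ≡ Σᵥ f
Σᵥ-mirror zero    f = refl
Σᵥ-mirror (suc i) f = Σᵥ-flip i f

-- An element t sharing at least ℓ entries with s shares exactly ℓ entries with s or with
-- flip ℓ s. Hence each of the 1 + j levels accounts for a quarter of the pairs (s , x).
levels-bound : ∀ j (B : Vec Bool j → Vec Bool j → Vec Bool j → ℕ) →
  (∀ ℓ → ℓ ≤ j → ∀ s x → ∃ λ t → ∃ λ y →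
    ℓ ≤ lcp s t × (y ≡ x ⊎ y ≡ mirror ℓ x) × 1 ≤ B s t y × 1 ≤ B (flip ℓ s) t y) →
  suc j * (2 ^ j * 2 ^ j) ≤ 4 * Σᵥ (λ s → Σᵥ (λ t → Σᵥ (λ x → B s t x)))
levels-bound j B hit = begin
  suc j * (2 ^ j * 2 ^ j)                       ≤⟨ Σ<-≥ (suc j) level-bound ⟩
  Σ< (suc j) (λ ℓ → 4 * F ℓ)                    ≡⟨ Σ<-* (suc j) 4 F ⟩
  4 * Σ< (suc j) F                              ≤⟨ ℕ.*-monoʳ-≤ 4 F-total ⟩
  4 * Σᵥ (λ s → Σᵥ (λ t → Σᵥ (λ x → B s t x)))  ∎
  where
  open ℕ.≤-Reasoning

  -- Only choices `t` that leave `s` after exactly `ℓ` entries are counted, which makes the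
  -- contributions of the levels disjoint.
  f : ℕ → Vec Bool j → Vec Bool j → ℕ
  f ℓ s x = Σᵥ (λ t → if lcp s t ≡ᵇ ℓ then B s t x else 0)

  F : ℕ → ℕ
  F ℓ = Σᵥ (λ s → Σᵥ (f ℓ s))

  f-≥1 : ∀ ℓ s t x → lcp s t ≡ ℓ → 1 ≤ B s t x → 1 ≤ f ℓ s x
  f-≥1 ℓ s t x refl 1≤B = ℕ.≤-trans
    (ℕ.≤-trans 1≤B (ℕ.≤-reflexive (sym (cong (λ b → if b then B s t x else 0) (refl-≡ᵇ (lcp s t))))))
    (≤Σᵥ (λ t → if lcp s t ≡ᵇ ℓ then B s t x else 0) t)
    where
    refl-≡ᵇ : ∀ m → (m ≡ᵇ m) ≡ true
    refl-≡ᵇ zero    = refl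
    refl-≡ᵇ (suc m) = refl-≡ᵇ m

  four-≥1 : ∀ ℓ → ℓ ≤ j → ∀ s x →
    1 ≤ (f ℓ s x + f ℓ s (mirror ℓ x)) + (f ℓ (flip ℓ s) x + f ℓ (flip ℓ s) (mirror ℓ x))
  four-≥1 ℓ ℓ≤j s x with hit ℓ ℓ≤j s x
  ... | t , y , ℓ≤lcp , y≡ , b , b′ with lcp-flip ℓ s t ℓ≤lcp | y≡
  ... | inj₁ eq | inj₁ refl = ℕ.≤-trans (f-≥1 ℓ s t x eq b) (ℕ.≤-trans (ℕ.m≤m+n _ _) (ℕ.m≤m+n _ _))
  ... | inj₁ eq | inj₂ refl = ℕ.≤-trans (f-≥1 ℓ s t _ eq b) (ℕ.≤-trans (ℕ.m≤n+m _ (f ℓ s x)) (ℕ.m≤m+n _ _))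
  ... | inj₂ eq | inj₁ refl = ℕ.≤-trans (f-≥1 ℓ (flip ℓ s) t x eq b′)
    (ℕ.≤-trans (ℕ.m≤m+n _ _) (ℕ.m≤n+m _ (f ℓ s x + f ℓ s (mirror ℓ x))))
  ... | inj₂ eq | inj₂ refl = ℕ.≤-trans (f-≥1 ℓ (flip ℓ s) t _ eq b′)
    (ℕ.≤-trans (ℕ.m≤n+m _ (f ℓ (flip ℓ s) x)) (ℕ.m≤n+m _ (f ℓ s x + f ℓ s (mirror ℓ x))))

  level-bound : ∀ ℓ → ℓ < suc j → 2 ^ j * 2 ^ j ≤ 4 * F ℓ
  level-bound ℓ (s≤s ℓ≤j) = begin
    2 ^ j * 2 ^ j
      ≡⟨ cong (2 ^ j *_) (ℕ.*-identityʳ (2 ^ j)) ⟨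
    2 ^ j * (2 ^ j * 1)
      ≡⟨ trans (Σᵥ-cong {j} (λ _ → Σᵥ-const j 1)) (Σᵥ-const j (2 ^ j * 1)) ⟨
    Σᵥ {j} (λ s → Σᵥ {j} (λ x → 1))
      ≤⟨ Σᵥ-mono-≤ (λ s → Σᵥ-mono-≤ (four-≥1 ℓ ℓ≤j s)) ⟩
    Σᵥ (λ s → Σᵥ (λ x → (f ℓ s x + f ℓ s (mirror ℓ x)) + (f ℓ (flip ℓ s) x + f ℓ (flip ℓ s) (mirror ℓ x))))
      -- `mirror ℓ` permutes the columns and `flip ℓ` the coin sequences, so the four terms have the
      -- same total `F ℓ`.
      ≡⟨ Σᵥ-cong (λ s → trans (Σᵥ-distrib-+ (λ x → f ℓ s x + f ℓ s (mirror ℓ x)) _)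
           (cong₂ _+_ (double s) (double (flip ℓ s)))) ⟩
    Σᵥ (λ s → (Σᵥ (f ℓ s) + Σᵥ (f ℓ s)) + (Σᵥ (f ℓ (flip ℓ s)) + Σᵥ (f ℓ (flip ℓ s))))
      ≡⟨ Σᵥ-distrib-+ (λ s → Σᵥ (f ℓ s) + Σᵥ (f ℓ s)) _ ⟩
    Σᵥ (λ s → Σᵥ (f ℓ s) + Σᵥ (f ℓ s)) + Σᵥ (λ s → Σᵥ (f ℓ (flip ℓ s)) + Σᵥ (f ℓ (flip ℓ s)))
      ≡⟨ cong (Σᵥ (λ s → Σᵥ (f ℓ s) + Σᵥ (f ℓ s)) +_) (Σᵥ-flip ℓ (λ s → Σᵥ (f ℓ s) + Σᵥ (f ℓ s))) ⟩
    Σᵥ (λ s → Σᵥ (f ℓ s) + Σᵥ (f ℓ s)) + Σᵥ (λ s → Σᵥ (f ℓ s) + Σᵥ (f ℓ s))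
      ≡⟨ cong₂ _+_ (Σᵥ-distrib-+ (λ s → Σᵥ (f ℓ s)) _) (Σᵥ-distrib-+ (λ s → Σᵥ (f ℓ s)) _) ⟩
    (F ℓ + F ℓ) + (F ℓ + F ℓ)
      ≡⟨ solve 1 (λ a → (a :+ a) :+ (a :+ a) := con 4 :* a) refl (F ℓ) ⟩
    4 * F ℓ ∎
    where
    open ℕ-Solver
    double : ∀ s → Σᵥ (λ x → f ℓ s x + f ℓ s (mirror ℓ x)) ≡ Σᵥ (f ℓ s) + Σᵥ (f ℓ s)
    double s = trans (Σᵥ-distrib-+ (f ℓ s) _) (cong (Σᵥ (f ℓ s) +_) (Σᵥ-mirror ℓ (f ℓ s)))

  F-total : Σ< (suc j) F ≤ Σᵥ (λ s → Σᵥ (λ t → Σᵥ (λ x → B s t x)))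
  F-total = begin
    Σ< (suc j) F
      ≡⟨ Σ<-Σᵥ-comm (suc j) (λ ℓ s → Σᵥ (f ℓ s)) ⟩
    Σᵥ (λ s → Σ< (suc j) (λ ℓ → Σᵥ (f ℓ s)))
      ≤⟨ Σᵥ-mono-≤ (λ s → begin
           Σ< (suc j) (λ ℓ → Σᵥ (f ℓ s))
             ≡⟨ Σ<-Σᵥ-comm (suc j) (λ ℓ → f ℓ s) ⟩
           Σᵥ (λ x → Σ< (suc j) (λ ℓ → f ℓ s x))
             ≡⟨ Σᵥ-cong (λ x → Σ<-Σᵥ-comm (suc j) (λ ℓ t → if lcp s t ≡ᵇ ℓ then B s t x else 0)) ⟩
           Σᵥ (λ x → Σᵥ (λ t → Σ< (suc j) (λ ℓ → if lcp s t ≡ᵇ ℓ then B s t x else 0)))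
             -- A pair `s , t` has a single value of `lcp`, so it is counted at one level at most.
             ≤⟨ Σᵥ-mono-≤ (λ x → Σᵥ-mono-≤ (λ t → Σ<-indicator (suc j) (lcp s t) (B s t x))) ⟩
           Σᵥ (λ x → Σᵥ (λ t → B s t x))
             ≡⟨ Σᵥ-comm (λ x t → B s t x) ⟩
           Σᵥ (λ t → Σᵥ (λ x → B s t x)) ∎) ⟩
    Σᵥ (λ s → Σᵥ (λ t → Σᵥ (λ x → B s t x))) ∎

-- The diamond graph

-- The diamond of depth suc j consists of four copies of the diamond of depth j: sub q h is
-- the interior of the half h (false next to the root) of the side q, whose middle is mid q.
data Inner : ℕ → Set where
  mid : ∀ {j} → Bool → Inner (suc j)
  sub : ∀ {j} → Bool → Bool → Inner j → Inner (suc j)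

data Node (j : ℕ) : Set where
  pole  : Bool → Node j
  inner : Inner j → Node j

-- Embedding of the copy `q , h`: its pole `h` stays a pole, while its other pole becomes the middle
-- of the side `q`, shared by the two halves.
glue : ∀ {j} → Bool → Bool → Node j → Node (suc j)
glue q h (pole c)  = if h xor c then inner (mid q) else pole c
glue q h (inner v) = inner (sub q h v)

-- The edge in column x of the path with choices t joins endpoint false t x and endpoint true t x.
endpoint : ∀ {j} → Bool → Vec Bool j → Vec Bool j → Node j
endpoint c []      []      = pole c
endpoint c (q ∷ t) (h ∷ x) = glue q h (endpoint c t x)

-- Whether a node lies beyond the column `x` as seen from the root. A node in the other half than
-- the column is beyond it exactly when the column is in the half next to the root, that is, when
-- `h` is `false`.
right : ∀ {j} → Vec Bool j → Node j → Bool
right x       (pole c)             = c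
right (h ∷ x) (inner (mid q))      = not h
right (h ∷ x) (inner (sub q k v)) = if h xor k then not h else right x (inner v)

-- The part of the side s of a diamond i levels down lying between its column x and the
-- mirror image of that column.
cut : ∀ {j} → ℕ → Vec Bool j → Vec Bool j → Node j → Bool
cut i       s       x       (pole c)            = false
cut zero    (p ∷ s) (h ∷ x) (inner (mid q))     = not (p xor q)
-- In the half next to the root the nodes beyond the column are taken, in the other half those
-- before it: a neighbourhood of the middle.
cut zero    (p ∷ s) (h ∷ x) (inner (sub q k v)) = not (p xor q) ∧ (k xor right x (inner v))
cut (suc i) (p ∷ s) (h ∷ x) (inner (mid q))     = false
cut (suc i) (p ∷ s) (h ∷ x) (inner (sub q k v)) = not (p xor q) ∧ (not (h xor k) ∧ cut i s x (inner v))

separator : ∀ {j} → ℕ → Vec Bool j → Vec Bool j → Node j → Bool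
separator zero    s x = right x
separator (suc i) s x = cut i s x

-- The recursion of `right` follows inner nodes; this form includes the poles of the copies, so it
-- applies to both ends of any edge.
right-glue : ∀ {j} h (x : Vec Bool j) q k u →
  right (h ∷ x) (glue q k u) ≡ (if h xor k then not h else right x u)
right-glue h     x q k     (inner v)    = refl
right-glue false x q false (pole false) = refl
right-glue false x q false (pole true)  = refl
right-glue false x q true  (pole false) = refl
right-glue false x q true  (pole true)  = refl
right-glue true  x q false (pole false) = refl
right-glue true  x q false (pole true)  = refl
right-glue true  x q true  (pole false) = refl
right-glue true  x q true  (pole true)  = refl

cut-zero-glue : ∀ {j} p (s : Vec Bool j) h x q k u →
  cut zero (p ∷ s) (h ∷ x) (glue q k u) ≡ not (p xor q) ∧ (k xor right x u)
cut-zero-glue p s h x q k     (inner v)    = refl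
cut-zero-glue p s h x q false (pole false) = sym (Bool.∧-zeroʳ _)
cut-zero-glue p s h x q false (pole true)  = sym (Bool.∧-identityʳ _)
cut-zero-glue p s h x q true  (pole false) = sym (Bool.∧-identityʳ _)
cut-zero-glue p s h x q true  (pole true)  = sym (Bool.∧-zeroʳ _)

cut-suc-glue : ∀ {j} i p (s : Vec Bool j) h x q k u →
  cut (suc i) (p ∷ s) (h ∷ x) (glue q k u) ≡ not (p xor q) ∧ (not (h xor k) ∧ cut i s x u)
cut-suc-glue i p s h x q k     (inner v)    = refl
cut-suc-glue i p s h x q false (pole false) = sym (trans (cong (not (p xor q) ∧_) (Bool.∧-zeroʳ _)) (Bool.∧-zeroʳ _))
cut-suc-glue i p s h x q false (pole true)  = sym (trans (cong (not (p xor q) ∧_) (Bool.∧-zeroʳ _)) (Bool.∧-zeroʳ _))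
cut-suc-glue i p s h x q true  (pole false) = sym (trans (cong (not (p xor q) ∧_) (Bool.∧-zeroʳ _)) (Bool.∧-zeroʳ _))
cut-suc-glue i p s h x q true  (pole true)  = sym (trans (cong (not (p xor q) ∧_) (Bool.∧-zeroʳ _)) (Bool.∧-zeroʳ _))

not-xor-true : ∀ p q → p xor q ≡ false → p ≡ q
not-xor-true false false eq = refl
not-xor-true true  true  eq = refl

Crosses : ∀ {j} → (Node j → Bool) → Vec Bool j → Vec Bool j → Set
Crosses P t y = P (endpoint false t y) ≢ P (endpoint true t y)

right-crosses : ∀ {j} (x t y : Vec Bool j) → Crosses (right x) t y → y ≡ x
right-crosses []      []      []      cr = refl
right-crosses (h ∷ x) (q ∷ t) (k ∷ y) cr
  rewrite right-glue h x q k (endpoint false t y) | right-glue h x q k (endpoint true t y)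
  with h xor k in eq
... | true  = contradiction refl cr
... | false = cong₂ _∷_ (sym (not-xor-true h k eq)) (right-crosses x t y cr)

head-or-mirror : ∀ {j} h k (x : Vec Bool j) → k ∷ x ≡ h ∷ x ⊎ k ∷ x ≡ not h ∷ x
head-or-mirror false false x = inj₁ refl
head-or-mirror false true  x = inj₂ refl
head-or-mirror true  false x = inj₂ refl
head-or-mirror true  true  x = inj₁ refl

cut-crosses : ∀ {j} i (s x t y : Vec Bool j) → Crosses (cut i s x) t y →
  suc i ≤ lcp s t × (y ≡ x ⊎ y ≡ flip i x)
cut-crosses i [] [] [] [] cr = contradiction refl cr
cut-crosses zero (p ∷ s) (h ∷ x) (q ∷ t) (k ∷ y) cr
  rewrite cut-zero-glue p s h x q k (endpoint false t y) | cut-zero-glue p s h x q k (endpoint true t y)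
  with p xor q in eq
... | true  = contradiction refl cr
... | false with right-crosses x t y (λ r → cr (cong (k xor_) r))
... | refl = s≤s z≤n , head-or-mirror h k x
cut-crosses (suc i) (p ∷ s) (h ∷ x) (q ∷ t) (k ∷ y) cr
  rewrite cut-suc-glue i p s h x q k (endpoint false t y) | cut-suc-glue i p s h x q k (endpoint true t y)
  with p xor q in eq | h xor k in eq′
... | true  | _    = contradiction refl cr
... | false | true = contradiction refl cr
... | false | false with not-xor-true h k eq′ | cut-crosses i s x t y cr
... | refl | i< , inj₁ y≡ = s≤s i< , inj₁ (cong (h ∷_) y≡)
... | refl | i< , inj₂ y≡ = s≤s i< , inj₂ (cong (h ∷_) y≡)

separator-crosses : ∀ {j} ℓ (s x t y : Vec Bool j) → Crosses (separator ℓ s x) t y →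
  ℓ ≤ lcp s t × (y ≡ x ⊎ y ≡ mirror ℓ x)
separator-crosses zero    s x t y cr = z≤n , inj₁ (right-crosses x t y cr)
separator-crosses (suc i) s x t y cr = cut-crosses i s x t y cr

right-endpoint : ∀ {j} c (t y : Vec Bool j) → right y (endpoint c t y) ≡ c
right-endpoint c []      []      = refl
right-endpoint c (q ∷ t) (h ∷ y) = trans (right-glue h y q h (endpoint c t y))
  (trans (cong (λ b → if b then not h else right y (endpoint c t y)) (Bool.xor-same h)) (right-endpoint c t y))

cut-endpoint : ∀ {i} (t y : Vec Bool (suc i)) → ∃ λ d → ∀ c → cut i t y (endpoint c t y) ≡ d xor c
cut-endpoint {zero} (q ∷ []) (h ∷ []) = h , λ c → trans (cut-zero-glue q [] h [] q h (pole c))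
  (cong (λ b → not b ∧ (h xor c)) (Bool.xor-same q))
cut-endpoint {suc i} (q ∷ t) (h ∷ y) with cut-endpoint t y
... | d , eq = d , λ c → trans (cut-suc-glue i q t h y q h (endpoint c t y))
  (trans (cong₂ (λ b b′ → not b ∧ (not b′ ∧ cut i t y (endpoint c t y))) (Bool.xor-same q) (Bool.xor-same h)) (eq c))

-- At the finest level the region shrinks to the single deepest middle at one end of the edge, or to
-- the far pole for `j = 0`. As `lcp` is then full, this cut identifies the choices `t`; it serves
-- to show that the graph is simple.
separator-endpoint : ∀ {j} (t y : Vec Bool j) → Crosses (separator j t y) t y
separator-endpoint {zero}  []  []  = λ ()
separator-endpoint {suc i} t y eq with cut-endpoint t y
... | d , h = xor-≢ d (trans (sym (h false)) (trans eq (h true)))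
  where
  xor-≢ : ∀ d → d xor false ≢ d xor true
  xor-≢ false ()
  xor-≢ true  ()

separator-root : ∀ {j} ℓ (s x : Vec Bool j) → separator ℓ s x (pole false) ≡ false
separator-root zero    s x = refl
separator-root (suc i) s x = refl

-- The requests

level : ∀ {j} → ℕ → Vec Bool j → List (Inner j)
level i       []      = []
level zero    (q ∷ s) = mid q ∷ []
level (suc i) (q ∷ s) = List.map (sub q false) (level i s) ++ List.map (sub q true) (level i s)

-- Later levels stand in front because request lists start with the most recent one. `upTo i s`
-- depends on the first `i` coins only.
upTo : ∀ {j} → ℕ → Vec Bool j → List (Node j)
upTo zero    s = pole true ∷ []
upTo (suc i) s = List.map inner (level i s) ++ upTo i s

level-flip : ∀ {j} i m (s : Vec Bool j) → i < m → level i (flip m s) ≡ level i s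
level-flip i       m       []      i<m       = refl
level-flip zero    (suc m) (q ∷ s) i<m       = refl
level-flip (suc i) (suc m) (q ∷ s) (s≤s i<m) =
  cong (λ L → List.map (sub q false) L ++ List.map (sub q true) L) (level-flip i m s i<m)

upTo-flip : ∀ {j} i m (s : Vec Bool j) → i ≤ m → upTo i (flip m s) ≡ upTo i s
upTo-flip zero    m s i≤m = refl
upTo-flip (suc i) m s i<m = cong₂ (λ L M → List.map inner L ++ M) (level-flip i m s i<m) (upTo-flip i m s (ℕ.<⇒≤ i<m))

cut-target : ∀ {j} i (s x : Vec Bool j) → i < j → ∃ λ v → v ∈ˡ level i s × cut i s x (inner v) ≡ true
cut-target zero    (q ∷ s) (h ∷ x) i<j = mid q , hereˡ refl , cong not (Bool.xor-same q)
cut-target (suc i) (q ∷ s) (h ∷ x) (s≤s i<j) with cut-target i s x i<j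
... | v , v∈ , eq = sub q h v , at h ,
  cong₂ (λ b b′ → not b ∧ b′) (Bool.xor-same q) (cong₂ (λ b b′ → not b ∧ b′) (Bool.xor-same h) eq)
  where
  at : ∀ h → sub q h v ∈ˡ level (suc i) (q ∷ s)
  at false = ∈-++⁺ˡ (∈-map⁺ (sub q false) v∈)
  at true  = ∈-++⁺ʳ (List.map (sub q false) (level i s)) (∈-map⁺ (sub q true) v∈)

separator-target : ∀ {j} ℓ (s x : Vec Bool j) → ℓ ≤ j → ∃ λ v → v ∈ˡ upTo ℓ s × separator ℓ s x v ≡ true
separator-target zero    s x ℓ≤j = pole true , hereˡ refl , refl
separator-target (suc i) s x i<j with cut-target i s x i<j
... | v , v∈ , eq = inner v , ∈-++⁺ˡ (∈-map⁺ inner v∈) , eq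

length-level : ∀ {j} i (s : Vec Bool j) → i < j → length (level i s) ≡ 2 ^ i
length-level zero    (q ∷ s) i<j       = refl
length-level (suc i) (q ∷ s) (s≤s i<j) = begin
  length (List.map (sub q false) (level i s) ++ List.map (sub q true) (level i s))
    ≡⟨ List.length-++ (List.map (sub q false) (level i s)) ⟩
  length (List.map (sub q false) (level i s)) + length (List.map (sub q true) (level i s))
    ≡⟨ cong₂ _+_ (List.length-map _ (level i s)) (List.length-map _ (level i s)) ⟩
  length (level i s) + length (level i s)
    ≡⟨ cong₂ _+_ (length-level i s i<j) (trans (length-level i s i<j) (sym (ℕ.+-identityʳ (2 ^ i)))) ⟩
  2 ^ suc i ∎
  where open ≡-Reasoning

length-upTo : ∀ {j} i (s : Vec Bool j) → i ≤ j → length (upTo i s) ≡ 2 ^ i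
length-upTo zero    s i≤j = refl
length-upTo (suc i) s i<j = begin
  length (List.map inner (level i s) ++ upTo i s)
    ≡⟨ List.length-++ (List.map inner (level i s)) ⟩
  length (List.map inner (level i s)) + length (upTo i s)
    ≡⟨ cong₂ _+_ (trans (List.length-map inner (level i s)) (length-level i s i<j))
                 (trans (length-upTo i s (ℕ.<⇒≤ i<j)) (sym (ℕ.+-identityʳ (2 ^ i)))) ⟩
  2 ^ suc i ∎
  where open ≡-Reasoning

sub-injective : ∀ {j q h q′ h′} {v w : Inner j} → sub q h v ≡ sub q′ h′ w → h ≡ h′ × v ≡ w
sub-injective refl = refl , refl

inner-injective : ∀ {j} {v w : Inner j} → inner v ≡ inner w → v ≡ w
inner-injective refl = refl

level-unique : ∀ {j} i (s : Vec Bool j) → Unique (level i s)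
level-unique i       []      = []ᵘ
level-unique zero    (q ∷ s) = All.[] ∷ᵘ []ᵘ
level-unique (suc i) (q ∷ s) = Unique.++⁺
  (Unique.map⁺ (proj₂ ∘ sub-injective) (level-unique i s))
  (Unique.map⁺ (proj₂ ∘ sub-injective) (level-unique i s))
  λ (p , p′) → let _ , _ , eq = ∈-map⁻ _ p ; _ , _ , eq′ = ∈-map⁻ _ p′ in
    case proj₁ (sub-injective (trans (sym eq) eq′)) of λ ()

-- Tells the levels apart, so that no node is requested twice.
depth : ∀ {j} → Inner j → ℕ
depth (mid q)     = 0
depth (sub q h v) = suc (depth v)

depth-level : ∀ {j} i (s : Vec Bool j) v → v ∈ˡ level i s → depth v ≡ i
depth-level zero    (q ∷ s) v (hereˡ refl) = refl
depth-level (suc i) (q ∷ s) v v∈ with ∈-++⁻ (List.map (sub q false) (level i s)) v∈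
... | inj₁ p with ∈-map⁻ (sub q false) p
... | w , w∈ , refl = cong suc (depth-level i s w w∈)
depth-level (suc i) (q ∷ s) v v∈ | inj₂ p with ∈-map⁻ (sub q true) p
... | w , w∈ , refl = cong suc (depth-level i s w w∈)

depth-upTo : ∀ {j} i (s : Vec Bool j) v → inner v ∈ˡ upTo i s → depth v < i
depth-upTo zero    s v (hereˡ ())
depth-upTo (suc i) s v v∈ with ∈-++⁻ (List.map inner (level i s)) v∈
... | inj₁ p with ∈-map⁻ inner p
... | w , w∈ , refl = ℕ.≤-reflexive (cong suc (depth-level i s w w∈))
depth-upTo (suc i) s v v∈ | inj₂ p = ℕ.m<n⇒m<1+n (depth-upTo i s v p)

upTo-unique : ∀ {j} i (s : Vec Bool j) → Unique (upTo i s)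
upTo-unique zero    s = All.[] ∷ᵘ []ᵘ
upTo-unique (suc i) s = Unique.++⁺ (Unique.map⁺ inner-injective (level-unique i s)) (upTo-unique i s) disjoint
  where
  disjoint : ∀ {v} → ¬ (v ∈ˡ List.map inner (level i s) × v ∈ˡ upTo i s)
  disjoint (p , p′) with ∈-map⁻ inner p
  ... | w , w∈ , refl = ℕ.<⇒≢ (depth-upTo i s w p′) (depth-level i s w w∈)

root∉upTo : ∀ {j} i (s : Vec Bool j) → ¬ (pole false ∈ˡ upTo i s)
root∉upTo zero    s (hereˡ ())
root∉upTo (suc i) s p with ∈-++⁻ (List.map inner (level i s)) p
... | inj₁ q with ∈-map⁻ inner q
... | _ , _ , ()
root∉upTo (suc i) s p | inj₂ q = root∉upTo i s q

-- The path with choices s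

data OnPath : ∀ {j} → Vec Bool j → Inner j → Set where
  mid : ∀ {j q} {s : Vec Bool j} → OnPath (q ∷ s) (mid q)
  sub : ∀ {j q h} {s : Vec Bool j} {v} → OnPath s v → OnPath (q ∷ s) (sub q h v)

path-through : ∀ {j} (v : Inner j) → ∃ λ s → OnPath s v
path-through {suc j} (mid q) = q ∷ replicate j false , mid
path-through (sub q h v) = let s , on = path-through v in q ∷ s , sub on

level-onPath : ∀ {j} i (s : Vec Bool j) v → v ∈ˡ level i s → OnPath s v
level-onPath zero    (q ∷ s) v (hereˡ refl) = mid
level-onPath (suc i) (q ∷ s) v v∈ with ∈-++⁻ (List.map (sub q false) (level i s)) v∈
... | inj₁ p with ∈-map⁻ (sub q false) p
... | w , w∈ , refl = sub (level-onPath i s w w∈)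
level-onPath (suc i) (q ∷ s) v v∈ | inj₂ p with ∈-map⁻ (sub q true) p
... | w , w∈ , refl = sub (level-onPath i s w w∈)

-- An arbitrary transitive `R` lets the induction pass to its pullback along `glue q h`, a relation
-- on the smaller diamond that still speaks of the large one.
path-connects : ∀ {j} (R : Node j → Node j → Set) → (∀ {u v w} → R u v → R v w → R u w) →
  (s : Vec Bool j) → (∀ x → R (endpoint false s x) (endpoint true s x)) →
  R (pole false) (pole true) × (∀ {v} → OnPath s v → R (pole false) (inner v))
path-connects R R-trans []      step = step [] , λ ()
path-connects R R-trans (q ∷ s) step = R-trans first (proj₁ (half true)) , λ where
    mid                   → first
    (sub {h = false} v∈s) → proj₂ (half false) v∈s
    (sub {h = true}  v∈s) → R-trans first (proj₂ (half true) v∈s)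
  where
  half = λ h → path-connects (λ u v → R (glue q h u) (glue q h v)) R-trans s (λ x → step (h ∷ x))
  first = proj₁ (half false)

upTo-connected : ∀ {j} (R : Node j → Node j → Set) → (∀ {u v w} → R u v → R v w → R u w) →
  (s : Vec Bool j) → (∀ x → R (endpoint false s x) (endpoint true s x)) →
  ∀ i {v} → v ∈ˡ upTo i s → R (pole false) v
upTo-connected R R-trans s step zero    (hereˡ refl) = proj₁ (path-connects R R-trans s step)
upTo-connected R R-trans s step (suc i) v∈ with ∈-++⁻ (List.map inner (level i s)) v∈
... | inj₂ p = upTo-connected R R-trans s step i p
... | inj₁ p with ∈-map⁻ inner p
... | w , w∈ , refl = proj₂ (path-connects R R-trans s step) (level-onPath i s w w∈)

-- Numbering nodes and edges

infixr 5 _⨟_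

_⨟_ : ∀ {A B C : Set} → A ↔ B → B ↔ C → A ↔ C
f ⨟ g = g ↔-∘ f

Vec↔ : ∀ j → Fin (2 ^ j) ↔ Vec Bool j
Vec↔ zero    = mk↔ₛ′ (λ _ → []) (λ _ → zero) (λ { [] → refl }) (λ { zero → refl })
Vec↔ (suc j) = (Fin.*↔× ⨟ (Fin.2↔Bool ×-↔ Vec↔ j)) ⨟
  mk↔ₛ′ (λ { (b , v) → b ∷ v }) (λ { (b ∷ v) → b , v }) (λ { (b ∷ v) → refl }) (λ { (b , v) → refl })

-- In closed form `2 * (4 ^ j - 1) / 3`. The nested products match the two uses of `Fin.*↔×` in
-- `Inner↔`.
innerCount : ℕ → ℕ
innerCount zero    = 0
innerCount (suc j) = 2 + 2 * (2 * innerCount j)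

Inner↔ : ∀ j → Fin (innerCount j) ↔ Inner j
Inner↔ zero    = mk↔ₛ′ (λ ()) (λ ()) (λ ()) (λ ())
Inner↔ (suc j) = (Fin.+↔⊎ ⨟ (Fin.2↔Bool ⊎-↔
    (Fin.*↔× ⨟ (Fin.2↔Bool ×-↔ (Fin.*↔× ⨟ (Fin.2↔Bool ×-↔ Inner↔ j)))))) ⨟
  mk↔ₛ′ (λ { (inj₁ q) → mid q ; (inj₂ (q , h , v)) → sub q h v })
        (λ { (mid q) → inj₁ q ; (sub q h v) → inj₂ (q , h , v) })
        (λ { (mid q) → refl ; (sub q h v) → refl })
        (λ { (inj₁ q) → refl ; (inj₂ _) → refl })

Node↔ : ∀ j → Fin (2 + innerCount j) ↔ Node j
Node↔ j = (Fin.+↔⊎ ⨟ (Fin.2↔Bool ⊎-↔ Inner↔ j)) ⨟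
  mk↔ₛ′ (λ { (inj₁ c) → pole c ; (inj₂ v) → inner v })
        (λ { (pole c) → inj₁ c ; (inner v) → inj₂ v })
        (λ { (pole c) → refl ; (inner v) → refl })
        (λ { (inj₁ c) → refl ; (inj₂ v) → refl })

sum-+ : ∀ m {n} (f : Fin (m + n) → ℕ) → sum f ≡ sum (λ i → f (i ↑ˡ n)) + sum (λ i → f (m ↑ʳ i))
sum-+ zero    f = refl
sum-+ (suc m) f = trans (cong (f zero +_) (sum-+ m (f ∘ suc))) (sym (ℕ.+-assoc (f zero) _ _))

sum-* : ∀ m {n} (f : Fin (m * n) → ℕ) → sum f ≡ sum {m} (λ i → sum {n} (λ k → f (combine i k)))
sum-* zero        f = refl
sum-* (suc m) {n} f = trans (sum-+ n f) (cong (sum (λ i → f (i ↑ˡ (m * n))) +_) (sum-* m (λ i → f (n ↑ʳ i))))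

sum-Vec↔ : ∀ j (f : Vec Bool j → ℕ) → sum (λ i → f (Inverse.to (Vec↔ j) i)) ≡ Σᵥ f
sum-Vec↔ zero    f = ℕ.+-identityʳ (f [])
sum-Vec↔ (suc j) f = begin
  sum (λ i → f (to i))
    ≡⟨ sum-* 2 {2 ^ j} (λ i → f (to i)) ⟩
  sum {2 ^ j} (λ k → f (to (combine {2} zero k))) + (sum {2 ^ j} (λ k → f (to (combine {2} (suc zero) k))) + 0)
    ≡⟨ cong₂ _+_ (half zero) (trans (ℕ.+-identityʳ _) (half (suc zero))) ⟩
  Σᵥ f ∎
  where
  open ≡-Reasoning
  to : Fin (2 ^ suc j) → Vec Bool (suc j)
  to = Inverse.to (Vec↔ (suc j))
  half : ∀ (b : Fin 2) → sum {2 ^ j} (λ k → f (to (combine b k))) ≡ Σᵥ (λ v → f (Inverse.to Fin.2↔Bool b ∷ v))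
  half b = trans
    (sum-cong-≗ (λ k → cong (λ (i , k) → f (Inverse.to Fin.2↔Bool i ∷ Inverse.to (Vec↔ j) k)) (Fin.remQuot-combine b k)))
    (sum-Vec↔ j (λ v → f (Inverse.to Fin.2↔Bool b ∷ v)))

∑-fromℕ : ∀ {n} (f : Fin n → ℝ) (g : Fin n → ℕ) → (∀ i → f i ≐ fromℚ (fromℕ (g i))) →
  ∑ f ≐ fromℚ (fromℕ (sum g))
∑-fromℕ {zero}  f g f≐g k = refl
∑-fromℕ {suc n} f g f≐g k = trans (cong₂ ℚ._+_ (f≐g zero k) (∑-fromℕ (f ∘ suc) (g ∘ suc) (f≐g ∘ suc) k))
  (sym (fromℕ-homo-+ (g zero) (sum (g ∘ suc))))

Pairs↔ : ∀ j → Fin (2 ^ j * 2 ^ j) ↔ (Vec Bool j × Vec Bool j)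
Pairs↔ j = Fin.*↔× ⨟ (Vec↔ j ×-↔ Vec↔ j)

sum-Pairs↔ : ∀ j (f : Vec Bool j × Vec Bool j → ℕ) →
  sum (λ i → f (Inverse.to (Pairs↔ j) i)) ≡ Σᵥ (λ t → Σᵥ (λ x → f (t , x)))
sum-Pairs↔ j f =
  trans (sum-* (2 ^ j) {2 ^ j} (λ i → f (Inverse.to (Pairs↔ j) i)))
  (trans (sum-cong-≗ {2 ^ j} (λ i → trans
    (sum-cong-≗ {2 ^ j} (λ k → cong (λ (i , k) → f (Inverse.to (Vec↔ j) i , Inverse.to (Vec↔ j) k)) (Fin.remQuot-combine i k)))
    (sum-Vec↔ j (λ x → f (Inverse.to (Vec↔ j) i , x)))))
  (sum-Vec↔ j (λ t → Σᵥ (λ x → f (t , x)))))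

sum-zero : ∀ {n} (f : Fin n → ℕ) → (∀ i → f i ≡ 0) → sum f ≡ 0
sum-zero {zero}  f f≡0 = refl
sum-zero {suc n} f f≡0 = cong₂ _+_ (f≡0 zero) (sum-zero (f ∘ suc) (f≡0 ∘ suc))

sum-⊎↔ : ∀ {m n} {A B : Set} (A↔ : Fin m ↔ A) (B↔ : Fin n ↔ B) (f : A ⊎ B → ℕ) → (∀ a → f (inj₁ a) ≡ 0) →
  sum (λ i → f (Inverse.to (Fin.+↔⊎ ⨟ (A↔ ⊎-↔ B↔)) i)) ≡ sum (λ i → f (inj₂ (Inverse.to B↔ i)))
sum-⊎↔ {m} {n} A↔ B↔ f f≡0 = trans (sum-+ m {n} (λ i → f (Inverse.to (Fin.+↔⊎ ⨟ (A↔ ⊎-↔ B↔)) i))) (cong₂ _+_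
  (sum-zero {m} _ (λ i → trans (cong (λ z → f (Sum.map (Inverse.to A↔) (Inverse.to B↔) z)) (Fin.splitAt-↑ˡ m i n)) (f≡0 _)))
  (sum-cong-≗ {n} (λ i → cong (λ z → f (Sum.map (Inverse.to A↔) (Inverse.to B↔) z)) (Fin.splitAt-↑ʳ m n i))))

if-fromℕ : ∀ b n → (if b then fromℚ (fromℕ n) else 0ᴿ) ≐ fromℚ (fromℕ (if b then n else 0))
if-fromℕ true  n k = refl
if-fromℕ false n k = refl

-- The network

-- Padding vertices, joined to the root by free edges, serve to adjust the sizes.
record Numbering (j : ℕ) : Set₁ where
  field
    Pad        : Set
    order size : ℕ
    V↔         : Fin order ↔ (Pad ⊎ Node j)
    E↔         : Fin size ↔ (Pad ⊎ (Vec Bool j × Vec Bool j))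
    sum-edges  : ∀ (f : Pad ⊎ (Vec Bool j × Vec Bool j) → ℕ) → (∀ p → f (inj₁ p) ≡ 0) →
      sum (λ e → f (Inverse.to E↔ e)) ≡ Σᵥ (λ t → Σᵥ (λ x → f (inj₂ (t , x))))

module Diamond {j : ℕ} (numbering : Numbering j) where
  open Numbering numbering

  V E : Set
  V = Pad ⊎ Node j
  E = Pad ⊎ (Vec Bool j × Vec Bool j)

  open Inverse V↔ using () renaming (to to decode; from to encode; strictlyInverseˡ to decode-encode; strictlyInverseʳ to encode-decode) public
  open Inverse E↔ using () renaming (to to decodeᴱ; from to encodeᴱ; strictlyInverseˡ to decode-encodeᴱ; strictlyInverseʳ to encode-decodeᴱ) public

  encode-injective : ∀ {u v} → encode u ≡ encode v → u ≡ v
  encode-injective {u} {v} eq = trans (sym (decode-encode u)) (trans (cong decode eq) (decode-encode v))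

  root : V
  root = inj₂ (pole false)

  end : Bool → E → V
  end false (inj₁ p)       = inj₁ p
  end true  (inj₁ p)       = root
  end c     (inj₂ (t , x)) = inj₂ (endpoint c t x)

  weight : E → ℕ
  weight (inj₁ _) = 0
  weight (inj₂ _) = 1

  end-≢ : ∀ e → end false e ≢ end true e
  end-≢ (inj₁ p)       ()
  end-≢ (inj₂ (t , x)) eq = case
    trans (sym (right-endpoint false t x)) (trans (cong (right x) (inj₂-injective eq)) (right-endpoint true t x)) of λ ()

  -- The ends of an edge determine it: the cuts of the column x and of the path t at x
  -- are crossed by the edge (t , x) only.
  end-injective : ∀ d e f → (∀ c → end c e ≡ end (d xor c) f) → e ≡ f
  end-injective false (inj₁ p) (inj₁ p′) h = cong inj₁ (inj₁-injective (h false))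
  end-injective true  (inj₁ p) (inj₁ p′) h = case h false of λ ()
  end-injective false (inj₁ p) (inj₂ _)  h = case h false of λ ()
  end-injective true  (inj₁ p) (inj₂ _)  h = case h false of λ ()
  end-injective false (inj₂ _) (inj₁ p)  h = case h false of λ ()
  end-injective true  (inj₂ _) (inj₁ p)  h = case h true of λ ()
  end-injective d (inj₂ (t , x)) (inj₂ (t′ , x′)) h = cong inj₂ (cong₂ _,_
    (lcp-full t t′ (proj₁ (separator-crosses j t x t′ x′ (transfer (separator j t x) (separator-endpoint t x)))))
    (sym (right-crosses x t′ x′ (transfer (right x) λ eq → case
      trans (sym (right-endpoint false t x)) (trans eq (right-endpoint true t x)) of λ ()))))
    where
    h′ : ∀ c → endpoint c t x ≡ endpoint (d xor c) t′ x′
    h′ c = inj₂-injective (trans (end-inj₂ c t x) (trans (h c) (sym (end-inj₂ (d xor c) t′ x′))))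
      where
      end-inj₂ : ∀ c t x → inj₂ (endpoint c t x) ≡ end c (inj₂ (t , x))
      end-inj₂ false t x = refl
      end-inj₂ true  t x = refl
    transfer : ∀ P → Crosses P t x → Crosses P t′ x′
    transfer P cr eq = cr (trans (cong P (h′ false)) (trans (lemma d) (sym (cong P (h′ true)))))
      where
      lemma : ∀ d → P (endpoint (d xor false) t′ x′) ≡ P (endpoint (d xor true) t′ x′)
      lemma false = eq
      lemma true  = sym eq

  ends : Fin size → Fin order × Fin order
  ends e = encode (end false (decodeᴱ e)) , encode (end true (decodeᴱ e))

  JoinsE : Fin size → (u v : Fin order) → Set
  JoinsE e u v = ends e ≡ (u , v) ⊎ ends e ≡ (v , u)

  Conn : Subset size → (u v : Fin order) → Set
  Conn S = Star (λ u v → ∃ λ e → e ∈ S × JoinsE e u v)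

  Conn-sym : ∀ {S u v} → Conn S u v → Conn S v u
  Conn-sym = Star.reverse λ (e , e∈S , joins) → e , e∈S , (case joins of λ where
    (inj₁ p) → inj₂ p
    (inj₂ p) → inj₁ p)

  ends-encode : ∀ e → ends (encodeᴱ e) ≡ (encode (end false e) , encode (end true e))
  ends-encode e = cong (λ e → encode (end false e) , encode (end true e)) (decode-encodeᴱ e)

  conn-edge : ∀ {S} e → encodeᴱ e ∈ S → Conn S (encode (end false e)) (encode (end true e))
  conn-edge e e∈S = (encodeᴱ e , e∈S , inj₁ (ends-encode e)) ◅ Star.ε

  Contains : Subset size → Vec Bool j → Set
  Contains S s = ∀ x → encodeᴱ (inj₂ (s , x)) ∈ S

  ToRoot : Subset size → V → Set
  ToRoot S v = Conn S (encode v) (encode root)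

  -- The arguments are reversed: `path-connects` starts at the root, whereas `Spans` asks for walks
  -- ending there.
  Reaches : Subset size → Node j → Node j → Set
  Reaches S u v = Conn S (encode (inj₂ v)) (encode (inj₂ u))

  reaches-step : ∀ {S} s → Contains S s → ∀ x → Reaches S (endpoint false s x) (endpoint true s x)
  reaches-step s path x = Conn-sym (conn-edge (inj₂ (s , x)) (path x))

  requests-toRoot : ∀ {S s} → Contains S s → ∀ i {v} → v ∈ˡ upTo i s → ToRoot S (inj₂ v)
  requests-toRoot {S} {s} path = upTo-connected (Reaches S) (λ p q → q ◅◅ p) s (reaches-step s path)

  pad-toRoot : ∀ {S} p → encodeᴱ (inj₁ p) ∈ S → ToRoot S (inj₁ p)
  pad-toRoot p = conn-edge (inj₁ p)

  all-toRoot : ∀ v → ToRoot ⊤ v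
  all-toRoot (inj₁ p)              = pad-toRoot p Subset.∈⊤
  all-toRoot (inj₂ (pole false))   = Star.ε
  all-toRoot (inj₂ (pole true))    = proj₁ (path-connects (Reaches ⊤) (λ p q → q ◅◅ p) (replicate j false)
                                       (reaches-step (replicate j false) (λ _ → Subset.∈⊤)))
  all-toRoot (inj₂ (inner v))      = let s , on = path-through v in
    proj₂ (path-connects (Reaches ⊤) (λ p q → q ◅◅ p) s (reaches-step s (λ _ → Subset.∈⊤))) on

  network : Network
  network = record
    { order = order
    ; size  = size
    ; ends  = ends
    ; cost  = λ e → fromℚ (fromℕ (weight (decodeᴱ e)))
    ; root  = encode root
    ; loopless = λ e v → λ where
        (inj₁ eq) → end-≢ (decodeᴱ e) (encode-injective (trans (,-injectiveˡ eq) (sym (,-injectiveʳ eq))))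
        (inj₂ eq) → end-≢ (decodeᴱ e) (encode-injective (trans (,-injectiveˡ eq) (sym (,-injectiveʳ eq))))
    ; simple = simple
    ; cost-nonneg = λ e → ≤̇⇒≤ {0ᴿ} {fromℚ (fromℕ (weight (decodeᴱ e)))}
        (λ _ → ℚ.nonNegative⁻¹ _ {{fromℕ-nonNeg (weight (decodeᴱ e))}})
    ; connected = λ u v → subst₂ (Conn ⊤) (encode-decode u) (encode-decode v)
        (all-toRoot (decode u) ◅◅ Conn-sym (all-toRoot (decode v)))
    }
    where
    same : ∀ d e f → (∀ c → encode (end c (decodeᴱ e)) ≡ encode (end (d xor c) (decodeᴱ f))) → e ≡ f
    same d e f h = trans (sym (encode-decodeᴱ e)) (trans
      (cong encodeᴱ (end-injective d (decodeᴱ e) (decodeᴱ f) (encode-injective ∘ h))) (encode-decodeᴱ f))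
    aligned : ∀ e f → ends e ≡ ends f → e ≡ f
    aligned e f eq = same false e f λ where
      false → ,-injectiveˡ eq
      true  → ,-injectiveʳ eq
    swapped : ∀ e f {u v} → ends e ≡ (u , v) → ends f ≡ (v , u) → e ≡ f
    swapped e f eq eq′ = same true e f λ where
      false → trans (,-injectiveˡ eq) (sym (,-injectiveʳ eq′))
      true  → trans (,-injectiveʳ eq) (sym (,-injectiveˡ eq′))
    simple : ∀ e f u v → JoinsE e u v → JoinsE f u v → e ≡ f
    simple e f u v (inj₁ p) (inj₁ q) = aligned e f (trans p (sym q))
    simple e f u v (inj₁ p) (inj₂ q) = swapped e f p q
    simple e f u v (inj₂ p) (inj₁ q) = swapped e f p q
    simple e f u v (inj₂ p) (inj₂ q) = aligned e f (trans p (sym q))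

  module N = Network network

  hit : Subset N.size → Vec Bool j → Vec Bool j → ℕ
  hit S t x = if lookup S (encodeᴱ (inj₂ (t , x))) then 1 else 0

  edgeCount : Subset N.size → ℕ
  edgeCount S = Σᵥ (λ t → Σᵥ (λ x → hit S t x))

  totalCost≐ : ∀ S → N.totalCost S ≐ fromℚ (fromℕ (edgeCount S))
  totalCost≐ S k = trans (∑-fromℕ _ price (λ e → if-fromℕ (lookup S e) (weight (decodeᴱ e))) k) (cong fromℕ (begin
    sum price
      ≡⟨ sum-cong-≗ (λ e → cong (λ e′ → if lookup S e′ then weight (decodeᴱ e) else 0) (sym (encode-decodeᴱ e))) ⟩
    sum (λ e → price′ (decodeᴱ e))
      ≡⟨ sum-edges price′ (λ p → if-same (lookup S (encodeᴱ (inj₁ p)))) ⟩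
    edgeCount S ∎))
    where
    open ≡-Reasoning
    price : Fin N.size → ℕ
    price e = if lookup S e then weight (decodeᴱ e) else 0
    price′ : E → ℕ
    price′ e = if lookup S (encodeᴱ e) then weight e else 0
    if-same : ∀ b → (if b then 0 else 0) ≡ 0
    if-same false = refl
    if-same true  = refl

  hit-≥1 : ∀ {S t x} → encodeᴱ (inj₂ (t , x)) ∈ S → 1 ≤ hit S t x
  hit-≥1 e∈S = ℕ.≤-reflexive (sym (cong (λ b → if b then 1 else 0) ([]=⇒lookup e∈S)))

  crossing : ∀ {S} (P : Fin N.order → Bool) {u v} → Conn S u v → P u ≡ true → P v ≡ false →
    ∃ λ e → e ∈ S × P (proj₁ (ends e)) ≢ P (proj₂ (ends e))
  crossing P Star.ε Pu Pv = case trans (sym Pu) Pv of λ ()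
  crossing P (_◅_ {j = w} (e , e∈S , joins) path) Pu Pv with P w in eq
  ... | true  = crossing P path eq Pv
  ... | false = e , e∈S , different joins
    where
    different : JoinsE e _ w → P (proj₁ (ends e)) ≢ P (proj₂ (ends e))
    different (inj₁ refl) same = case trans (sym Pu) (trans same eq) of λ ()
    different (inj₂ refl) same = case trans (sym eq) (trans same Pu) of λ ()

  -- Padding vertices are put on the side of the root, so no padding edge crosses the cut.
  separatorᵛ : ℕ → Vec Bool j → Vec Bool j → V → Bool
  separatorᵛ ℓ s x (inj₁ p) = false
  separatorᵛ ℓ s x (inj₂ v) = separator ℓ s x v

  separating-edge : ∀ {S} ℓ s x {v} → ToRoot S (inj₂ v) → separator ℓ s x v ≡ true →
    ∃ λ t → ∃ λ y → ℓ ≤ lcp s t × (y ≡ x ⊎ y ≡ mirror ℓ x) × encodeᴱ (inj₂ (t , y)) ∈ S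
  separating-edge {S} ℓ s x {v} path sep
    with crossing (separatorᵛ ℓ s x ∘ decode) path
           (trans (cong (separatorᵛ ℓ s x) (decode-encode (inj₂ v))) sep)
           (trans (cong (separatorᵛ ℓ s x) (decode-encode root)) (separator-root ℓ s x))
  ... | e , e∈S , P≢ with decodeᴱ e in eq
  ... | inj₁ p = contradiction
    (trans (cong (separatorᵛ ℓ s x) (decode-encode (inj₁ p)))
      (sym (trans (cong (separatorᵛ ℓ s x) (decode-encode root)) (separator-root ℓ s x)))) P≢
  ... | inj₂ (t , y) =
    let ℓ≤ , y≡ = separator-crosses ℓ s x t y (λ same → P≢ (trans
                    (cong (separatorᵛ ℓ s x) (decode-encode (inj₂ (endpoint false t y))))
                    (trans same (sym (cong (separatorᵛ ℓ s x) (decode-encode (inj₂ (endpoint true t y))))))))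
    in t , y , ℓ≤ , y≡ , subst (_∈ S) (trans (sym (encode-decodeᴱ e)) (cong encodeᴱ eq)) e∈S

  edgeCount-≥ : ∀ {S} → ToRoot S (inj₂ (pole true)) → 2 ^ j ≤ edgeCount S
  edgeCount-≥ {S} path = begin
    2 ^ j                                ≡⟨ ℕ.*-identityʳ (2 ^ j) ⟨
    2 ^ j * 1                            ≡⟨ Σᵥ-const j 1 ⟨
    Σᵥ {j} (λ x → 1)                     ≤⟨ Σᵥ-mono-≤ column ⟩
    Σᵥ (λ x → Σᵥ (λ t → hit S t x))      ≡⟨ Σᵥ-comm (λ x t → hit S t x) ⟩
    edgeCount S                          ∎
    where
    open ℕ.≤-Reasoning
    column : ∀ x → 1 ≤ Σᵥ (λ t → hit S t x)
    -- `mirror zero` is the identity, so both cases give an edge of the column `x` itself.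
    column x with separating-edge zero x x path refl
    ... | t , y , _ , inj₁ refl , e∈S = ℕ.≤-trans (hit-≥1 e∈S) (≤Σᵥ (λ t → hit S t x) t)
    ... | t , y , _ , inj₂ refl , e∈S = ℕ.≤-trans (hit-≥1 e∈S) (≤Σᵥ (λ t → hit S t x) t)

  -- The optimal solution: padding edges are free, so all of them are taken, and every requested
  -- padding vertex is served.
  pathEdge : Vec Bool j → E → Bool
  pathEdge s (inj₁ p)       = true
  pathEdge s (inj₂ (t , x)) = t == s

  pathEdges : Vec Bool j → Subset N.size
  pathEdges s = tabulate (pathEdge s ∘ decodeᴱ)

  lookup-pathEdges : ∀ s e → lookup (pathEdges s) (encodeᴱ e) ≡ pathEdge s e
  lookup-pathEdges s e = trans (lookup∘tabulate (pathEdge s ∘ decodeᴱ) (encodeᴱ e)) (cong (pathEdge s) (decode-encodeᴱ e))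

  pathEdges-contains : ∀ s → Contains (pathEdges s) s
  pathEdges-contains s x = lookup⇒[]= _ _ (trans (lookup-pathEdges s (inj₂ (s , x))) (==-refl s))

  pathEdges-pad : ∀ s p → encodeᴱ (inj₁ p) ∈ pathEdges s
  pathEdges-pad s p = lookup⇒[]= _ _ (lookup-pathEdges s (inj₁ p))

  edgeCount-pathEdges : ∀ s → edgeCount (pathEdges s) ≡ 2 ^ j
  edgeCount-pathEdges s = begin
    Σᵥ (λ t → Σᵥ (λ x → hit (pathEdges s) t x))
      ≡⟨ Σᵥ-cong (λ t → trans (Σᵥ-cong {j} (λ x → cong (λ b → if b then 1 else 0) (lookup-pathEdges s (inj₂ (t , x)))))
           (trans (Σᵥ-const j (if t == s then 1 else 0)) (*-if (t == s)))) ⟩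
    Σᵥ (λ t → if t == s then 2 ^ j else 0)
      ≡⟨ Σᵥ-≡ s (2 ^ j) ⟩
    2 ^ j ∎
    where
    open ≡-Reasoning
    *-if : ∀ b → 2 ^ j * (if b then 1 else 0) ≡ (if b then 2 ^ j else 0)
    *-if true  = ℕ.*-identityʳ (2 ^ j)
    *-if false = ℕ.*-zeroʳ (2 ^ j)

-- Subsets listing given elements

listed : ∀ {n} → List (Fin n) → Subset n
listed L = ⋃ (List.map ⁅_⁆ L)

∈-listed⁺ : ∀ {n} {v : Fin n} {L} → v ∈ˡ L → v ∈ listed L
∈-listed⁺ {v = v} (hereˡ refl) = Subset.x∈p∪q⁺ (inj₁ (Subset.x∈⁅x⁆ v))
∈-listed⁺ (thereˡ v∈L)         = Subset.x∈p∪q⁺ (inj₂ (∈-listed⁺ v∈L))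

∈-listed⁻ : ∀ {n} {v : Fin n} L → v ∈ listed L → v ∈ˡ L
∈-listed⁻ []      v∈ = contradiction v∈ Subset.∉⊥
∈-listed⁻ (w ∷ L) v∈ with Subset.x∈p∪q⁻ ⁅ w ⁆ (listed L) v∈
... | inj₁ p = hereˡ (Subset.x∈⁅y⁆⇒x≡y w p)
... | inj₂ p = thereˡ (∈-listed⁻ L p)

∣⁅x⁆∪p∣ : ∀ {n} (x : Fin n) p → ¬ (x ∈ p) → ∣ ⁅ x ⁆ ∪ p ∣ ≡ suc ∣ p ∣
∣⁅x⁆∪p∣ zero    (true ∷ p)  x∉p = contradiction here x∉p
∣⁅x⁆∪p∣ zero    (false ∷ p) x∉p = cong (λ q → suc ∣ q ∣) (Subset.∪-identityˡ p)
∣⁅x⁆∪p∣ (suc x) (true ∷ p)  x∉p = cong suc (∣⁅x⁆∪p∣ x p (x∉p ∘ there))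
∣⁅x⁆∪p∣ (suc x) (false ∷ p) x∉p = ∣⁅x⁆∪p∣ x p (x∉p ∘ there)

∣listed∣ : ∀ {n} {L : List (Fin n)} → Unique L → ∣ listed L ∣ ≡ length L
∣listed∣ {n}         []ᵘ       = Subset.∣⊥∣≡0 n
∣listed∣ {L = v ∷ L} (v# ∷ᵘ u) = trans
  (∣⁅x⁆∪p∣ v (listed L) (λ v∈ → All.lookup v# (∈-listed⁻ L v∈) refl)) (cong suc (∣listed∣ u))

∣p∣≡∣p∩q∣+∣p─q∣ : ∀ {n} (p q : Subset n) → ∣ p ∣ ≡ ∣ p ∩ q ∣ + ∣ p ─ q ∣
∣p∣≡∣p∩q∣+∣p─q∣ []          []          = refl
∣p∣≡∣p∩q∣+∣p─q∣ (true ∷ p)  (true ∷ q)  = cong suc (∣p∣≡∣p∩q∣+∣p─q∣ p q)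
∣p∣≡∣p∩q∣+∣p─q∣ (true ∷ p)  (false ∷ q) = trans (cong suc (∣p∣≡∣p∩q∣+∣p─q∣ p q)) (sym (ℕ.+-suc _ _))
∣p∣≡∣p∩q∣+∣p─q∣ (false ∷ p) (true ∷ q)  = ∣p∣≡∣p∩q∣+∣p─q∣ p q
∣p∣≡∣p∩q∣+∣p─q∣ (false ∷ p) (false ∷ q) = ∣p∣≡∣p∩q∣+∣p─q∣ p q

-- Purchases of online algorithms

module _ (alg : OnlineAlgorithm) (G : Network) (R̂ : Subset (Network.order G)) where
  open OnlineAlgorithm alg
  open Network G using (Connected; root)

  bought-mono : ∀ xs {past} {e} → e ∈ bought G R̂ past → e ∈ bought G R̂ (xs ++ past)
  bought-mono []       e∈ = e∈
  bought-mono (x ∷ xs) e∈ = Subset.x∈p∪q⁺ (inj₁ (bought-mono xs e∈))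

  bought-connects : ∀ {v} past → Unique past → v ∈ˡ past → Connected (bought G R̂ past) v root
  bought-connects (v ∷ past) u          (hereˡ refl) = feasible G R̂ v past u
  bought-connects (w ∷ past) (_ ∷ᵘ u) (thereˡ v∈)  =
    Star.map (λ (e , e∈ , joins) → e , bought-mono (w ∷ []) e∈ , joins) (bought-connects past u v∈)

-- The hard instances and the bound for a deterministic algorithm

pole∈upTo : ∀ {j} i (s : Vec Bool j) → pole true ∈ˡ upTo i s
pole∈upTo zero    s = hereˡ refl
pole∈upTo (suc i) s = ∈-++⁺ʳ (List.map inner (level i s)) (pole∈upTo i s)

upTo-suffix : ∀ {j} i d (s : Vec Bool j) → ∃ λ L → upTo (d + i) s ≡ L ++ upTo i s
upTo-suffix i zero    s = [] , refl
upTo-suffix i (suc d) s = let L , eq = upTo-suffix i d s in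
  List.map inner (level (d + i) s) ++ L ,
  trans (cong (List.map inner (level (d + i) s) ++_) eq) (sym (List.++-assoc _ L (upTo i s)))

module Requests {j : ℕ} (numbering : Numbering j)
  (requestedPads : List (Numbering.Pad numbering)) (requestedPads-unique : Unique requestedPads)
  (predicted : List (Diamond.V numbering))
  where

  open Numbering numbering
  open Diamond numbering

  -- Padding vertices stand at the end and so are requested before everything else; each
  -- `history i s` is then a past of the full sequence.
  history : ℕ → Vec Bool j → List V
  history i s = List.map inj₂ (upTo i s) ++ List.map inj₁ requestedPads

  history-unique : ∀ i s → Unique (history i s)
  history-unique i s = Unique.++⁺ (Unique.map⁺ inj₂-injective (upTo-unique i s))
    (Unique.map⁺ inj₁-injective requestedPads-unique)
    λ (p , q) → let _ , _ , eq = ∈-map⁻ inj₂ p ; _ , _ , eq′ = ∈-map⁻ inj₁ q in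
      case trans (sym eq) eq′ of λ ()

  requests : ℕ → Vec Bool j → List (Fin order)
  requests i s = List.map encode (history i s)

  requests-unique : ∀ i s → Unique (requests i s)
  requests-unique i s = Unique.map⁺ encode-injective (history-unique i s)

  requests-suffix : ∀ i s → i ≤ j → ∃ λ L → requests j s ≡ L ++ requests i s
  requests-suffix i s i≤j with upTo-suffix i (j ∸ i) s
  ... | L , eq = List.map encode (List.map inj₂ L) , (begin
    requests j s
      ≡⟨ cong (λ k → requests k s) (ℕ.m∸n+n≡m i≤j) ⟨
    requests (j ∸ i + i) s
      ≡⟨ cong (λ M → List.map encode (List.map inj₂ M ++ List.map inj₁ requestedPads)) eq ⟩
    List.map encode (List.map inj₂ (L ++ upTo i s) ++ List.map inj₁ requestedPads)
      ≡⟨ cong (λ M → List.map encode (M ++ List.map inj₁ requestedPads)) (List.map-++ inj₂ L (upTo i s)) ⟩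
    List.map encode ((List.map inj₂ L ++ List.map inj₂ (upTo i s)) ++ List.map inj₁ requestedPads)
      ≡⟨ cong (List.map encode) (List.++-assoc (List.map inj₂ L) _ _) ⟩
    List.map encode (List.map inj₂ L ++ history i s)
      ≡⟨ List.map-++ encode (List.map inj₂ L) (history i s) ⟩
    List.map encode (List.map inj₂ L) ++ requests i s ∎)
    where open ≡-Reasoning

  predictedSet : Subset order
  predictedSet = listed (List.map encode predicted)

  pathEdges-spans : ∀ s → N.Spans (pathEdges s) (listed (requests j s))
  pathEdges-spans s v v∈ with ∈-map⁻ encode (∈-listed⁻ (requests j s) v∈)
  ... | w , w∈ , refl with ∈-++⁻ (List.map inj₂ (upTo j s)) w∈
  ... | inj₁ p with ∈-map⁻ inj₂ p
  ... | u , u∈ , refl = requests-toRoot (pathEdges-contains s) j u∈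
  pathEdges-spans s v v∈ | w , w∈ , refl | inj₂ p with ∈-map⁻ inj₁ p
  ... | q , _ , refl = pad-toRoot q (pathEdges-pad s q)

  instanceFor : Vec Bool j → Instance
  instanceFor s = record
    { network     = network
    ; prediction  = predictedSet
    ; requests    = requests j s
    ; distinct    = requests-unique j s
    ; OPT         = fromℚ (fromℕ (2 ^ j))
    ; OPT-optimal =
        (pathEdges s , pathEdges-spans s , ≐⇒≈ {N.totalCost (pathEdges s)} {fromℚ (fromℕ (2 ^ j))}
          (λ k → trans (totalCost≐ (pathEdges s) k) (cong fromℕ (edgeCount-pathEdges s))))
      , λ S spans → ≤̇⇒≤ {fromℚ (fromℕ (2 ^ j))} {N.totalCost S} (λ k → ℚ.≤-trans
          (fromℕ-mono-≤ (edgeCount-≥ (spans _ (∈-listed⁺ (∈-map⁺ encode (∈-++⁺ˡ (∈-map⁺ inj₂ (pole∈upTo j s))))))))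
          (ℚ.≤-reflexive (sym (totalCost≐ S k))))
    }

  -- Network, prediction and the requests up to level `i` agree for `s` and `flip i s`, so the
  -- algorithm has bought the same separating edge in both runs. Purchases are irrevocable, so the
  -- edge is in both final sets, as `levels-bound` demands.
  algorithm-bound : ∀ alg → suc j * (2 ^ j * 2 ^ j) ≤
    4 * Σᵥ (λ s → edgeCount (OnlineAlgorithm.bought alg network predictedSet (requests j s)))
  algorithm-bound alg = levels-bound j (λ s → hit (final s)) λ i i≤j s x →
    let v , v∈ , sep = separator-target i s x i≤j
        t , y , i≤lcp , y≡ , e∈ = separating-edge i s x {v}
          (bought-connects alg network predictedSet (requests i s) (requests-unique i s)
            (∈-map⁺ encode (∈-++⁺ˡ (∈-map⁺ inj₂ v∈)))) sep
    in t , y , i≤lcp , y≡ , hit-≥1 (kept i s i≤j e∈) ,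
       hit-≥1 (kept i (flip i s) i≤j (subst (λ L → encodeᴱ (inj₂ (t , y)) ∈ bought L) (sym (same i s)) e∈))
    where
    bought : List (Fin order) → Subset size
    bought = OnlineAlgorithm.bought alg network predictedSet
    final : Vec Bool j → Subset size
    final s = bought (requests j s)
    kept : ∀ i s → i ≤ j → ∀ {e} → e ∈ bought (requests i s) → e ∈ final s
    kept i s i≤j {e} e∈ with requests-suffix i s i≤j
    ... | L , eq = subst (λ M → e ∈ bought M) (sym eq) (bought-mono alg network predictedSet L e∈)
    same : ∀ i s → requests i (flip i s) ≡ requests i s
    same i s = cong (λ L → List.map encode (List.map inj₂ L ++ List.map inj₁ requestedPads)) (upTo-flip i i s ℕ.≤-refl)

-- The adversary and its competitive ratio

∑-const : ∀ n q → ∑ {n} (λ _ → fromℚ q) ≐ fromℚ (fromℕ n ℚ.* q)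
∑-const zero    q k = sym (ℚ.*-zeroˡ q)
∑-const (suc n) q k = begin
  q ℚ.+ seq (∑ {n} (λ _ → fromℚ q)) k    ≡⟨ cong₂ ℚ._+_ (sym (ℚ.*-identityˡ q)) (∑-const n q k) ⟩
  1ℚ ℚ.* q ℚ.+ fromℕ n ℚ.* q             ≡⟨ ℚ.*-distribʳ-+ q 1ℚ (fromℕ n) ⟨
  (1ℚ ℚ.+ fromℕ n) ℚ.* q                 ≡⟨ cong (ℚ._* q) (fromℕ-homo-+ 1 n) ⟨
  fromℕ (suc n) ℚ.* q                    ∎
  where open ≡-Reasoning

∑-scale : ∀ {n} q (f g : Fin n → ℝ) k → (∀ i → seq (f i) k ≡ q ℚ.* seq (g i) k) →
  seq (∑ f) k ≡ q ℚ.* seq (∑ g) k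
∑-scale {zero}  q f g k h = sym (ℚ.*-zeroʳ q)
∑-scale {suc n} q f g k h = trans (cong₂ ℚ._+_ (h zero) (∑-scale q (f ∘ suc) (g ∘ suc) k (h ∘ suc)))
  (sym (ℚ.*-distribˡ-+ q (seq (g zero) k) (seq (∑ (g ∘ suc)) k)))

∑⊆-scale : ∀ {n} q (f g : Subset n → ℝ) k → (∀ S → seq (f S) k ≡ q ℚ.* seq (g S) k) →
  seq (∑⊆ f) k ≡ q ℚ.* seq (∑⊆ g) k
∑⊆-scale {zero}  q f g k h = h []
∑⊆-scale {suc n} q f g k h = trans
  (cong₂ ℚ._+_ (∑⊆-scale q (f ∘ (true ∷_)) (g ∘ (true ∷_)) k (h ∘ (true ∷_)))
               (∑⊆-scale q (f ∘ (false ∷_)) (g ∘ (false ∷_)) k (h ∘ (false ∷_))))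
  (sym (ℚ.*-distribˡ-+ q (seq (∑⊆ (g ∘ (true ∷_))) k) (seq (∑⊆ (g ∘ (false ∷_))) k)))

≤ᴿ-transport : ∀ {x y u v} → (∀ k → seq x k ℚ.≤ seq u k) → u ≤ᴿ v → (∀ k → seq v k ≡ seq y k) → x ≤ᴿ y
≤ᴿ-transport {x} {y} {u} {v} x≤u u≤v v≡y ε ε>0 with u≤v ε ε>0
... | N , p = N , λ k N≤k → ℚ.≤-trans (x≤u k) (ℚ.≤-trans (p k N≤k) (ℚ.≤-reflexive (cong (ℚ._+ ε) (v≡y k))))

expectation-scale : ∀ {n k Δ₁ Δ₂} (adv : Adversary n k Δ₁ Δ₂) (let open Adversary adv) (f : Instance → ℝ) q
  (g : Fin outcomes → ℝ) k → (∀ i → seq (weight i) k ℚ.* seq (f (outcome i)) k ≡ q ℚ.* seq (g i) k) →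
  seq (expectation f) k ≡ q ℚ.* seq (∑ g) k
expectation-scale adv f q g k h = ∑-scale q (λ i → weight i *ᴿ f (outcome i)) g k h
  where open Adversary adv

¼ : ℚ
¼ = ½ ℚ.* ½

-- The quarter of `levels-bound` times 1/3 from `L ≤ 3 * suc j`.
constant : ℚ
constant = (ℤ.+ 1) ℚ./ 12

fromℕ-pos : ∀ n → 1 ≤ n → ℚ.Positive (fromℕ n)
fromℕ-pos (suc n) _ = ℚ.normalize-pos (suc n) 1

scaled-bound : ∀ j D w l L → ℚ.NonNegative D → D ℚ.* w ≡ 1ℚ → l ℚ.≤ fromℕ L → L ≤ 3 * suc j →
  (constant ℚ.* l) ℚ.* D ℚ.≤ (w ℚ.* ¼) ℚ.* (fromℕ (suc j) ℚ.* (D ℚ.* D))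
scaled-bound j D w l L D≥0 Dw≡1 l≤L L≤3j = begin
  (constant ℚ.* l) ℚ.* D
    ≤⟨ ℚ.*-monoʳ-≤-nonNeg D {{D≥0}} (ℚ.*-monoˡ-≤-nonNeg constant (ℚ.≤-trans l≤L (fromℕ-mono-≤ L≤3j))) ⟩
  (constant ℚ.* fromℕ (3 * suc j)) ℚ.* D
    ≡⟨ cong (λ z → (constant ℚ.* z) ℚ.* D) (fromℕ-homo-* 3 (suc j)) ⟩
  (constant ℚ.* (fromℕ 3 ℚ.* m)) ℚ.* D
    ≡⟨ cong (ℚ._* D) (ℚ.*-assoc constant (fromℕ 3) m) ⟨
  ((constant ℚ.* fromℕ 3) ℚ.* m) ℚ.* D
    -- `constant * fromℕ 3` computes to `¼`.
    ≡⟨⟩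
  (¼ ℚ.* m) ℚ.* D
    ≡⟨ ℚ.*-identityˡ _ ⟨
  1ℚ ℚ.* ((¼ ℚ.* m) ℚ.* D)
    ≡⟨ cong (ℚ._* ((¼ ℚ.* m) ℚ.* D)) Dw≡1 ⟨
  (D ℚ.* w) ℚ.* ((¼ ℚ.* m) ℚ.* D)
    ≡⟨ solve 4 (λ d w q m → (d :* w) :* ((q :* m) :* d) := (w :* q) :* (m :* (d :* d))) refl D w ¼ m ⟩
  (w ℚ.* ¼) ℚ.* (m ℚ.* (D ℚ.* D)) ∎
  where
  open ℚ.≤-Reasoning
  open ℚ-Solver
  m : ℚ
  m = fromℕ (suc j)

module Game {j : ℕ} (numbering : Numbering j)
  (requestedPads : List (Numbering.Pad numbering)) (requestedPads-unique : Unique requestedPads)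
  (predicted : List (Diamond.V numbering)) {n k Δ₁ Δ₂ : ℕ}
  (sizes : ∀ s → HasSizes n k Δ₁ Δ₂ (Requests.instanceFor numbering requestedPads requestedPads-unique predicted s))
  where

  open Numbering numbering
  open Diamond numbering
  open Requests numbering requestedPads requestedPads-unique predicted

  coins : Fin (2 ^ j) → Vec Bool j
  coins = Inverse.to (Vec↔ j)

  2^j-pos : ℚ.Positive (fromℕ (2 ^ j))
  2^j-pos = fromℕ-pos (2 ^ j) (ℕ.m^n>0 2 j)

  probability : ∃ λ w → ℚ.Positive w × fromℕ (2 ^ j) ℚ.* w ≡ 1ℚ
  probability = divideBy (fromℕ (2 ^ j)) 1ℚ 2^j-pos _

  w : ℚ
  w = proj₁ probability

  w>0 : ℚ.Positive w
  w>0 = proj₁ (proj₂ probability)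

  adversary : Adversary n k Δ₁ Δ₂
  adversary = record
    { outcomes      = 2 ^ j
    ; weight        = λ _ → fromℚ w
    ; weight-nonneg = λ _ → ≤̇⇒≤ {0ᴿ} {fromℚ w} (λ _ → ℚ.<⇒≤ (ℚ.positive⁻¹ w {{w>0}}))
    ; weight-total  = ≐⇒≈ {∑ {2 ^ j} (λ _ → fromℚ w)} {1ᴿ}
        (λ k → trans (∑-const (2 ^ j) w k) (proj₂ (proj₂ probability)))
    ; outcome       = instanceFor ∘ coins
    ; sizes         = sizes ∘ coins
    }

  open Adversary adversary using (expectation)

  expectation-OPT : ∀ i → seq (expectation Instance.OPT) i ≡ fromℕ (2 ^ j)
  expectation-OPT i = begin
    seq (expectation Instance.OPT) i
      ≡⟨ expectation-scale adversary Instance.OPT w (λ _ → fromℚ (fromℕ (2 ^ j))) i (λ _ → refl) ⟩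
    w ℚ.* seq (∑ {2 ^ j} (λ _ → fromℚ (fromℕ (2 ^ j)))) i
      ≡⟨ cong (w ℚ.*_) (∑-const (2 ^ j) (fromℕ (2 ^ j)) i) ⟩
    w ℚ.* (fromℕ (2 ^ j) ℚ.* fromℕ (2 ^ j))
      ≡⟨ ℚ.*-assoc w (fromℕ (2 ^ j)) (fromℕ (2 ^ j)) ⟨
    (w ℚ.* fromℕ (2 ^ j)) ℚ.* fromℕ (2 ^ j)
      ≡⟨ cong (ℚ._* fromℕ (2 ^ j)) (trans (ℚ.*-comm w (fromℕ (2 ^ j))) (proj₂ (proj₂ probability))) ⟩
    1ℚ ℚ.* fromℕ (2 ^ j)
      ≡⟨ ℚ.*-identityˡ (fromℕ (2 ^ j)) ⟩
    fromℕ (2 ^ j) ∎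
    where open ≡-Reasoning

  module _ (alg : RandomizedAlgorithm) where
    open RandomizedAlgorithm alg

    K : ℕ
    K = suc j * (2 ^ j * 2 ^ j)

    -- The factor 4 keeps the multiplicities natural numbers; multiplying by `w * ¼` gives the
    -- expected cost, see `expectation-cost`.
    lower : ℝ
    lower = ∑ (λ i → ∑⊆ (λ S → (4 * edgeCount S) ⊠
      ℙ (boughtExactly network predictedSet (requests j (coins i)) S)
        (measurable network predictedSet (requests j (coins i)) (requests-unique j (coins i)) S)))

    lower-≥ : fromℚ (fromℕ K) ≼ lower
    lower-≥ = Linearity.expectation-bound space (2 ^ j)
      (λ i ω → OnlineAlgorithm.bought (run ω) network predictedSet (requests j (coins i)))
      (λ i S → measurable network predictedSet (requests j (coins i)) (requests-unique j (coins i)) S)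
      (λ i S → 4 * edgeCount S) K
      (λ ω → ℕ.≤-trans (algorithm-bound (run ω)) (ℕ.≤-reflexive (sym (trans
        (sum-Vec↔ j (λ s → 4 * edgeCount (OnlineAlgorithm.bought (run ω) network predictedSet (requests j s))))
        (Σᵥ-* 4 (λ s → edgeCount (OnlineAlgorithm.bought (run ω) network predictedSet (requests j s))))))))

    expectation-cost : ∀ i → (w ℚ.* ¼) ℚ.* seq lower i ≡ seq (expectation (expectedCost alg)) i
    expectation-cost i = sym (expectation-scale adversary (expectedCost alg) (w ℚ.* ¼) _ i λ o → trans
      (cong (w ℚ.*_) (∑⊆-scale ¼ _ (λ S → (4 * edgeCount S) ⊠ p o S) i (λ S → term (p o S) S)))
      (sym (ℚ.*-assoc w ¼ _)))
      where
      p : Fin (2 ^ j) → Subset size → ℝ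
      p o S = ℙ (boughtExactly network predictedSet (requests j (coins o)) S)
        (measurable network predictedSet (requests j (coins o)) (requests-unique j (coins o)) S)
      term : ∀ x S → seq x i ℚ.* seq (N.totalCost S) i ≡ ¼ ℚ.* seq ((4 * edgeCount S) ⊠ x) i
      term x S = begin
        seq x i ℚ.* seq (N.totalCost S) i
          ≡⟨ cong (seq x i ℚ.*_) (totalCost≐ S i) ⟩
        seq x i ℚ.* fromℕ (edgeCount S)
          ≡⟨ ℚ.*-identityˡ _ ⟨
        (¼ ℚ.* fromℕ 4) ℚ.* (seq x i ℚ.* fromℕ (edgeCount S))
          ≡⟨ solve 4 (λ q f x c → (q :* f) :* (x :* c) := q :* (x :* (f :* c))) refl ¼ (fromℕ 4) (seq x i) (fromℕ (edgeCount S)) ⟩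
        ¼ ℚ.* (seq x i ℚ.* (fromℕ 4 ℚ.* fromℕ (edgeCount S)))
          ≡⟨ cong (λ z → ¼ ℚ.* (seq x i ℚ.* z)) (fromℕ-homo-* 4 (edgeCount S)) ⟨
        ¼ ℚ.* (seq x i ℚ.* fromℕ (4 * edgeCount S))
          ≡⟨ cong (¼ ℚ.*_) (⊠≐ (4 * edgeCount S) x i) ⟨
        ¼ ℚ.* seq ((4 * edgeCount S) ⊠ x) i ∎
        where
        open ≡-Reasoning
        open ℚ-Solver

    competitive : ∀ M L → (∀ i → seq (log₂ M) i ℚ.≤ fromℕ L) → L ≤ 3 * suc j →
      CompetitiveRatioAtLeast (fromℚ constant *ᴿ log₂ M) adversary alg
    competitive M L log≤L L≤ = (1ℚ , _ , 0 , λ i _ → begin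
        0ℚ ℚ.+ 1ℚ                             ≡⟨ ℚ.+-identityˡ 1ℚ ⟩
        fromℕ 1                               ≤⟨ fromℕ-mono-≤ (ℕ.m^n>0 2 j) ⟩
        fromℕ (2 ^ j)                         ≡⟨ expectation-OPT i ⟨
        seq (expectation Instance.OPT) i      ∎)
      , ≤ᴿ-transport {(fromℚ constant *ᴿ log₂ M) *ᴿ expectation Instance.OPT} {expectation (expectedCost alg)}
                     {(w ℚ.* ¼) · fromℚ (fromℕ K)} {(w ℚ.* ¼) · lower}
          (λ i → begin
            (constant ℚ.* seq (log₂ M) i) ℚ.* seq (expectation Instance.OPT) i
              ≡⟨ cong ((constant ℚ.* seq (log₂ M) i) ℚ.*_) (expectation-OPT i) ⟩
            (constant ℚ.* seq (log₂ M) i) ℚ.* fromℕ (2 ^ j)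
              ≤⟨ scaled-bound j (fromℕ (2 ^ j)) w (seq (log₂ M) i) L (fromℕ-nonNeg (2 ^ j)) (proj₂ (proj₂ probability)) (log≤L i) L≤ ⟩
            (w ℚ.* ¼) ℚ.* (fromℕ (suc j) ℚ.* (fromℕ (2 ^ j) ℚ.* fromℕ (2 ^ j)))
              ≡⟨ cong ((w ℚ.* ¼) ℚ.*_) (trans (fromℕ-homo-* (suc j) (2 ^ j * 2 ^ j)) (cong (fromℕ (suc j) ℚ.*_) (fromℕ-homo-* (2 ^ j) (2 ^ j)))) ⟨
            (w ℚ.* ¼) ℚ.* fromℕ K ∎)
          (·-mono-≤ (w ℚ.* ¼) (ℚ.pos⇒nonNeg (w ℚ.* ¼) {{ℚ.pos*pos⇒pos w {{w>0}} ¼}}) {fromℚ (fromℕ K)} {lower} (_≼_.get lower-≥))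
          expectation-cost
      where open ℚ.≤-Reasoning

log₂-≤ : ∀ m L → m ≤ 2 ^ L → ∀ i → seq (log₂ m) i ℚ.≤ fromℕ L
log₂-≤ zero        L m≤ i = ℚ.nonNegative⁻¹ (fromℕ L) {{fromℕ-nonNeg L}}
log₂-≤ m@(suc _) L m≤ i = ℚ.toℚᵘ-cancel-≤
  (ℚᵘ.≤-respˡ-≃ (ℚᵘ.≃-sym (ℚ.toℚᵘ-fromℚᵘ (ℚᵘ.mkℚᵘ (ℤ.+ a) i)))
  (ℚᵘ.≤-respʳ-≃ (ℚᵘ.≃-sym (toℚᵘ-fromℕ L))
  (ℚᵘ.*≤* (subst₂ ℤ._≤_ (ℤ.pos-* a 1) (ℤ.pos-* L (suc i)) (ℤ.+≤+ (begin
    a * 1                            ≡⟨ ℕ.*-identityʳ a ⟩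
    ⌊log₂ m ^ suc i ⌋                ≤⟨ ⌊log₂⌋-mono-≤ (ℕ.^-monoˡ-≤ (suc i) m≤) ⟩
    ⌊log₂ (2 ^ L) ^ suc i ⌋          ≡⟨ cong ⌊log₂_⌋ (ℕ.^-*-assoc 2 L (suc i)) ⟩
    ⌊log₂ 2 ^ (L * suc i) ⌋          ≡⟨ ⌊log₂[2^n]⌋≡n (L * suc i) ⟩
    L * suc i                        ∎))))))
  where
  open ℕ.≤-Reasoning
  a : ℕ
  a = ⌊log₂ m ^ suc i ⌋

-- Sizes

∣listed∩listed∣ : ∀ {n} {A B C : List (Fin n)} → Unique C →
  (∀ {v} → v ∈ˡ C → v ∈ˡ A × v ∈ˡ B) → (∀ {v} → v ∈ˡ A → v ∈ˡ B → v ∈ˡ C) →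
  ∣ listed A ∩ listed B ∣ ≡ length C
∣listed∩listed∣ {A = A} {B} {C} u C⊆ ⊆C = trans (cong ∣_∣ (Subset.⊆-antisym
  (λ v∈ → let p , q = Subset.x∈p∩q⁻ (listed A) (listed B) v∈ in ∈-listed⁺ (⊆C (∈-listed⁻ A p) (∈-listed⁻ B q)))
  (λ v∈ → let p , q = C⊆ (∈-listed⁻ C v∈) in Subset.x∈p∩q⁺ (∈-listed⁺ p , ∈-listed⁺ q))))
  (∣listed∣ u)

module _ {A B : Set} where

  inj₁∈ : ∀ {a : A} {X : List A} {Y : List B} → inj₁ a ∈ˡ List.map inj₁ X ++ List.map inj₂ Y → a ∈ˡ X
  inj₁∈ {X = X} p with ∈-++⁻ (List.map inj₁ X) p
  ... | inj₁ q with ∈-map⁻ inj₁ q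
  ... | _ , a∈ , refl = a∈
  inj₁∈ {X = X} p | inj₂ q with ∈-map⁻ inj₂ q
  ... | _ , _ , ()

  inj₂∈ : ∀ {b : B} {X : List A} {Y : List B} → inj₂ b ∈ˡ List.map inj₁ X ++ List.map inj₂ Y → b ∈ˡ Y
  inj₂∈ {X = X} p with ∈-++⁻ (List.map inj₁ X) p
  ... | inj₂ q with ∈-map⁻ inj₂ q
  ... | _ , b∈ , refl = b∈
  inj₂∈ {X = X} p | inj₁ q with ∈-map⁻ inj₁ q
  ... | _ , _ , ()

  _⊕_ : List A → List B → List (A ⊎ B)
  X ⊕ Y = List.map inj₁ X ++ List.map inj₂ Y

  ∈-⊕₁ : ∀ {a X} Y → a ∈ˡ X → inj₁ a ∈ˡ X ⊕ Y
  ∈-⊕₁ Y a∈ = ∈-++⁺ˡ (∈-map⁺ inj₁ a∈)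

  ∈-⊕₂ : ∀ {b} X {Y} → b ∈ˡ Y → inj₂ b ∈ˡ X ⊕ Y
  ∈-⊕₂ X b∈ = ∈-++⁺ʳ (List.map inj₁ X) (∈-map⁺ inj₂ b∈)

  ⊕-unique : ∀ {X Y} → Unique X → Unique Y → Unique (X ⊕ Y)
  ⊕-unique u v = Unique.++⁺ (Unique.map⁺ inj₁-injective u) (Unique.map⁺ inj₂-injective v)
    λ (p , q) → let _ , _ , eq = ∈-map⁻ inj₁ p ; _ , _ , eq′ = ∈-map⁻ inj₂ q in case trans (sym eq) eq′ of λ ()

  length-⊕ : ∀ X Y → length (X ⊕ Y) ≡ length X + length Y
  length-⊕ X Y = trans (List.length-++ (List.map inj₁ X)) (cong₂ _+_ (List.length-map inj₁ X) (List.length-map inj₂ Y))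

length-allFin : ∀ n → length (List.allFin n) ≡ n
length-allFin n = List.length-tabulate {n = n} (λ i → i)

nonRoots : ∀ j → List (Node j)
nonRoots j = pole true ∷ List.map inner (List.map (Inverse.to (Inner↔ j)) (List.allFin (innerCount j)))

nonRoots-unique : ∀ j → Unique (nonRoots j)
nonRoots-unique j = All.tabulate (λ v∈ → λ { refl → case ∈-map⁻ inner v∈ of λ { (_ , _ , ()) } }) ∷ᵘ
  Unique.map⁺ inner-injective (Unique.map⁺ to-injective (Unique.allFin⁺ (innerCount j)))
  where
  to-injective : ∀ {i i′} → Inverse.to (Inner↔ j) i ≡ Inverse.to (Inner↔ j) i′ → i ≡ i′
  to-injective {i} {i′} eq = trans (sym (Inverse.strictlyInverseʳ (Inner↔ j) i))
    (trans (cong (Inverse.from (Inner↔ j)) eq) (Inverse.strictlyInverseʳ (Inner↔ j) i′))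

length-nonRoots : ∀ j → length (nonRoots j) ≡ suc (innerCount j)
length-nonRoots j = cong suc (trans (List.length-map inner (List.map (Inverse.to (Inner↔ j)) (List.allFin (innerCount j))))
  (trans (List.length-map (Inverse.to (Inner↔ j)) (List.allFin (innerCount j))) (length-allFin (innerCount j))))

∈-nonRoots : ∀ {j} {v : Node j} → v ≢ pole false → v ∈ˡ nonRoots j
∈-nonRoots {v = pole false} v≢ = contradiction refl v≢
∈-nonRoots {v = pole true}  v≢ = hereˡ refl
∈-nonRoots {j} {inner v}    v≢ = thereˡ (∈-map⁺ inner (subst (_∈ˡ List.map (Inverse.to (Inner↔ j)) _)
  (Inverse.strictlyInverseˡ (Inner↔ j) v) (∈-map⁺ (Inverse.to (Inner↔ j)) (∈-allFin (Inverse.from (Inner↔ j) v)))))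

-- There are b padding vertices that are predicted and requested, d₁ that are only predicted
-- and d₂ that are only requested; P lists the predicted nodes of the diamond.
module Padded (j b d₁ d₂ : ℕ) (P : List (Node j)) (P-unique : Unique P) where

  numbering : Numbering j
  numbering = record
    { Pad       = Fin b ⊎ (Fin d₁ ⊎ Fin d₂)
    ; order     = (b + (d₁ + d₂)) + (2 + innerCount j)
    ; size      = (b + (d₁ + d₂)) + 2 ^ j * 2 ^ j
    ; V↔        = Fin.+↔⊎ ⨟ (Pad↔ ⊎-↔ Node↔ j)
    ; E↔        = Fin.+↔⊎ ⨟ (Pad↔ ⊎-↔ Pairs↔ j)
    ; sum-edges = λ f f≡0 → trans (sum-⊎↔ Pad↔ (Pairs↔ j) f f≡0) (sum-Pairs↔ j (λ e → f (inj₂ e)))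
    }
    where
    Pad↔ : Fin (b + (d₁ + d₂)) ↔ (Fin b ⊎ (Fin d₁ ⊎ Fin d₂))
    Pad↔ = Fin.+↔⊎ ⨟ (↔-id (Fin b) ⊎-↔ Fin.+↔⊎)

  open Numbering numbering

  requestedPads predictedPads : List Pad
  requestedPads = List.allFin b ⊕ List.map inj₂ (List.allFin d₂)
  predictedPads = List.allFin b ⊕ List.map inj₁ (List.allFin d₁)

  requestedPads-unique : Unique requestedPads
  requestedPads-unique = ⊕-unique (Unique.allFin⁺ b) (Unique.map⁺ inj₂-injective (Unique.allFin⁺ d₂))

  predicted : List (Pad ⊎ Node j)
  predicted = predictedPads ⊕ P

  predicted-unique : Unique predicted
  predicted-unique = ⊕-unique (⊕-unique (Unique.allFin⁺ b) (Unique.map⁺ inj₁-injective (Unique.allFin⁺ d₁))) P-unique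

  open Diamond numbering using (encode; encode-injective; V)
  open Requests numbering requestedPads requestedPads-unique predicted public

  module _ (s : Vec Bool j) (Q : List (Node j)) (Q-unique : Unique Q)
    (Q⊆ : ∀ {v} → v ∈ˡ Q → v ∈ˡ P × v ∈ˡ upTo j s) (⊆Q : ∀ {v} → v ∈ˡ P → v ∈ˡ upTo j s → v ∈ˡ Q) where

    common : List V
    common = (List.allFin b ⊕ []) ⊕ Q

    common-unique : Unique common
    common-unique = ⊕-unique (⊕-unique (Unique.allFin⁺ b) []ᵘ) Q-unique

    ∈-history₁ : ∀ {p} → inj₁ p ∈ˡ history j s → p ∈ˡ requestedPads
    ∈-history₁ p∈ with ∈-++⁻ (List.map inj₂ (upTo j s)) p∈
    ... | inj₂ q with ∈-map⁻ inj₁ q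
    ... | _ , a∈ , refl = a∈
    ∈-history₁ p∈ | inj₁ q with ∈-map⁻ inj₂ q
    ... | _ , _ , ()

    ∈-history₂ : ∀ {v} → inj₂ v ∈ˡ history j s → v ∈ˡ upTo j s
    ∈-history₂ p∈ with ∈-++⁻ (List.map inj₂ (upTo j s)) p∈
    ... | inj₁ q with ∈-map⁻ inj₂ q
    ... | _ , a∈ , refl = a∈
    ∈-history₂ p∈ | inj₂ q with ∈-map⁻ inj₁ q
    ... | _ , _ , ()

    common⊆ : ∀ {v} → v ∈ˡ common → v ∈ˡ predicted × v ∈ˡ history j s
    common⊆ {inj₂ v} v∈ = let p , q = Q⊆ (inj₂∈ {X = List.allFin b ⊕ []} v∈) in
      ∈-⊕₂ predictedPads p , ∈-++⁺ˡ (∈-map⁺ inj₂ q)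
    common⊆ {inj₁ (inj₁ p)} v∈ =
      ∈-⊕₁ P (∈-⊕₁ (List.map inj₁ (List.allFin d₁)) (∈-allFin p)) ,
      ∈-++⁺ʳ (List.map inj₂ (upTo j s)) (∈-map⁺ inj₁ (∈-⊕₁ (List.map inj₂ (List.allFin d₂)) (∈-allFin p)))
    common⊆ {inj₁ (inj₂ p)} v∈ = case inj₂∈ {X = List.allFin b} (inj₁∈ {X = List.allFin b ⊕ []} v∈) of λ ()

    ⊆common : ∀ {v} → v ∈ˡ predicted → v ∈ˡ history j s → v ∈ˡ common
    ⊆common {inj₂ v} p q = ∈-⊕₂ (List.allFin b ⊕ []) (⊆Q (inj₂∈ {X = predictedPads} p) (∈-history₂ q))
    ⊆common {inj₁ (inj₁ v)} p q = ∈-⊕₁ Q (∈-⊕₁ [] (∈-allFin v))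
    ⊆common {inj₁ (inj₂ v)} p q
      with ∈-map⁻ inj₁ (inj₂∈ {X = List.allFin b} (inj₁∈ {X = predictedPads} p))
         | ∈-map⁻ inj₂ (inj₂∈ {X = List.allFin b} (∈-history₁ q))
    ... | _ , _ , refl | _ , _ , ()

    length-common : length common ≡ b + length Q
    length-common = trans (length-⊕ (List.allFin b ⊕ []) Q) (cong (_+ length Q)
      (trans (length-⊕ (List.allFin b) []) (trans (ℕ.+-identityʳ _) (length-allFin b))))

    length-predicted : length predicted ≡ (b + d₁) + length P
    length-predicted = trans (length-⊕ predictedPads P) (cong (_+ length P)
      (trans (length-⊕ (List.allFin b) (List.map inj₁ (List.allFin d₁))) (cong₂ _+_ (length-allFin b)
        (trans (List.length-map inj₁ (List.allFin d₁)) (length-allFin d₁)))))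

    length-history : length (history j s) ≡ 2 ^ j + (b + d₂)
    length-history = trans (List.length-++ (List.map inj₂ (upTo j s))) (cong₂ _+_
      (trans (List.length-map inj₂ (upTo j s)) (length-upTo j s ℕ.≤-refl))
      (trans (List.length-map inj₁ requestedPads)
        (trans (length-⊕ (List.allFin b) (List.map inj₂ (List.allFin d₂))) (cong₂ _+_ (length-allFin b)
          (trans (List.length-map inj₂ (List.allFin d₂)) (length-allFin d₂))))))

    ∣R̂∣ : ∣ Instance.prediction (instanceFor s) ∣ ≡ length predicted
    ∣R̂∣ = trans (∣listed∣ (Unique.map⁺ encode-injective predicted-unique)) (List.length-map encode predicted)

    ∣R∣ : ∣ Instance.terminals (instanceFor s) ∣ ≡ length (history j s)
    ∣R∣ = trans (∣listed∣ (requests-unique j s)) (List.length-map encode (history j s))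

    ∣R̂∩R∣ : ∣ Instance.prediction (instanceFor s) ∩ Instance.terminals (instanceFor s) ∣ ≡ length common
    ∣R̂∩R∣ = trans (∣listed∩listed∣ {A = List.map encode predicted} {requests j s} {List.map encode common}
      (Unique.map⁺ encode-injective common-unique) to from) (List.length-map encode common)
      where
      to : ∀ {v} → v ∈ˡ List.map encode common → v ∈ˡ List.map encode predicted × v ∈ˡ requests j s
      to v∈ with ∈-map⁻ encode v∈
      ... | u , u∈ , refl = let p , q = common⊆ u∈ in ∈-map⁺ encode p , ∈-map⁺ encode q
      from : ∀ {v} → v ∈ˡ List.map encode predicted → v ∈ˡ requests j s → v ∈ˡ List.map encode common
      from p q with ∈-map⁻ encode p | ∈-map⁻ encode q
      ... | u , u∈ , refl | u′ , u′∈ , eq = ∈-map⁺ encode (⊆common u∈ (subst (_∈ˡ history j s) (sym (encode-injective eq)) u′∈))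

    -- `Q` lists the diamond nodes both predicted and requested. The two differences follow from the
    -- sizes of the sets by cancelling their intersection.
    hasSizes : ∀ {n k Δ₁ Δ₂} → (b + d₁) + length P ≡ n → 2 ^ j + (b + d₂) ≡ k →
      (b + length Q) + Δ₁ ≡ n → (b + length Q) + Δ₂ ≡ k → HasSizes n k Δ₁ Δ₂ (instanceFor s)
    hasSizes {n} {k} {Δ₁} {Δ₂} n≡ k≡ Δ₁≡ Δ₂≡ = record
      { ∣R̂∣≡n    = R̂≡n
      ; ∣R∣≡k    = R≡k
      ; ∣R̂─R∣≡Δ₁ = ℕ.+-cancelˡ-≡ (b + length Q) _ _ (trans (cong (_+ ∣ R̂ ─ R ∣) (sym ∩≡))
          (trans (sym (∣p∣≡∣p∩q∣+∣p─q∣ R̂ R)) (trans R̂≡n (sym Δ₁≡))))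
      ; ∣R─R̂∣≡Δ₂ = ℕ.+-cancelˡ-≡ (b + length Q) _ _ (trans (cong (_+ ∣ R ─ R̂ ∣) (sym (trans (cong ∣_∣ (Subset.∩-comm R R̂)) ∩≡)))
          (trans (sym (∣p∣≡∣p∩q∣+∣p─q∣ R R̂)) (trans R≡k (sym Δ₂≡))))
      }
      where
      R̂ R : Subset order
      R̂ = Instance.prediction (instanceFor s)
      R = Instance.terminals (instanceFor s)
      R̂≡n : ∣ R̂ ∣ ≡ n
      R̂≡n = trans ∣R̂∣ (trans length-predicted n≡)
      R≡k : ∣ R ∣ ≡ k
      R≡k = trans ∣R∣ (trans length-history k≡)
      ∩≡ : ∣ R̂ ∩ R ∣ ≡ b + length Q
      ∩≡ = trans ∣R̂∩R∣ length-common

-- Choice of the parameters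

⌊n/2⌋+⌊n/2⌋≤n : ∀ n → ⌊ n /2⌋ + ⌊ n /2⌋ ≤ n
⌊n/2⌋+⌊n/2⌋≤n n = ℕ.≤-trans (ℕ.+-monoʳ-≤ ⌊ n /2⌋ (ℕ.⌊n/2⌋≤⌈n/2⌉ n)) (ℕ.≤-reflexive (ℕ.⌊n/2⌋+⌈n/2⌉≡n n))

n≤1+⌊n/2⌋+⌊n/2⌋ : ∀ n → n ≤ suc (⌊ n /2⌋ + ⌊ n /2⌋)
n≤1+⌊n/2⌋+⌊n/2⌋ 0             = z≤n
n≤1+⌊n/2⌋+⌊n/2⌋ 1             = s≤s z≤n
n≤1+⌊n/2⌋+⌊n/2⌋ (suc (suc n)) = s≤s (ℕ.≤-trans (s≤s (n≤1+⌊n/2⌋+⌊n/2⌋ n))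
  (ℕ.≤-reflexive (cong suc (sym (ℕ.+-suc ⌊ n /2⌋ ⌊ n /2⌋)))))

innerCount-≤ : ∀ j → suc (innerCount j) ≤ 2 ^ (j + j)
innerCount-≤ zero    = s≤s z≤n
innerCount-≤ (suc j) = begin
  3 + 2 * (2 * innerCount j)   ≤⟨ ℕ.n≤1+n _ ⟩
  4 + 2 * (2 * innerCount j)   ≡⟨ solve 1 (λ a → con 4 :+ con 2 :* (con 2 :* a) := con 2 :* (con 2 :* (con 1 :+ a))) refl (innerCount j) ⟩
  2 * (2 * suc (innerCount j)) ≤⟨ ℕ.*-monoʳ-≤ 2 (ℕ.*-monoʳ-≤ 2 (innerCount-≤ j)) ⟩
  2 ^ suc (suc (j + j))        ≡⟨ cong (λ e → 2 ^ suc e) (ℕ.+-suc j j) ⟨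
  2 ^ (suc j + suc j)          ∎
  where
  open ℕ.≤-Reasoning
  open ℕ-Solver

innerCount-≥ : ∀ j → 2 ^ j ≤ suc (innerCount j)
innerCount-≥ zero    = s≤s z≤n
innerCount-≥ (suc j) = begin
  2 * 2 ^ j                    ≤⟨ ℕ.*-monoʳ-≤ 2 (innerCount-≥ j) ⟩
  2 * suc (innerCount j)       ≡⟨ solve 1 (λ a → con 2 :* (con 1 :+ a) := con 2 :+ con 2 :* a) refl (innerCount j) ⟩
  2 + 2 * innerCount j         ≤⟨ ℕ.+-mono-≤ (ℕ.n≤1+n 2) (ℕ.*-monoʳ-≤ 2 (ℕ.m≤m+n (innerCount j) _)) ⟩
  3 + 2 * (2 * innerCount j)   ∎
  where
  open ℕ.≤-Reasoning
  open ℕ-Solver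

3+j+j≤ : ∀ j → suc (suc (suc (j + j))) ≤ 3 * suc j
3+j+j≤ j = ℕ.≤-trans (ℕ.m≤m+n (3 + (j + j)) j) (ℕ.≤-reflexive
  (solve 1 (λ a → (con 3 :+ (a :+ a)) :+ a := con 3 :* (con 1 :+ a)) refl j))
  where open ℕ-Solver

<2^⌊log₂⌋ : ∀ {m} N → m ≤ 2 * N → m ≤ 2 ^ suc (suc ⌊log₂ N ⌋)
<2^⌊log₂⌋ N m≤ = ℕ.≤-trans m≤ (ℕ.*-monoʳ-≤ 2 (ℕ.<⇒≤ (<2^1+⌊log₂⌋ N)))

HardAdversary : (n k Δ₁ Δ₂ : ℕ) → ℕ → Set₁
HardAdversary n k Δ₁ Δ₂ M = Σ (Adversary n k Δ₁ Δ₂) λ adv → (alg : RandomizedAlgorithm) →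
  CompetitiveRatioAtLeast (fromℚ constant *ᴿ log₂ M) adv alg

-- All `2 ^ j` diamond terminals are prediction errors, which `Δ₂` must pay for, so the depth is
-- `⌊log₂ Δ₂ ⌋`. Padding supplies the `m` correct predictions, the `Δ₁` wrong ones and the remaining
-- `Δ₂ ∸ 2 ^ j` errors.
unpredicted : ∀ {m Δ₁ Δ₂} M → 1 ≤ Δ₂ → M ≤ 2 * Δ₂ → HardAdversary (m + Δ₁) (m + Δ₂) Δ₁ Δ₂ M
unpredicted {m} {Δ₁} {Δ₂} M 1≤Δ₂ M≤ =
  Game.adversary numbering requestedPads requestedPads-unique predicted sizes , λ alg →
  Game.competitive numbering requestedPads requestedPads-unique predicted sizes alg M (suc (suc j))
    (log₂-≤ M (suc (suc j)) (<2^⌊log₂⌋ Δ₂ M≤)) (ℕ.≤-trans (ℕ.≤-trans (ℕ.n≤1+n _) (s≤s (s≤s (s≤s (ℕ.m≤m+n j j))))) (3+j+j≤ j))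
  where
  j : ℕ
  j = ⌊log₂ Δ₂ ⌋
  open Padded j m Δ₁ (Δ₂ ∸ 2 ^ j) [] []ᵘ
  sizes : ∀ s → HasSizes (m + Δ₁) (m + Δ₂) Δ₁ Δ₂ (instanceFor s)
  sizes s = hasSizes s [] []ᵘ (λ ()) (λ ())
    (ℕ.+-identityʳ (m + Δ₁))
    (begin
      2 ^ j + (m + (Δ₂ ∸ 2 ^ j))   ≡⟨ solve 3 (λ a b c → a :+ (b :+ c) := b :+ (a :+ c)) refl (2 ^ j) m (Δ₂ ∸ 2 ^ j) ⟩
      m + (2 ^ j + (Δ₂ ∸ 2 ^ j))   ≡⟨ cong (m +_) (ℕ.m+[n∸m]≡n (2^⌊log₂⌋≤ Δ₂ 1≤Δ₂)) ⟩
      m + Δ₂                       ∎)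
    (cong (_+ Δ₁) (ℕ.+-identityʳ m))
    (cong (_+ Δ₂) (ℕ.+-identityʳ m))
    where
    open ≡-Reasoning
    open ℕ-Solver

-- The `2 ^ j` diamond terminals hide among `I` predicted nodes. They count towards `m`, the decoys
-- towards `Δ₁`, so it suffices that `I` is at most `m ⊓ Δ₁`.
allPredicted : ∀ {m Δ₁ Δ₂} M → 1 ≤ m ⊓ Δ₁ → M ≤ 2 * (m ⊓ Δ₁) → HardAdversary (m + Δ₁) (m + Δ₂) Δ₁ Δ₂ M
allPredicted {m} {Δ₁} {Δ₂} M 1≤N M≤ =
  Game.adversary numbering requestedPads requestedPads-unique predicted sizes , λ alg →
  Game.competitive numbering requestedPads requestedPads-unique predicted sizes alg M (suc (suc ⌊log₂ m ⊓ Δ₁ ⌋))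
    (log₂-≤ M (suc (suc ⌊log₂ m ⊓ Δ₁ ⌋)) (<2^⌊log₂⌋ (m ⊓ Δ₁) M≤))
    -- Halving loses at most one, so the logarithm is at most `3 + (j + j)`; for `j = 0` this equals
    -- `3 * suc j`, the origin of the factor 3.
    (ℕ.≤-trans (s≤s (s≤s (n≤1+⌊n/2⌋+⌊n/2⌋ ⌊log₂ m ⊓ Δ₁ ⌋))) (3+j+j≤ j))
  where
  j I : ℕ
  -- Half of the logarithm, because `I` may be as large as `4 ^ j`.
  j = ⌊ ⌊log₂ m ⊓ Δ₁ ⌋ /2⌋
  I = suc (innerCount j)
  open Padded j (m ∸ 2 ^ j) (Δ₁ ∸ (I ∸ 2 ^ j)) Δ₂ (nonRoots j) (nonRoots-unique j)

  I≤ : I ≤ m ⊓ Δ₁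
  I≤ = ℕ.≤-trans (innerCount-≤ j) (ℕ.≤-trans (ℕ.^-monoʳ-≤ 2 (⌊n/2⌋+⌊n/2⌋≤n ⌊log₂ m ⊓ Δ₁ ⌋)) (2^⌊log₂⌋≤ (m ⊓ Δ₁) 1≤N))

  m≡ : (m ∸ 2 ^ j) + 2 ^ j ≡ m
  m≡ = ℕ.m∸n+n≡m (ℕ.≤-trans (innerCount-≥ j) (ℕ.≤-trans I≤ (ℕ.m⊓n≤m m Δ₁)))

  common≡ : ∀ s → (m ∸ 2 ^ j) + length (upTo j s) ≡ m
  common≡ s = trans (cong ((m ∸ 2 ^ j) +_) (length-upTo j s ℕ.≤-refl)) m≡

  sizes : ∀ s → HasSizes (m + Δ₁) (m + Δ₂) Δ₁ Δ₂ (instanceFor s)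
  sizes s = hasSizes s (upTo j s) (upTo-unique j s)
    (λ v∈ → ∈-nonRoots (λ { refl → root∉upTo j s v∈ }) , v∈) (λ _ v∈ → v∈)
    (begin
      ((m ∸ 2 ^ j) + d) + length (nonRoots j)
        ≡⟨ cong (((m ∸ 2 ^ j) + d) +_) (trans (length-nonRoots j) (sym (ℕ.m+[n∸m]≡n (innerCount-≥ j)))) ⟩
      ((m ∸ 2 ^ j) + d) + (2 ^ j + (I ∸ 2 ^ j))
        ≡⟨ solve 4 (λ a b c e → (a :+ b) :+ (c :+ e) := (a :+ c) :+ (b :+ e)) refl (m ∸ 2 ^ j) d (2 ^ j) (I ∸ 2 ^ j) ⟩
      ((m ∸ 2 ^ j) + 2 ^ j) + (d + (I ∸ 2 ^ j))
        ≡⟨ cong₂ _+_ m≡ (ℕ.m∸n+n≡m (ℕ.≤-trans (ℕ.m∸n≤m I (2 ^ j)) (ℕ.≤-trans I≤ (ℕ.m⊓n≤n m Δ₁)))) ⟩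
      m + Δ₁ ∎)
    (begin
      2 ^ j + ((m ∸ 2 ^ j) + Δ₂)   ≡⟨ solve 3 (λ a b c → a :+ (b :+ c) := (b :+ a) :+ c) refl (2 ^ j) (m ∸ 2 ^ j) Δ₂ ⟩
      ((m ∸ 2 ^ j) + 2 ^ j) + Δ₂   ≡⟨ cong (_+ Δ₂) m≡ ⟩
      m + Δ₂                       ∎)
    (cong (_+ Δ₁) (common≡ s))
    (cong (_+ Δ₂) (common≡ s))
    where
    open ≡-Reasoning
    open ℕ-Solver
    d : ℕ
    d = Δ₁ ∸ (I ∸ 2 ^ j)

halve-≤ : ∀ {M a b} → M ≤ a + b → 2 * b < M → M ≤ 2 * a
halve-≤ {M} {a} {b} M≤ 2b<M = ℕ.+-cancelʳ-≤ (2 * b) M (2 * a) (begin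
  M + 2 * b        ≤⟨ ℕ.+-monoʳ-≤ M (ℕ.<⇒≤ 2b<M) ⟩
  M + M            ≤⟨ ℕ.+-mono-≤ M≤ M≤ ⟩
  (a + b) + (a + b) ≡⟨ solve 2 (λ a b → (a :+ b) :+ (a :+ b) := con 2 :* a :+ con 2 :* b) refl a b ⟩
  2 * a + 2 * b    ∎)
  where
  open ℕ.≤-Reasoning
  open ℕ-Solver

positive-half : ∀ {M a} → 2 ≤ M → M ≤ 2 * a → 1 ≤ a
positive-half {a = zero}  2≤M M≤ = contradiction (ℕ.≤-trans 2≤M M≤) λ ()
positive-half {a = suc a} 2≤M M≤ = s≤s z≤n

-- If `Δ₂` is less than half of `M`, then both `m` and `Δ₁` are at least half of it, since either
-- one together with `Δ₂` reaches `M`.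
hardAdversary : ∀ m Δ₁ Δ₂ M → M ≤ m + Δ₂ → M ≤ Δ₁ + Δ₂ → 2 ≤ M → HardAdversary (m + Δ₁) (m + Δ₂) Δ₁ Δ₂ M
hardAdversary m Δ₁ Δ₂ M M≤k M≤Δ 2≤M = [ few , many ]′ (ℕ.≤-<-connex M (2 * Δ₂))
  where
  few : M ≤ 2 * Δ₂ → HardAdversary (m + Δ₁) (m + Δ₂) Δ₁ Δ₂ M
  few M≤ = unpredicted M (positive-half {a = Δ₂} 2≤M M≤) M≤
  many : 2 * Δ₂ < M → HardAdversary (m + Δ₁) (m + Δ₂) Δ₁ Δ₂ M
  many 2Δ₂<M = allPredicted M (positive-half {a = m ⊓ Δ₁} 2≤M M≤) M≤
    where
    M≤ : M ≤ 2 * (m ⊓ Δ₁)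
    M≤ = ℕ.≤-trans (ℕ.⊓-glb (halve-≤ {a = m} M≤k 2Δ₂<M) (halve-≤ {a = Δ₁} M≤Δ 2Δ₂<M))
      (ℕ.≤-reflexive (sym (ℕ.*-distribˡ-⊓ 2 m Δ₁)))

theoremD1 : Σ ℝ λ c₀ → 0ᴿ <ᴿ c₀ ×
    ((n k Δ₁ Δ₂ : ℕ) → Δ₁ ≤ n → Δ₂ ≤ k → n ∸ Δ₁ ≡ k ∸ Δ₂ → 2 ≤ k ⊓ (Δ₁ + Δ₂) →
    Σ (Adversary n k Δ₁ Δ₂) λ adv → (alg : RandomizedAlgorithm) →
    CompetitiveRatioAtLeast (c₀ *ᴿ log₂ (k ⊓ (Δ₁ + Δ₂))) adv alg)
theoremD1 = fromℚ constant , (constant , _ , 0 , λ _ _ → ℚ.≤-reflexive (ℚ.+-identityˡ constant)) , construct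
  where
  construct : ∀ n k Δ₁ Δ₂ → Δ₁ ≤ n → Δ₂ ≤ k → n ∸ Δ₁ ≡ k ∸ Δ₂ → 2 ≤ k ⊓ (Δ₁ + Δ₂) →
    HardAdversary n k Δ₁ Δ₂ (k ⊓ (Δ₁ + Δ₂))
  -- With `m = n ∸ Δ₁`, the number of correct predictions, the sizes become `n = m + Δ₁` and
  -- `k = m + Δ₂`.
  construct n k Δ₁ Δ₂ Δ₁≤n Δ₂≤k n∸Δ₁≡k∸Δ₂ = subst₂
    (λ n k → 2 ≤ k ⊓ (Δ₁ + Δ₂) → HardAdversary n k Δ₁ Δ₂ (k ⊓ (Δ₁ + Δ₂)))
    (ℕ.m∸n+n≡m Δ₁≤n) (trans (cong (_+ Δ₂) n∸Δ₁≡k∸Δ₂) (ℕ.m∸n+n≡m Δ₂≤k))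
    (hardAdversary (n ∸ Δ₁) Δ₁ Δ₂ _ (ℕ.m⊓n≤m _ (Δ₁ + Δ₂)) (ℕ.m⊓n≤n (n ∸ Δ₁ + Δ₂) (Δ₁ + Δ₂)))
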